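{- Let $q$ be a prime power, $\ell$ a prime with $\ell\nmid q$, and $g\ge 0$ an integer. Let $\mathfrak{Q}(q,\ell,g)$ be the proportion of matrices in $\mathrm{GSp}_{2g}^{(q)}(\mathbb{F}_\ell)$ having $1$ as an eigenvalue. Then \[ \mathfrak{Q}(q,\ell,g) = \begin{cases} \displaystyle - \sum_{r=1}^g\ell^r \prod_{j=1}^r (1-\ell^{2j})^{ -1} & \text{if } \ell \mid q-1, \\ \displaystyle - \sum_{r=1}^g \prod_{j=1}^r (1-\ell^j)^{ -1} & \text{if } \ell \nmid q-1. \end{cases}\]
   Context: Let $\Omega=\begin{pmatrix}0&\mathbb{I}_g\\-\mathbb{I}_g&0\end{pmatrix}$ ($2g\times 2g$) and $\mathrm{GSp}_{2g}^{(q)}(\mathbb{F}_\ell)=\{M\in\mathrm{GL}_{2g}(\mathbb{F}_\ell): {}^tM\Omega M=q\Omega\}$, with $q$ read modulo $\ell$. For $g=0$ the set consists of a single matrix which does not have eigenvalue $1$, so $\mathfrak{Q}(q,\ell,0)=0$ (empty sum). -}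

module Defs where

open import Data.Nat as ℕ using (ℕ; zero; suc; _+_; _*_; _∸_; _^_; _<_; _≥_; NonZero)
open import Data.Nat.DivMod using (_mod_)
open import Data.Nat.Primality using (Prime)
open import Data.Fin as Fin using (Fin; toℕ)
open import Data.Fin.Properties using () renaming (_≟_ to _≟F_)
open import Data.Vec as Vec using (Vec; []; _∷_)
open import Data.Vec.Properties using (≡-dec)
open import Data.List as List using (List; [_]; cartesianProductWith; allFin; filter; length)
open import Data.List.Membership.Propositional using (_∈_)
open import Data.List.Membership.Propositional.Properties using (∈-cartesianProductWith⁺; ∈-allFin)
open import Data.List.Relation.Unary.Any as Any using (Any; here; there; any?; satisfied)
open import Data.Bool using (if_then_else_; _∧_)
open import Data.Product using (Σ; ∃; _×_; _,_)
open import Data.Integer as ℤ using (ℤ; +_; -[1+_])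
open import Data.Rational as ℚ using (ℚ; mkℚ; 1/_; 0ℚ)
open import Relation.Nullary using (Dec; yes; no; ¬_; ¬?; _×-dec_; does)
open import Relation.Unary using (Pred; Decidable)
open import Relation.Binary.PropositionalEquality using (_≡_; _≢_; refl)
open import Level using (0ℓ)

IsPrimePower : ℕ → Set
IsPrimePower q = Σ ℕ λ p → Σ ℕ λ k → Prime p × k ≥ 1 × q ≡ p ^ k

module Field (ℓ : ℕ) {{_ : NonZero ℓ}} where

  F : Set
  F = Fin ℓ

  ι : ℕ → F
  ι n = n mod ℓ

  0F 1F : F
  0F = ι 0
  1F = ι 1

  _+F_ _*F_ : F → F → F
  a +F b = ι (toℕ a + toℕ b)
  a *F b = ι (toℕ a * toℕ b)

  -F_ : F → F
  -F a = ι (ℓ ∸ toℕ a)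

  Vecₗ : ℕ → Set
  Vecₗ n = Vec F n

  Mat : ℕ → Set
  Mat n = Vec (Vec F n) n

  dot : ∀ {n} → Vec F n → Vec F n → F
  dot u v = Vec.foldr _ _+F_ 0F (Vec.zipWith _*F_ u v)

  _·_ : ∀ {n} → Mat n → Vec F n → Vec F n
  M · v = Vec.map (λ row → dot row v) M

  _⊗_ : ∀ {n} → Mat n → Mat n → Mat n
  A ⊗ B = Vec.map (λ row → Vec.map (λ col → dot row col) (Vec.transpose B)) A

  ᵗ_ : ∀ {n} → Mat n → Mat n
  ᵗ M = Vec.transpose M

  scale : ∀ {n} → F → Mat n → Mat n
  scale c M = Vec.map (Vec.map (c *F_)) M

  zeroVec : ∀ {n} → Vec F n
  zeroVec = Vec.replicate _ 0F

  -- Ω = ( 0  I_g ; -I_g  0 ), of size 2g × 2g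
  Ω : (g : ℕ) → Mat (2 * g)
  Ω g = Vec.tabulate λ i → Vec.tabulate λ j →
    if does (toℕ i ℕ.<? g) ∧ does (toℕ j ℕ.≟ toℕ i + g) then 1F
    else if does (toℕ j + g ℕ.≟ toℕ i) then -F 1F
    else 0F

  -- GSp^{(q)}_{2g}(F_ℓ) : matrices M with  ᵗM Ω M = q Ω  (q read mod ℓ).
  -- (Such M are automatically invertible since q ≢ 0 mod ℓ; we still
  -- impose nothing extra: invertibility follows from the equation.)
  InGSp : (q g : ℕ) → Mat (2 * g) → Set
  InGSp q g M = (ᵗ M) ⊗ (Ω g ⊗ M) ≡ scale (ι q) (Ω g)

  HasEigenvalue1 : ∀ {n} → Mat n → Set
  HasEigenvalue1 {n} M = ∃ λ (v : Vec F n) → v ≢ zeroVec × M · v ≡ v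

  allVecsOf : ∀ {A : Set} → List A → (n : ℕ) → List (Vec A n)
  allVecsOf L zero    = [ [] ]
  allVecsOf L (suc n) = cartesianProductWith _∷_ L (allVecsOf L n)

  allVecsOf-complete : ∀ {A : Set} (L : List A) → (∀ a → a ∈ L) →
                       ∀ {n} (v : Vec A n) → v ∈ allVecsOf L n
  allVecsOf-complete L c []       = here refl
  allVecsOf-complete L c (x ∷ xs) =
    ∈-cartesianProductWith⁺ _∷_ (c x) (allVecsOf-complete L c xs)

  allVecs : (n : ℕ) → List (Vec F n)
  allVecs n = allVecsOf (allFin ℓ) n

  allMats : (n : ℕ) → List (Mat n)
  allMats n = allVecsOf (allVecs n) n

  _≟V_ : ∀ {n} (u v : Vec F n) → Dec (u ≡ v)
  _≟V_ = ≡-dec _≟F_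

  _≟M_ : ∀ {n} (A B : Mat n) → Dec (A ≡ B)
  _≟M_ = ≡-dec _≟V_

  InGSp? : (q g : ℕ) → Decidable (InGSp q g)
  InGSp? q g M = ((ᵗ M) ⊗ (Ω g ⊗ M)) ≟M scale (ι q) (Ω g)

  private
    lose : ∀ {A : Set} {P : A → Set} {x : A} {xs : List A} → x ∈ xs → P x → Any P xs
    lose (here refl) px = here px
    lose (there x∈) px = there (lose x∈ px)

  HasEigenvalue1? : ∀ {n} → Decidable (HasEigenvalue1 {n})
  HasEigenvalue1? {n} M with any? (λ v → ¬? (v ≟V zeroVec) ×-dec ((M · v) ≟V v)) (allVecs n)
  ... | yes a = yes (satisfied a)
  ... | no ¬a = no λ { (v , pv) →
          ¬a (lose (allVecsOf-complete (allFin ℓ) ∈-allFin v) pv) }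

  #GSp : (q g : ℕ) → ℕ
  #GSp q g = length (filter (InGSp? q g) (allMats (2 * g)))

  #GSpEig1 : (q g : ℕ) → ℕ
  #GSpEig1 q g =
    length (filter (λ M → InGSp? q g M ×-dec HasEigenvalue1? M) (allMats (2 * g)))

-- a / b as a rational (b = 0 never occurs below: GSp is nonempty)
ratio : ℕ → ℕ → ℚ
ratio a zero    = 0ℚ
ratio a (suc b) = (+ a) ℚ./ suc b

𝔔 : (q ℓ g : ℕ) → {{_ : NonZero ℓ}} → ℚ
𝔔 q ℓ g = ratio (Field.#GSpEig1 ℓ q g) (Field.#GSp ℓ q g)

-- Multiplicative inverse on ℚ (total; 0 ↦ 0, never used at 0 below).
inv : ℚ → ℚ
inv p@(mkℚ (+ zero) _ _)  = 0ℚ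
inv p@(mkℚ (+ suc _) _ _) = 1/ p
inv p@(mkℚ -[1+ _ ] _ _)  = 1/ p

ℕ→ℚ : ℕ → ℚ
ℕ→ℚ n = (+ n) ℚ./ 1

Σ₁ : ℕ → (ℕ → ℚ) → ℚ
Σ₁ zero    f = 0ℚ
Σ₁ (suc g) f = Σ₁ g f ℚ.+ f (suc g)

Π₁ : ℕ → (ℕ → ℚ) → ℚ
Π₁ zero    f = ℚ.1ℚ
Π₁ (suc r) f = Π₁ r f ℚ.* f (suc r)

RHS-split : ℕ → ℕ → ℚ
RHS-split ℓ g = ℚ.- Σ₁ g (λ r →
  ℕ→ℚ (ℓ ^ r) ℚ.* Π₁ r (λ j → inv (ℚ.1ℚ ℚ.- ℕ→ℚ (ℓ ^ (2 * j)))))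

RHS-nonsplit : ℕ → ℕ → ℚ
RHS-nonsplit ℓ g = ℚ.- Σ₁ g (λ r →
  Π₁ r (λ j → inv (ℚ.1ℚ ℚ.- ℕ→ℚ (ℓ ^ j))))

{-# OPTIONS --safe #-}
-- Möbius inversion over subspaces: if a space over the field with ℓ elements has N elements, then
-- f k = ∏_{i<k} (N - ℓ^i) counts its independent k-tuples, and with p k = ∏_{1≤j≤k} (1 - ℓ^j)⁻¹ the sum
-- of all f k * p k is 1 for the trivial space and 0 otherwise. For an isotropic subspace of a symplectic
-- space of dimension 2g the sum stops at k = g, so it suffices to average f k over the matrices.
--
-- If q ≢ 1, the fixed space of every M in GSp^(q) is isotropic. The number of M that send one isotropic
-- k-frame to another one does not depend on the frames, so the average of f k is 1.
--
-- If q ≡ 1, the M without eigenvalue 1 correspond through B (M - 1) = Ω to the invertible B with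
-- B - ᵗB = - Ω. The kernel of any such B is isotropic, the average of f k over all of them is
-- ∏_{i<k} (1 - ℓ^{2i-2g}), and the q-Chu-Vandermonde identity evaluates the resulting sum.
--
-- All cardinalities come from choosing the columns of a matrix one after the other: the vectors with
-- prescribed pairings against m independent vectors of a space of dimension n number ℓ^{n-m}.

module Submission where

open import Defs
open import Algebra.Bundles using (CommutativeRing)
open import Algebra.Solver.Ring.AlmostCommutativeRing using (fromCommutativeRing; _-Raw-AlmostCommutative⟶_)
open import Data.Bool using (true; false; if_then_else_; _∧_)
open import Data.Fin as Fin using (Fin; zero; suc; toℕ)
import Data.Fin.Properties as FinP
open import Data.Fin.Properties using (toℕ-fromℕ<; toℕ-injective; toℕ<n)
open import Data.Integer as ℤ using (ℤ; -[1+_])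
import Data.Integer.Properties as ℤP
open import Data.List as List using (List; []; _∷_; _++_; allFin; cartesianProductWith; filter; length)
import Data.List.Properties as ListP
open import Data.List.Membership.Propositional using (_∈_; lose)
open import Data.List.Membership.Propositional.Properties using (∈-allFin)
open import Data.List.Relation.Unary.Any as Any using (here; there)
open import Data.Maybe using (Maybe; just; nothing)
open import Data.Nat as ℕ using (ℕ; zero; suc; _∸_; _≤_; _<_; z≤n; s≤s; NonZero)
open import Data.Nat.Coprimality using (prime⇒coprime; coprime-Bézout)
open import Data.Nat.Divisibility using (_∣_; m%n≡0⇒n∣m; n∣m⇒m%n≡0)
open import Data.Nat.DivMod using (_%_; m<n⇒m%n≡m; %-distribˡ-+; %-distribˡ-*; n%n≡0; m%n<n; m*n%n≡0)
open import Data.Nat.GCD using (module Bézout)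
open import Data.Nat.Primality using (Prime; prime⇒nonTrivial)
import Data.Nat.Properties as ℕP
import Data.Nat.Solver
open import Data.Product using (∃; _,_; proj₁; proj₂)
open import Data.Rational as ℚ using (ℚ; mkℚ; 0ℚ; 1ℚ; toℚᵘ)
import Data.Rational.Properties as ℚP
import Data.Rational.Unnormalised as ℚᵘ
import Data.Rational.Unnormalised.Properties as ℚᵘP
open import Data.Sum using (inj₁; inj₂)
open import Data.Unit using (⊤; tt)
open import Data.Vec as Vec using (Vec; []; _∷_)
open import Data.Vec.Properties using (≡-dec; ∷-injective; ∷-injectiveˡ; ∷-injectiveʳ; drop-map; map-∘; map-cong; tabulate-cong; zipWith-is-⊛)
open import Data.Vec.Relation.Unary.All using (All; []; _∷_; all?)
open import Function using (_∘_; id)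
open import Level using (0ℓ)
open import Relation.Binary.Definitions using (tri<; tri≈; tri>)
open import Relation.Binary.PropositionalEquality as ≡ using (_≡_; _≢_; refl; sym; trans; cong; cong₂; subst; subst₂; isEquivalence; module ≡-Reasoning)
open import Relation.Nullary using (Dec; yes; no; ¬_; ¬?; _×-dec_; does; contradiction)
open import Relation.Unary using (Decidable)

-- For q ≡ 1 the fixed space of M need not be isotropic; it can be the whole space. Its frames then
-- have many Gram matrices, and the sum would not stop at g. Passing from M to B repairs this. If x
-- = (M - 1) u and B x = Ω u, the identity ω (M u) (M v) = ω u v becomes B - ᵗB = - Ω, and two
-- vectors x, y killed by B satisfy 0 = ᵗx (B - ᵗB) y = - ᵗx Ω y. Once invertibility is dropped, the
-- matrices B form a coset of the symmetric matrices and are counted by their free entries. After a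
-- symplectic change of basis, killing an isotropic k-frame means that k columns of B vanish. This
-- divides the number of B by the product of ℓ^(2g-i) over i < k, while the isotropic k-frames
-- number ∏ (ℓ^(2g-i) - ℓ^i); the quotient of the two products is the stated average. For k = g the
-- number of pairs (B, frame) is exactly the order of the symplectic group, and this turns a
-- proportion among the B into a proportion among the M.

module RingSolver (R : CommutativeRing 0ℓ 0ℓ) where
  private
    module R = CommutativeRing R
    open import Algebra.Properties.Ring R.ring using (-‿distribˡ-*; -‿involutive; -0#≈0#)
    open import Algebra.Properties.AbelianGroup R.+-abelianGroup using (⁻¹-∙-comm)
    open import Algebra.Properties.Semiring.Mult.TCOptimised R.semiring
    open import Relation.Binary.Reasoning.Setoid R.setoid

  -- With this version of `×`, `1 × R.1#` reduces to `R.1#`, so the constants `:0` and `:1` of the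
  -- solver evaluate to the ring's own 0 and 1 by computation.
  fromℤ : ℤ → R.Carrier
  fromℤ (ℤ.+ n)    = n × R.1#
  fromℤ -[1+ n ] = R.- (suc n × R.1#)

  private
    -‿homo : ∀ i → fromℤ (ℤ.- i) R.≈ R.- fromℤ i
    -‿homo (ℤ.+ zero)  = R.sym -0#≈0#
    -‿homo (ℤ.+ suc n) = R.refl
    -‿homo -[1+ n ]  = R.sym (-‿involutive _)

    ⊖-homo : ∀ m n → fromℤ (m ℤ.⊖ n) R.≈ (m × R.1#) R.- (n × R.1#)
    ⊖-homo m zero = begin
      fromℤ (m ℤ.⊖ 0)            ≡⟨ ≡.cong fromℤ (ℤP.⊖-≥ {m} ℕ.z≤n) ⟩
      m × R.1#                    ≈⟨ R.+-identityʳ _ ⟨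
      m × R.1# R.+ R.0#           ≈⟨ R.+-congˡ (R.sym -0#≈0#) ⟩
      (m × R.1#) R.- (0 × R.1#)   ∎
    ⊖-homo zero (suc n) = R.sym (R.+-identityˡ _)
    ⊖-homo (suc m) (suc n) = begin
      fromℤ (suc m ℤ.⊖ suc n)                       ≡⟨ ≡.cong fromℤ (ℤP.[1+m]⊖[1+n]≡m⊖n m n) ⟩
      fromℤ (m ℤ.⊖ n)                               ≈⟨ ⊖-homo m n ⟩
      m1 R.- n1                                     ≈⟨ R.+-congʳ (R.+-identityʳ _) ⟨
      m1 R.+ R.0# R.- n1                            ≈⟨ R.+-congʳ (R.+-congˡ (R.-‿inverseʳ _)) ⟨
      m1 R.+ (R.1# R.- R.1#) R.- n1                 ≈⟨ R.+-congʳ (R.+-assoc _ _ _) ⟨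
      m1 R.+ R.1# R.- R.1# R.- n1                   ≈⟨ R.+-congʳ (R.+-congʳ (R.+-comm _ _)) ⟩
      R.1# R.+ m1 R.- R.1# R.- n1                   ≈⟨ R.+-assoc _ _ _ ⟩
      R.1# R.+ m1 R.+ (R.- R.1# R.- n1)             ≈⟨ R.+-congˡ (⁻¹-∙-comm _ _) ⟩
      R.1# R.+ m1 R.- (R.1# R.+ n1)                 ≈⟨ R.+-cong (1+× m R.1#) (R.-‿cong (1+× n R.1#)) ⟨
      (suc m × R.1#) R.- (suc n × R.1#)             ∎
      where m1 = m × R.1#
            n1 = n × R.1#

    +-homo : ∀ i j → fromℤ (i ℤ.+ j) R.≈ fromℤ i R.+ fromℤ j
    +-homo (ℤ.+ m) (ℤ.+ n)       = ×-homo-+ R.1# m n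
    +-homo (ℤ.+ m) -[1+ n ]    = ⊖-homo m (suc n)
    +-homo -[1+ m ] (ℤ.+ n)    = R.trans (⊖-homo n (suc m)) (R.+-comm _ _)
    +-homo -[1+ m ] -[1+ n ] = begin
      R.- (suc (suc (m ℕ.+ n)) × R.1#)             ≡⟨ ≡.cong (λ k → R.- (k × R.1#)) (≡.sym (ℕP.+-suc (suc m) n)) ⟩
      R.- ((suc m ℕ.+ suc n) × R.1#)               ≈⟨ R.-‿cong (×-homo-+ R.1# (suc m) (suc n)) ⟩
      R.- ((suc m × R.1#) R.+ (suc n × R.1#))      ≈⟨ ⁻¹-∙-comm _ _ ⟨
      R.- (suc m × R.1#) R.- (suc n × R.1#)        ∎

    *-homo⁺ : ∀ m j → fromℤ (ℤ.+ m ℤ.* j) R.≈ (m × R.1#) R.* fromℤ j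
    *-homo⁺ zero j = begin
      fromℤ (ℤ.0ℤ ℤ.* j)     ≡⟨ ≡.cong fromℤ (ℤP.*-zeroˡ j) ⟩
      R.0#                    ≈⟨ R.zeroˡ _ ⟨
      R.0# R.* fromℤ j        ∎
    *-homo⁺ (suc m) j = begin
      fromℤ (ℤ.suc (ℤ.+ m) ℤ.* j)              ≡⟨ ≡.cong fromℤ (ℤP.suc-* (ℤ.+ m) j) ⟩
      fromℤ (j ℤ.+ ℤ.+ m ℤ.* j)                ≈⟨ +-homo j (ℤ.+ m ℤ.* j) ⟩
      fromℤ j R.+ fromℤ (ℤ.+ m ℤ.* j)          ≈⟨ R.+-cong (R.sym (R.*-identityˡ _)) (*-homo⁺ m j) ⟩
      R.1# R.* fromℤ j R.+ m1 R.* fromℤ j    ≈⟨ R.distribʳ _ _ _ ⟨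
      (R.1# R.+ m1) R.* fromℤ j              ≈⟨ R.*-congʳ (1+× m R.1#) ⟨
      (suc m × R.1#) R.* fromℤ j             ∎
      where m1 = m × R.1#

    *-homo : ∀ i j → fromℤ (i ℤ.* j) R.≈ fromℤ i R.* fromℤ j
    *-homo (ℤ.+ m) j    = *-homo⁺ m j
    *-homo -[1+ m ] j = begin
      fromℤ (-[1+ m ] ℤ.* j)                 ≡⟨ ≡.cong fromℤ (ℤP.neg-distribˡ-* (ℤ.+ suc m) j) ⟨
      fromℤ (ℤ.- (ℤ.+ suc m ℤ.* j))            ≈⟨ -‿homo (ℤ.+ suc m ℤ.* j) ⟩
      R.- fromℤ (ℤ.+ suc m ℤ.* j)              ≈⟨ R.-‿cong (*-homo⁺ (suc m) j) ⟩
      R.- ((suc m × R.1#) R.* fromℤ j)       ≈⟨ -‿distribˡ-* _ _ ⟩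
      R.- (suc m × R.1#) R.* fromℤ j         ∎

    morphism : ℤ.+-*-rawRing -Raw-AlmostCommutative⟶ fromCommutativeRing R
    morphism = record
      { ⟦_⟧ = fromℤ ; +-homo = +-homo ; *-homo = *-homo ; -‿homo = -‿homo
      ; 0-homo = R.refl ; 1-homo = R.refl }

    -- Coefficients are compared in ℤ, where equality computes; in the field with a variable modulus
    -- ℓ it would not. Distinct integers with the same image in `R` are merely left unidentified.
    _coeff≟_ : ∀ i j → Maybe (fromℤ i R.≈ fromℤ j)
    i coeff≟ j with i ℤP.≟ j
    ... | yes refl = just R.refl
    ... | no _     = nothing

  open import Algebra.Solver.Ring ℤ.+-*-rawRing (fromCommutativeRing R) morphism _coeff≟_ public

  :0 :1 : ∀ {m} → Polynomial m
  :0 = con (ℤ.+ 0)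
  :1 = con (ℤ.+ 1)

private module QS = RingSolver ℚP.+-*-commutativeRing

-- Natural numbers and their quotients inside the rationals

module _ where
  open ℚᵘP.≃-Reasoning

  toℚᵘ-ℕ→ℚ : ∀ n → toℚᵘ (ℕ→ℚ n) ℚᵘ.≃ ℚᵘ.mkℚᵘ (ℤ.+ n) 0
  toℚᵘ-ℕ→ℚ n = ℚP.toℚᵘ-fromℚᵘ (ℚᵘ.mkℚᵘ (ℤ.+ n) 0)

  ℕ→ℚ-+ : ∀ m n → ℕ→ℚ (m ℕ.+ n) ≡ ℕ→ℚ m ℚ.+ ℕ→ℚ n
  ℕ→ℚ-+ m n = ℚP.toℚᵘ-injective (begin
    toℚᵘ (ℕ→ℚ (m ℕ.+ n))                    ≈⟨ toℚᵘ-ℕ→ℚ (m ℕ.+ n) ⟩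
    ℚᵘ.mkℚᵘ (ℤ.+ (m ℕ.+ n)) 0                 ≈⟨ ℚᵘ.*≡* (cong (ℤ._* ℤ.+ 1) (sym (cong₂ ℤ._+_ (ℤP.*-identityʳ (ℤ.+ m)) (ℤP.*-identityʳ (ℤ.+ n))))) ⟩
    ℚᵘ.mkℚᵘ (ℤ.+ m) 0 ℚᵘ.+ ℚᵘ.mkℚᵘ (ℤ.+ n) 0    ≈⟨ ℚᵘP.+-cong (toℚᵘ-ℕ→ℚ m) (toℚᵘ-ℕ→ℚ n) ⟨
    toℚᵘ (ℕ→ℚ m) ℚᵘ.+ toℚᵘ (ℕ→ℚ n)          ≈⟨ ℚP.toℚᵘ-homo-+ (ℕ→ℚ m) (ℕ→ℚ n) ⟨
    toℚᵘ (ℕ→ℚ m ℚ.+ ℕ→ℚ n)                  ∎)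

  ℕ→ℚ-* : ∀ m n → ℕ→ℚ (m ℕ.* n) ≡ ℕ→ℚ m ℚ.* ℕ→ℚ n
  ℕ→ℚ-* m n = ℚP.toℚᵘ-injective (begin
    toℚᵘ (ℕ→ℚ (m ℕ.* n))                    ≈⟨ toℚᵘ-ℕ→ℚ (m ℕ.* n) ⟩
    ℚᵘ.mkℚᵘ (ℤ.+ (m ℕ.* n)) 0                 ≈⟨ ℚᵘ.*≡* (cong (ℤ._* ℤ.+ 1) (ℤP.pos-* m n)) ⟩
    ℚᵘ.mkℚᵘ (ℤ.+ m) 0 ℚᵘ.* ℚᵘ.mkℚᵘ (ℤ.+ n) 0    ≈⟨ ℚᵘP.*-cong (toℚᵘ-ℕ→ℚ m) (toℚᵘ-ℕ→ℚ n) ⟨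
    toℚᵘ (ℕ→ℚ m) ℚᵘ.* toℚᵘ (ℕ→ℚ n)          ≈⟨ ℚP.toℚᵘ-homo-* (ℕ→ℚ m) (ℕ→ℚ n) ⟨
    toℚᵘ (ℕ→ℚ m ℚ.* ℕ→ℚ n)                  ∎)

  ℕ→ℚ-injective : ∀ {m n} → ℕ→ℚ m ≡ ℕ→ℚ n → m ≡ n
  ℕ→ℚ-injective {m} {n} eq = ℤP.+-injective (trans (sym (ℤP.*-identityʳ (ℤ.+ m)))
      (trans (ℚᵘP.drop-*≡* mn) (ℤP.*-identityʳ (ℤ.+ n))))
    where
    mn : ℚᵘ.mkℚᵘ (ℤ.+ m) 0 ℚᵘ.≃ ℚᵘ.mkℚᵘ (ℤ.+ n) 0
    mn = begin
      ℚᵘ.mkℚᵘ (ℤ.+ m) 0   ≈⟨ toℚᵘ-ℕ→ℚ m ⟨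
      toℚᵘ (ℕ→ℚ m)      ≡⟨ cong toℚᵘ eq ⟩
      toℚᵘ (ℕ→ℚ n)      ≈⟨ toℚᵘ-ℕ→ℚ n ⟩
      ℚᵘ.mkℚᵘ (ℤ.+ n) 0   ∎

  ratio-* : ∀ a b → b ≢ 0 → ratio a b ℚ.* ℕ→ℚ b ≡ ℕ→ℚ a
  ratio-* a zero    b≢0 = contradiction refl b≢0
  ratio-* a (suc b) _   = ℚP.toℚᵘ-injective (begin
    toℚᵘ (ratio a (suc b) ℚ.* ℕ→ℚ (suc b))            ≈⟨ ℚP.toℚᵘ-homo-* (ratio a (suc b)) (ℕ→ℚ (suc b)) ⟩
    toℚᵘ (ratio a (suc b)) ℚᵘ.* toℚᵘ (ℕ→ℚ (suc b))    ≈⟨ ℚᵘP.*-cong (ℚP.toℚᵘ-fromℚᵘ (ℚᵘ.mkℚᵘ (ℤ.+ a) b)) (toℚᵘ-ℕ→ℚ (suc b)) ⟩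
    ℚᵘ.mkℚᵘ (ℤ.+ a) b ℚᵘ.* ℚᵘ.mkℚᵘ (ℤ.+ suc b) 0          ≈⟨ ℚᵘ.*≡* (trans (ℤP.*-identityʳ _) (cong (λ z → ℤ.+ a ℤ.* ℤ.+ suc z) (sym (ℕP.*-identityʳ b)))) ⟩
    ℚᵘ.mkℚᵘ (ℤ.+ a) 0                                   ≈⟨ toℚᵘ-ℕ→ℚ a ⟨
    toℚᵘ (ℕ→ℚ a)                                      ∎)

*-invʳ : ∀ y → y ≢ 0ℚ → y ℚ.* inv y ≡ 1ℚ
*-invʳ y@(mkℚ (ℤ.+ zero) _ _)      y≢0 = contradiction (ℚP.↥p≡0⇒p≡0 y refl) y≢0
*-invʳ y@(mkℚ (ℤ.+ suc _) _ _)     y≢0 = ℚP.*-inverseʳ y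
*-invʳ y@(mkℚ ℤ.-[1+ _ ] _ _)    y≢0 = ℚP.*-inverseʳ y

-- Identities between rational sums

module RationalSums where
  open ≡-Reasoning
  open import Data.Rational using (_+_; _*_; -_; _-_)

  pw : ℚ → ℕ → ℚ
  pw y zero    = 1ℚ
  pw y (suc n) = y * pw y n

  pw-* : ∀ y z n → pw (y * z) n ≡ pw y n * pw z n
  pw-* y z zero    = refl
  pw-* y z (suc n) = trans (cong (y * z *_) (pw-* y z n))
    (QS.solve 4 (λ a b c d → a QS.:* b QS.:* (c QS.:* d) QS.:= a QS.:* c QS.:* (b QS.:* d)) refl y z (pw y n) (pw z n))

  ℕ→ℚ-^ : ∀ m n → ℕ→ℚ (m ℕ.^ n) ≡ pw (ℕ→ℚ m) n
  ℕ→ℚ-^ m zero    = refl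
  ℕ→ℚ-^ m (suc n) = trans (ℕ→ℚ-* m (m ℕ.^ n)) (cong (ℕ→ℚ m *_) (ℕ→ℚ-^ m n))

  -- Unlike `Σ₁`, this starts at index 0, so that the term of the empty frame can belong to the sum.
  psum : ℕ → (ℕ → ℚ) → ℚ
  psum zero    f = 0ℚ
  psum (suc m) f = psum m f ℚ.+ f m

  psum-cong : ∀ m {f h} → (∀ k → f k ≡ h k) → psum m f ≡ psum m h
  psum-cong zero    eq = refl
  psum-cong (suc m) eq = cong₂ _+_ (psum-cong m eq) (eq m)

  psum-+ : ∀ m f h → psum m (λ k → f k + h k) ≡ psum m f + psum m h
  psum-+ zero    f h = refl
  psum-+ (suc m) f h = trans (cong (_+ (f m + h m)) (psum-+ m f h))
    (solve 4 (λ a b c d → (a :+ b) :+ (c :+ d) := (a :+ c) :+ (b :+ d)) refl (psum m f) (psum m h) (f m) (h m))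
    where open QS

  psum-* : ∀ m c f → psum m (λ k → c * f k) ≡ c * psum m f
  psum-* zero    c f = sym (ℚP.*-zeroʳ c)
  psum-* (suc m) c f = trans (cong (_+ c * f m) (psum-* m c f)) (sym (ℚP.*-distribˡ-+ c (psum m f) (f m)))

  psum-shift : ∀ m f → psum (suc m) f ≡ f 0 + psum m (f ∘ suc)
  psum-shift zero    f = ℚP.+-comm 0ℚ (f 0)
  psum-shift (suc m) f = trans (cong (_+ f (suc m)) (psum-shift m f)) (ℚP.+-assoc (f 0) _ _)

  Σ₁≡psum : ∀ m f → Σ₁ m f ≡ psum m (f ∘ suc)
  Σ₁≡psum zero    f = refl
  Σ₁≡psum (suc m) f = cong (_+ f (suc m)) (Σ₁≡psum m f)

  Σ₁-cong : ∀ m {f h} → (∀ k → f k ≡ h k) → Σ₁ m f ≡ Σ₁ m h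
  Σ₁-cong zero    eq = refl
  Σ₁-cong (suc m) eq = cong₂ _+_ (Σ₁-cong m eq) (eq (suc m))

  Σ₁-* : ∀ m c f → Σ₁ m (λ k → c * f k) ≡ c * Σ₁ m f
  Σ₁-* zero    c f = sym (ℚP.*-zeroʳ c)
  Σ₁-* (suc m) c f = trans (cong (_+ c * f (suc m)) (Σ₁-* m c f)) (sym (ℚP.*-distribˡ-+ c (Σ₁ m f) (f (suc m))))

  -- Telescoped form of Möbius inversion over the subspaces of a space with N elements,
  -- f k being the number of its linearly independent k-tuples and x the size of the field.
  frame-inversion : ∀ (x N : ℚ) (u f : ℕ → ℚ) → (∀ j → (1ℚ - pw x (suc j)) * u (suc j) ≡ 1ℚ) → f 0 ≡ 1ℚ →
    (∀ k → f (suc k) + f k * pw x k ≡ f k * N) →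
    ∀ m → (N - 1ℚ) * (1ℚ + Σ₁ m (λ k → f k * Π₁ k u)) ≡ f (suc m) * Π₁ m u
  frame-inversion x N u f hu f0 rec zero = begin
    (N - 1ℚ) * (1ℚ + 0ℚ)       ≡⟨ solve 1 (λ N → (N :- :1) :* (:1 :+ :0) := :1 :* N :- :1 :* :1) refl N ⟩
    1ℚ * N - 1ℚ * 1ℚ           ≡⟨ cong (λ z → z * N - z * 1ℚ) f0 ⟨
    f 0 * N - f 0 * 1ℚ         ≡⟨ cong (_- f 0 * 1ℚ) (rec 0) ⟨
    f 1 + f 0 * 1ℚ - f 0 * 1ℚ  ≡⟨ solve 2 (λ a b → a :+ b :* :1 :- b :* :1 := a :* :1) refl (f 1) (f 0) ⟩
    f 1 * 1ℚ                   ∎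
    where open QS
  frame-inversion x N u f hu f0 rec (suc m) = begin
    (N - 1ℚ) * (1ℚ + (S + f₁ * (p * U)))
      ≡⟨ solve 5 (λ N S f p U → (N :- :1) :* (:1 :+ (S :+ f :* (p :* U))) :=
                                (N :- :1) :* (:1 :+ S) :+ (N :- :1) :* (f :* (p :* U))) refl N S f₁ p U ⟩
    (N - 1ℚ) * (1ℚ + S) + (N - 1ℚ) * (f₁ * (p * U))
      ≡⟨ cong (_+ (N - 1ℚ) * (f₁ * (p * U))) (frame-inversion x N u f hu f0 rec m) ⟩
    f₁ * p + (N - 1ℚ) * (f₁ * (p * U))
      ≡⟨ solve 4 (λ N f p U → f :* p :+ (N :- :1) :* (f :* (p :* U)) :=
                              f :* p :* :1 :+ (N :- :1) :* (f :* (p :* U))) refl N f₁ p U ⟩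
    f₁ * p * 1ℚ + (N - 1ℚ) * (f₁ * (p * U))
      ≡⟨ cong (λ z → f₁ * p * z + (N - 1ℚ) * (f₁ * (p * U))) (hu m) ⟨
    f₁ * p * ((1ℚ - X) * U) + (N - 1ℚ) * (f₁ * (p * U))
      ≡⟨ solve 5 (λ N f p U X → f :* p :* ((:1 :- X) :* U) :+ (N :- :1) :* (f :* (p :* U)) :=
                                (f :* N :- f :* X) :* (p :* U)) refl N f₁ p U X ⟩
    (f₁ * N - f₁ * X) * (p * U)
      ≡⟨ cong (λ z → (z - f₁ * X) * (p * U)) (rec (suc m)) ⟨
    (f (suc (suc m)) + f₁ * X - f₁ * X) * (p * U)
      ≡⟨ cong (_* (p * U)) (solve 2 (λ a b → a :+ b :- b := a) refl (f (suc (suc m))) (f₁ * X)) ⟩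
    f (suc (suc m)) * (p * U) ∎
    where
    open QS
    f₁ = f (suc m)
    p = Π₁ m u
    U = u (suc m)
    X = pw x (suc m)
    S = Σ₁ m (λ k → f k * Π₁ k u)

  -- The q-series identity behind the case q ≡ 1

  module GaussianIdentity (x r : ℚ) (u v : ℕ → ℚ) (rx : r * x ≡ 1ℚ)
    (hu : ∀ j → (1ℚ - pw x (suc j)) * u (suc j) ≡ 1ℚ)
    (hv : ∀ j → (1ℚ - pw x (suc j) * pw x (suc j)) * v (suc j) ≡ 1ℚ) where
    open QS

    pw-rx : ∀ n → pw x n * pw r n ≡ 1ℚ
    pw-rx n = trans (ℚP.*-comm (pw x n) (pw r n)) (trans (sym (pw-* r x n)) (trans (cong (λ z → pw z n) rx) (pw-1 n)))
      where
      pw-1 : ∀ n → pw 1ℚ n ≡ 1ℚ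
      pw-1 zero    = refl
      pw-1 (suc n) = trans (ℚP.*-identityˡ _) (pw-1 n)

    pw-xr : ∀ k n → pw x (suc k) * pw r (suc n) ≡ pw x k * pw r n
    pw-xr k n = begin
      x * pw x k * (r * pw r n)     ≡⟨ solve 4 (λ x a r b → x :* a :* (r :* b) := r :* x :* (a :* b)) refl x (pw x k) r (pw r n) ⟩
      r * x * (pw x k * pw r n)     ≡⟨ cong (_* (pw x k * pw r n)) rx ⟩
      1ℚ * (pw x k * pw r n)        ≡⟨ ℚP.*-identityˡ _ ⟩
      pw x k * pw r n               ∎

    -- In q-Pochhammer notation with base x: c n k = x^k (x^{-n})_k / (x)_k and d k y = (- y)_k.
    c : ℕ → ℕ → ℚ
    c n zero    = 1ℚ
    c n (suc k) = c n k * (x * u (suc k) * (1ℚ - pw x k * pw r n))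

    d : ℕ → ℚ → ℚ
    d zero    y = 1ℚ
    d (suc k) y = (1ℚ + y) * d k (x * y)

    -- `d` takes its factors from the front by moving the argument to `x * y`, which is what the
    -- induction in `q-Vandermonde` needs; the products `a` and `c` grow at the back.
    d-last : ∀ k y → d (suc k) y ≡ d k y * (1ℚ + pw x k * y)
    d-last zero    y = solve 1 (λ y → (:1 :+ y) :* :1 := :1 :* (:1 :+ :1 :* y)) refl y
    d-last (suc k) y = begin
      (1ℚ + y) * d (suc k) (x * y)                             ≡⟨ cong ((1ℚ + y) *_) (d-last k (x * y)) ⟩
      (1ℚ + y) * (d k (x * y) * (1ℚ + pw x k * (x * y)))       ≡⟨ solve 4 (λ y D X x → (:1 :+ y) :* (D :* (:1 :+ X :* (x :* y))) := (:1 :+ y) :* D :* (:1 :+ x :* X :* y)) refl y (d k (x * y)) (pw x k) x ⟩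
      (1ℚ + y) * d k (x * y) * (1ℚ + x * pw x k * y)           ∎

    c-vanishes : ∀ n → c n (suc n) ≡ 0ℚ
    c-vanishes n = begin
      c n n * (x * u (suc n) * (1ℚ - pw x n * pw r n))   ≡⟨ cong (λ z → c n n * (x * u (suc n) * (1ℚ - z))) (pw-rx n) ⟩
      c n n * (x * u (suc n) * (1ℚ - 1ℚ))                ≡⟨ solve 3 (λ a x u → a :* (x :* u :* (:1 :- :1)) := :0) refl (c n n) x (u (suc n)) ⟩
      0ℚ                                                 ∎

    -- Up to sign and a power of x, `c n k` is the Gaussian binomial coefficient of n and k, and
    -- this is its Pascal rule.
    c-pascal : ∀ n k → c (suc n) (suc k) ≡ c n (suc k) - pw r n * c n k
    c-pascal n zero = begin
      1ℚ * (x * u₁ * (1ℚ - 1ℚ * (r * R)))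
        ≡⟨ solve 4 (λ x u r R → :1 :* (x :* u :* (:1 :- :1 :* (r :* R))) := x :* u :- (r :* x) :* u :* R) refl x u₁ r R ⟩
      x * u₁ - (r * x) * u₁ * R
        ≡⟨ cong (λ z → x * u₁ - z * u₁ * R) rx ⟩
      x * u₁ - 1ℚ * u₁ * R
        ≡⟨ solve 3 (λ x u R → x :* u :- :1 :* u :* R := :1 :* (x :* u :* (:1 :- :1 :* R)) :- R :* ((:1 :- x :* :1) :* u)) refl x u₁ R ⟩
      1ℚ * (x * u₁ * (1ℚ - 1ℚ * R)) - R * ((1ℚ - x * 1ℚ) * u₁)
        ≡⟨ cong (λ z → 1ℚ * (x * u₁ * (1ℚ - 1ℚ * R)) - R * z) (hu 0) ⟩
      1ℚ * (x * u₁ * (1ℚ - 1ℚ * R)) - R * 1ℚ ∎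
      where R = pw r n
            u₁ = u 1
    c-pascal n (suc k) = begin
      c (suc n) (suc k) * (x * U * (1ℚ - pw x (suc k) * pw r (suc n)))
        ≡⟨ cong₂ (λ a b → a * (x * U * (1ℚ - b))) (c-pascal n k) (pw-xr k n) ⟩
      (C₁ - R * C₀) * (x * U * (1ℚ - X * R))
        ≡⟨ solve 6 (λ C₁ R C₀ x U X → (C₁ :- R :* C₀) :* (x :* U :* (:1 :- X :* R)) :=
             C₁ :* (x :* U :* (:1 :- X :* R)) :- R :* U :* (C₀ :* x :* (:1 :- X :* R) :* :1)) refl C₁ R C₀ x U X ⟩
      C₁ * (x * U * (1ℚ - X * R)) - R * U * (C₀ * x * (1ℚ - X * R) * 1ℚ)
        -- The factor 1 is traded for `(1ℚ - x * X) * U₀`, so that `C₀` can be reassembled into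
        -- `C₁`.
        ≡⟨ cong (λ z → C₁ * (x * U * (1ℚ - X * R)) - R * U * (C₀ * x * (1ℚ - X * R) * z)) (hu k) ⟨
      C₁ * (x * U * (1ℚ - X * R)) - R * U * (C₀ * x * (1ℚ - X * R) * ((1ℚ - x * X) * U₀))
        ≡⟨ solve 6 (λ R C₀ x U X U₀ → let C₁ = C₀ :* (x :* U₀ :* (:1 :- X :* R)) in
             C₁ :* (x :* U :* (:1 :- X :* R)) :- R :* U :* (C₀ :* x :* (:1 :- X :* R) :* ((:1 :- x :* X) :* U₀)) :=
             C₁ :* (x :* U :* (:1 :- (x :* X) :* R)) :- R :* C₁ :* ((:1 :- x :* (x :* X)) :* U)) refl R C₀ x U X U₀ ⟩
      C₁ * (x * U * (1ℚ - (x * X) * R)) - R * C₁ * ((1ℚ - x * (x * X)) * U)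
        ≡⟨ cong (λ z → C₁ * (x * U * (1ℚ - (x * X) * R)) - R * C₁ * z) (hu (suc k)) ⟩
      C₁ * (x * U * (1ℚ - (x * X) * R)) - R * C₁ * 1ℚ
        ≡⟨ cong (λ z → C₁ * (x * U * (1ℚ - (x * X) * R)) - z) (ℚP.*-identityʳ (R * C₁)) ⟩
      C₁ * (x * U * (1ℚ - pw x (suc k) * R)) - R * C₁ ∎
      where
      R = pw r n
      X = pw x k
      C₀ = c n k
      C₁ = c n (suc k)
      U₀ = u (suc k)
      U = u (suc (suc k))

    -- For the sum S n y, Pascal's rule gives S (n+1) y = S n y - x^(-n) (1 + y) S n (x y). By
    -- induction the two values are (-y)^n and x^n (-y)^n, which leaves -y (-y)^n. The second value
    -- is why y must stay general.
    q-Vandermonde : ∀ n y → psum (suc n) (λ k → c n k * d k y) ≡ pw (- y) n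
    q-Vandermonde zero    y = refl
    q-Vandermonde (suc n) y = begin
      psum (suc (suc n)) (λ k → c (suc n) k * d k y)
        ≡⟨ psum-shift (suc n) _ ⟩
      1ℚ + psum (suc n) (λ k → c (suc n) (suc k) * d (suc k) y)
        ≡⟨ cong (λ z → 1ℚ + z) (psum-cong (suc n) (λ k → trans (cong (_* d (suc k) y) (c-pascal n k))
             (solve 5 (λ C R C₀ y D → (C :- R :* C₀) :* ((:1 :+ y) :* D) := C :* ((:1 :+ y) :* D) :+ (:- (R :* (:1 :+ y))) :* (C₀ :* D)) refl (c n (suc k)) R (c n k) y (d k (x * y))))) ⟩
      1ℚ + psum (suc n) (λ k → c n (suc k) * d (suc k) y + (- (R * (1ℚ + y))) * (c n k * d k (x * y)))
        ≡⟨ cong (λ z → 1ℚ + z) (trans (psum-+ (suc n) _ _) (cong (λ z → psum (suc n) (λ k → c n (suc k) * d (suc k) y) + z) (psum-* (suc n) (- (R * (1ℚ + y))) (λ k → c n k * d k (x * y))))) ⟩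
      1ℚ + (psum (suc n) (λ k → c n (suc k) * d (suc k) y) + (- (R * (1ℚ + y))) * psum (suc n) (λ k → c n k * d k (x * y)))
        ≡⟨ ℚP.+-assoc 1ℚ (psum (suc n) (λ k → c n (suc k) * d (suc k) y)) ((- (R * (1ℚ + y))) * psum (suc n) (λ k → c n k * d k (x * y))) ⟨
      1ℚ + psum (suc n) (λ k → c n (suc k) * d (suc k) y) + (- (R * (1ℚ + y))) * psum (suc n) (λ k → c n k * d k (x * y))
        ≡⟨ cong₂ (λ a b → a + (- (R * (1ℚ + y))) * b) (sym (psum-shift (suc n) (λ k → c n k * d k y))) (q-Vandermonde n (x * y)) ⟩
      psum (suc n) (λ k → c n k * d k y) + c n (suc n) * d (suc n) y + (- (R * (1ℚ + y))) * pw (- (x * y)) n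
        ≡⟨ cong₂ (λ a b → a + b * d (suc n) y + (- (R * (1ℚ + y))) * pw (- (x * y)) n) (q-Vandermonde n y) (c-vanishes n) ⟩
      Y + 0ℚ * d (suc n) y + (- (R * (1ℚ + y))) * pw (- (x * y)) n
        ≡⟨ cong (λ z → Y + 0ℚ * d (suc n) y + (- (R * (1ℚ + y))) * z)
             (trans (cong (λ z → pw z n) (solve 2 (λ x y → :- (x :* y) := x :* (:- y)) refl x y)) (pw-* x (- y) n)) ⟩
      Y + 0ℚ * d (suc n) y + (- (R * (1ℚ + y))) * (pw x n * Y)
        ≡⟨ solve 5 (λ Y D R y X → Y :+ :0 :* D :+ (:- (R :* (:1 :+ y))) :* (X :* Y) := Y :- (X :* R) :* ((:1 :+ y) :* Y)) refl Y (d (suc n) y) R y (pw x n) ⟩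
      Y - (pw x n * R) * ((1ℚ + y) * Y)
        ≡⟨ cong (λ z → Y - z * ((1ℚ + y) * Y)) (pw-rx n) ⟩
      Y - 1ℚ * ((1ℚ + y) * Y)
        ≡⟨ solve 2 (λ Y y → Y :- :1 :* ((:1 :+ y) :* Y) := (:- y) :* Y) refl Y y ⟩
      - y * Y ∎
      where R = pw r n
            Y = pw (- y) n

    -- For x = ℓ this is the average number of independent k-tuples in the kernel of B, taken over
    -- all B with B - ᵗB = - Ω.
    a : ℕ → ℕ → ℚ
    a g zero    = 1ℚ
    a g (suc k) = a g k * (1ℚ - (pw x k * pw r g) * (pw x k * pw r g))

    -- The factor of index 0 is split off; the factor of index i + 1 for g + 1 equals that of index
    -- i for g, because only the difference of the two numbers enters.
    a-shift : ∀ g k → a (suc g) (suc k) ≡ (1ℚ - pw r (suc g) * pw r (suc g)) * a g k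
    a-shift g zero    = solve 1 (λ R → :1 :* (:1 :- (:1 :* R) :* (:1 :* R)) := (:1 :- R :* R) :* :1) refl (pw r (suc g))
    a-shift g (suc k) = trans (cong₂ (λ p q → p * (1ℚ - q * q)) (a-shift g k) (pw-xr k g)) (ℚP.*-assoc (1ℚ - pw r (suc g) * pw r (suc g)) (a g k) (1ℚ - (pw x k * pw r g) * (pw x k * pw r g)))

    -- Each factor 1 - z² of `a`, with z = x^(i-g), splits as (1 - z) (1 + z): the first halves
    -- build `c g k`, the second ones `d k` at y = x^(-g).
    x^k-p-a≡c-d : ∀ g k → pw x k * (Π₁ k u * a g k) ≡ c g k * d k (pw r g)
    x^k-p-a≡c-d g zero    = refl
    x^k-p-a≡c-d g (suc k) = begin
      x * X * (Π₁ k u * U * (a g k * (1ℚ - (X * R) * (X * R))))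
        ≡⟨ solve 6 (λ x X P U A R → x :* X :* (P :* U :* (A :* (:1 :- (X :* R) :* (X :* R)))) :=
             (X :* (P :* A)) :* (x :* U :* (:1 :- X :* R) :* (:1 :+ X :* R))) refl x X (Π₁ k u) U (a g k) R ⟩
      (X * (Π₁ k u * a g k)) * (x * U * (1ℚ - X * R) * (1ℚ + X * R))
        ≡⟨ cong (_* (x * U * (1ℚ - X * R) * (1ℚ + X * R))) (x^k-p-a≡c-d g k) ⟩
      (c g k * d k R) * (x * U * (1ℚ - X * R) * (1ℚ + X * R))
        ≡⟨ solve 4 (λ C D e f → (C :* D) :* (e :* f) := (C :* e) :* (D :* f)) refl (c g k) (d k R) (x * U * (1ℚ - X * R)) (1ℚ + X * R) ⟩
      (c g k * (x * U * (1ℚ - X * R))) * (d k R * (1ℚ + X * R))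
        ≡⟨ cong (c g (suc k) *_) (d-last k R) ⟨
      c g (suc k) * d (suc k) R ∎
      where X = pw x k
            R = pw r g
            U = u (suc k)

    -- For x = ℓ this is the proportion of invertible matrices among all B with B - ᵗB = - Ω.
    A : ℕ → ℚ
    A g = psum (suc g) (λ k → Π₁ k u * a g k)

    -- Each term is split by 1 = (1 - x^k) + x^k. In the first part 1 - x^k cancels the last factor
    -- of `Π₁ k u`, and an index shift leads back to `A g`; the second part is a `q-Vandermonde`
    -- sum.
    A-suc : ∀ g → A (suc g) ≡ (1ℚ - pw r (suc g) * pw r (suc g)) * A g + pw (- pw r (suc g)) (suc g)
    A-suc g = begin
      psum (suc (suc g)) (λ k → Π₁ k u * a (suc g) k)
        ≡⟨ psum-cong (suc (suc g)) (λ k → solve 2 (λ t X → t := (:1 :- X) :* t :+ X :* t) refl (Π₁ k u * a (suc g) k) (pw x k)) ⟩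
      psum (suc (suc g)) (λ k → (1ℚ - pw x k) * (Π₁ k u * a (suc g) k) + pw x k * (Π₁ k u * a (suc g) k))
        ≡⟨ psum-+ (suc (suc g)) _ _ ⟩
      psum (suc (suc g)) (λ k → (1ℚ - pw x k) * (Π₁ k u * a (suc g) k)) + psum (suc (suc g)) (λ k → pw x k * (Π₁ k u * a (suc g) k))
        ≡⟨ cong₂ _+_ first-part (trans (psum-cong (suc (suc g)) (x^k-p-a≡c-d (suc g))) (q-Vandermonde (suc g) (pw r (suc g)))) ⟩
      w * A g + pw (- pw r (suc g)) (suc g) ∎
      where
      w = 1ℚ - pw r (suc g) * pw r (suc g)
      first-part : psum (suc (suc g)) (λ k → (1ℚ - pw x k) * (Π₁ k u * a (suc g) k)) ≡ w * A g
      first-part = begin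
        psum (suc (suc g)) (λ k → (1ℚ - pw x k) * (Π₁ k u * a (suc g) k))
          ≡⟨ psum-shift (suc g) _ ⟩
        0ℚ + psum (suc g) (λ k → (1ℚ - pw x (suc k)) * (Π₁ (suc k) u * a (suc g) (suc k)))
          ≡⟨ ℚP.+-identityˡ _ ⟩
        psum (suc g) (λ k → (1ℚ - pw x (suc k)) * (Π₁ (suc k) u * a (suc g) (suc k)))
          ≡⟨ psum-cong (suc g) (λ k → trans (cong (λ z → (1ℚ - pw x (suc k)) * (Π₁ (suc k) u * z)) (a-shift g k))
               (trans (solve 5 (λ X p U w A → (:1 :- X) :* (p :* U :* (w :* A)) := ((:1 :- X) :* U) :* (w :* (p :* A))) refl (pw x (suc k)) (Π₁ k u) (u (suc k)) w (a g k))
               (trans (cong (_* (w * (Π₁ k u * a g k))) (hu k)) (ℚP.*-identityˡ _)))) ⟩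
        psum (suc g) (λ k → w * (Π₁ k u * a g k))
          ≡⟨ psum-* (suc g) w _ ⟩
        w * A g ∎

    -- `a g g` is the product of 1 - x^(-2j) for 1 ≤ j ≤ g, and 1 - x^(-2j) = - x^(-2j) (1 -
    -- x^(2j)), where the last factor is cancelled by `v j`.
    a-Π : ∀ g → a g g * Π₁ g v ≡ pw (- pw r g) g * pw r g
    a-Π zero    = refl
    a-Π (suc g) = begin
      a (suc g) (suc g) * (Π₁ g v * V)
        ≡⟨ cong (_* (Π₁ g v * V)) (a-shift g g) ⟩
      (1ℚ - R * R) * a g g * (Π₁ g v * V)
        ≡⟨ solve 4 (λ R A P V → (:1 :- R :* R) :* A :* (P :* V) := (A :* P) :* ((:1 :* :1 :- R :* R) :* V)) refl R (a g g) (Π₁ g v) V ⟩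
      (a g g * Π₁ g v) * ((1ℚ * 1ℚ - R * R) * V)
        ≡⟨ cong₂ (λ p q → p * ((q * q - R * R) * V)) (a-Π g) (sym (pw-rx (suc g))) ⟩
      (pw (- pw r g) g * pw r g) * (((X * R) * (X * R) - R * R) * V)
        ≡⟨ solve 5 (λ q s X R V → (q :* s) :* (((X :* R) :* (X :* R) :- R :* R) :* V) := (q :* s) :* (:- (R :* R)) :* ((:1 :- X :* X) :* V)) refl (pw (- pw r g) g) (pw r g) X R V ⟩
      (pw (- pw r g) g * pw r g) * (- (R * R)) * ((1ℚ - X * X) * V)
        ≡⟨ trans (cong ((pw (- pw r g) g * pw r g) * (- (R * R)) *_) (hv g)) (ℚP.*-identityʳ _) ⟩
      (pw (- pw r g) g * pw r g) * (- (R * R))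
        ≡⟨ solve 3 (λ q s R → (q :* s) :* (:- (R :* R)) := (:- R) :* (s :* q) :* R) refl (pw (- pw r g) g) (pw r g) R ⟩
      (- R) * (pw r g * pw (- pw r g) g) * R
        ≡⟨ cong (λ z → (- R) * z * R) (trans (sym (pw-* r (- pw r g) g)) (cong (λ z → pw z g) (solve 2 (λ r s → r :* (:- s) := :- (r :* s)) refl r (pw r g)))) ⟩
      (- R) * pw (- R) g * R ∎
      where R = pw r (suc g)
            X = pw x (suc g)
            V = v (suc g)

    -- Divided by `a g g`, the recurrence `A-suc` has first coefficient 1, so the sum telescopes; by
    -- `a-Π` the inhomogeneous term becomes the new summand.
    A-closed-form : ∀ g → A g ≡ a g g * (1ℚ + Σ₁ g (λ k → pw x k * Π₁ k v))
    A-closed-form zero    = refl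
    A-closed-form (suc g) = begin
      A (suc g)
        ≡⟨ A-suc g ⟩
      w * A g + pw (- R) (suc g)
        ≡⟨ cong₂ (λ p q → w * p + q) (A-closed-form g) (sym last-term) ⟩
      w * (a g g * Q) + a (suc g) (suc g) * (X * Π₁ (suc g) v)
        ≡⟨ cong (_+ a (suc g) (suc g) * (X * Π₁ (suc g) v)) (trans (sym (ℚP.*-assoc w (a g g) Q)) (cong (_* Q) (sym (a-shift g g)))) ⟩
      a (suc g) (suc g) * Q + a (suc g) (suc g) * (X * Π₁ (suc g) v)
        ≡⟨ solve 3 (λ A S T → A :* (:1 :+ S) :+ A :* T := A :* (:1 :+ (S :+ T))) refl (a (suc g) (suc g)) (Σ₁ g (λ k → pw x k * Π₁ k v)) (X * Π₁ (suc g) v) ⟩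
      a (suc g) (suc g) * (1ℚ + (Σ₁ g (λ k → pw x k * Π₁ k v) + X * Π₁ (suc g) v)) ∎
      where
      R = pw r (suc g)
      X = pw x (suc g)
      w = 1ℚ - R * R
      Q = 1ℚ + Σ₁ g (λ k → pw x k * Π₁ k v)
      last-term : a (suc g) (suc g) * (X * Π₁ (suc g) v) ≡ pw (- R) (suc g)
      last-term = begin
        a (suc g) (suc g) * (X * Π₁ (suc g) v)      ≡⟨ solve 3 (λ A X P → A :* (X :* P) := (A :* P) :* X) refl (a (suc g) (suc g)) X (Π₁ (suc g) v) ⟩
        (a (suc g) (suc g) * Π₁ (suc g) v) * X      ≡⟨ cong (_* X) (a-Π (suc g)) ⟩
        pw (- R) (suc g) * R * X                    ≡⟨ trans (ℚP.*-assoc (pw (- R) (suc g)) R X) (cong (pw (- R) (suc g) *_) (trans (ℚP.*-comm R X) (pw-rx (suc g)))) ⟩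
        pw (- R) (suc g) * 1ℚ                       ≡⟨ ℚP.*-identityʳ _ ⟩
        pw (- R) (suc g)                            ∎

open RationalSums
open import Data.Nat using (_+_; _*_; _^_)
open import Algebra.Properties.CommutativeSemigroup ℕP.*-commutativeSemigroup using (x∙yz≈y∙xz)
open import Data.Product using (_×_)
private module NS = Data.Nat.Solver.+-*-Solver

-- The field with ℓ elements

module PrimeField (ℓ : ℕ) {{nz : NonZero ℓ}} where
  open Field ℓ {{nz}} public
  open ≡-Reasoning

  toℕ-ι : ∀ n → toℕ (ι n) ≡ n % ℓ
  toℕ-ι n = toℕ-fromℕ< (m%n<n n ℓ)

  ι-toℕ : ∀ a → ι (toℕ a) ≡ a
  ι-toℕ a = toℕ-injective (trans (toℕ-ι _) (m<n⇒m%n≡m (toℕ<n a)))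

  ι-cong% : ∀ {m n} → m % ℓ ≡ n % ℓ → ι m ≡ ι n
  ι-cong% {m} {n} eq = toℕ-injective (trans (toℕ-ι m) (trans eq (sym (toℕ-ι n))))

  ι-injective% : ∀ {m n} → ι m ≡ ι n → m % ℓ ≡ n % ℓ
  ι-injective% {m} {n} eq = trans (sym (toℕ-ι m)) (trans (cong toℕ eq) (toℕ-ι n))

  ι-+ : ∀ m n → ι m +F ι n ≡ ι (m ℕ.+ n)
  ι-+ m n = ι-cong% (trans (cong (_% ℓ) (cong₂ ℕ._+_ (toℕ-ι m) (toℕ-ι n))) (sym (%-distribˡ-+ m n ℓ)))

  ι-* : ∀ m n → ι m *F ι n ≡ ι (m ℕ.* n)
  ι-* m n = ι-cong% (trans (cong (_% ℓ) (cong₂ ℕ._*_ (toℕ-ι m) (toℕ-ι n))) (sym (%-distribˡ-* m n ℓ)))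

  ι-ℓ : ι ℓ ≡ 0F
  ι-ℓ = ι-cong% (trans (n%n≡0 ℓ) (sym (m*n%n≡0 0 ℓ)))

  private
    -- Every residue is `ι` of a natural number, so the ring laws need only be checked on values of
    -- `ι`, where they descend from ℕ.
    lift : ∀ {P : F → Set} → (∀ n → P (ι n)) → ∀ a → P a
    lift {P} p a = subst P (ι-toℕ a) (p (toℕ a))

    +F-assoc : ∀ a b c → (a +F b) +F c ≡ a +F (b +F c)
    +F-assoc = lift λ i → lift λ j → lift λ k → begin
      (ι i +F ι j) +F ι k    ≡⟨ cong (_+F ι k) (ι-+ i j) ⟩
      ι (i ℕ.+ j) +F ι k     ≡⟨ ι-+ (i ℕ.+ j) k ⟩
      ι (i ℕ.+ j ℕ.+ k)      ≡⟨ cong ι (ℕP.+-assoc i j k) ⟩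
      ι (i ℕ.+ (j ℕ.+ k))    ≡⟨ ι-+ i (j ℕ.+ k) ⟨
      ι i +F ι (j ℕ.+ k)     ≡⟨ cong (ι i +F_) (ι-+ j k) ⟨
      ι i +F (ι j +F ι k)    ∎

    *F-assoc : ∀ a b c → (a *F b) *F c ≡ a *F (b *F c)
    *F-assoc = lift λ i → lift λ j → lift λ k → begin
      (ι i *F ι j) *F ι k    ≡⟨ cong (_*F ι k) (ι-* i j) ⟩
      ι (i ℕ.* j) *F ι k     ≡⟨ ι-* (i ℕ.* j) k ⟩
      ι (i ℕ.* j ℕ.* k)      ≡⟨ cong ι (ℕP.*-assoc i j k) ⟩
      ι (i ℕ.* (j ℕ.* k))    ≡⟨ ι-* i (j ℕ.* k) ⟨
      ι i *F ι (j ℕ.* k)     ≡⟨ cong (ι i *F_) (ι-* j k) ⟨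
      ι i *F (ι j *F ι k)    ∎

    +F-comm : ∀ a b → a +F b ≡ b +F a
    +F-comm a b = cong ι (ℕP.+-comm (toℕ a) (toℕ b))

    *F-comm : ∀ a b → a *F b ≡ b *F a
    *F-comm a b = cong ι (ℕP.*-comm (toℕ a) (toℕ b))

    +F-identityˡ : ∀ a → 0F +F a ≡ a
    +F-identityˡ = lift λ i → ι-+ 0 i

    *F-identityˡ : ∀ a → 1F *F a ≡ a
    *F-identityˡ = lift λ i → trans (ι-* 1 i) (cong ι (ℕP.*-identityˡ i))

    *F-distribˡ : ∀ a b c → a *F (b +F c) ≡ (a *F b) +F (a *F c)
    *F-distribˡ = lift λ i → lift λ j → lift λ k → begin
      ι i *F (ι j +F ι k)           ≡⟨ cong (ι i *F_) (ι-+ j k) ⟩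
      ι i *F ι (j ℕ.+ k)            ≡⟨ ι-* i (j ℕ.+ k) ⟩
      ι (i ℕ.* (j ℕ.+ k))           ≡⟨ cong ι (ℕP.*-distribˡ-+ i j k) ⟩
      ι (i ℕ.* j ℕ.+ i ℕ.* k)       ≡⟨ ι-+ (i ℕ.* j) (i ℕ.* k) ⟨
      ι (i ℕ.* j) +F ι (i ℕ.* k)    ≡⟨ cong₂ _+F_ (ι-* i j) (ι-* i k) ⟨
      (ι i *F ι j) +F (ι i *F ι k)  ∎

    -F-inverseʳ : ∀ a → a +F (-F a) ≡ 0F
    -F-inverseʳ a = begin
      a +F ι (ℓ ∸ toℕ a)             ≡⟨ cong (_+F ι (ℓ ∸ toℕ a)) (ι-toℕ a) ⟨
      ι (toℕ a) +F ι (ℓ ∸ toℕ a)     ≡⟨ ι-+ (toℕ a) (ℓ ∸ toℕ a) ⟩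
      ι (toℕ a ℕ.+ (ℓ ∸ toℕ a))      ≡⟨ cong ι (ℕP.m+[n∸m]≡n (ℕP.<⇒≤ (toℕ<n a))) ⟩
      ι ℓ                            ≡⟨ ι-ℓ ⟩
      0F                             ∎

  commutativeRing : CommutativeRing 0ℓ 0ℓ
  commutativeRing = record
    { Carrier = F ; _≈_ = _≡_ ; _+_ = _+F_ ; _*_ = _*F_ ; -_ = -F_ ; 0# = 0F ; 1# = 1F
    ; isCommutativeRing = record
      { isRing = record
        { +-isAbelianGroup = record
          { isGroup = record
            { isMonoid = record
              { isSemigroup = record
                { isMagma = record { isEquivalence = isEquivalence ; ∙-cong = cong₂ _+F_ }
                ; assoc = +F-assoc }
              ; identity = +F-identityˡ , λ a → trans (+F-comm a 0F) (+F-identityˡ a) }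
            ; inverse = (λ a → trans (+F-comm (-F a) a) (-F-inverseʳ a)) , -F-inverseʳ
            ; ⁻¹-cong = cong -F_ }
          ; comm = +F-comm }
        ; *-cong = cong₂ _*F_
        ; *-assoc = *F-assoc
        ; *-identity = *F-identityˡ , λ a → trans (*F-comm a 1F) (*F-identityˡ a)
        ; distrib = *F-distribˡ , λ a b c → trans (*F-comm (b +F c) a)
            (trans (*F-distribˡ a b c) (cong₂ _+F_ (*F-comm a b) (*F-comm a c))) }
      ; *-comm = *F-comm } }

  module R = CommutativeRing commutativeRing
  module RS = RingSolver commutativeRing

  ι≡0⇒%≡0 : ∀ {m} → ι m ≡ 0F → m % ℓ ≡ 0
  ι≡0⇒%≡0 eq = trans (ι-injective% eq) (m*n%n≡0 0 ℓ)

  0F≢1F : Prime ℓ → 0F ≢ 1F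
  0F≢1F pr eq = contradiction (trans (sym (m*n%n≡0 0 ℓ)) (trans (ι-injective% eq) (m<n⇒m%n≡m (ℕ.nonTrivial⇒n>1 ℓ {{prime⇒nonTrivial pr}})))) λ ()

  abstract
    -- Bézout for ℓ and the representative of `a`; of its two sign patterns, one gives minus the
    -- inverse. The block is `abstract` so that the Bézout computation does not unfold inside later
    -- terms.
    inverse : Prime ℓ → ∀ a → a ≢ 0F → ∃ λ b → b *F a ≡ 1F
    inverse pr a a≢0 with coprime-Bézout (prime⇒coprime pr {{ℕ.≢-nonZero toℕa≢0}} (toℕ<n a))
      where
      toℕa≢0 : toℕ a ≢ 0
      toℕa≢0 eq = a≢0 (trans (sym (ι-toℕ a)) (cong ι eq))
    ... | Bézout.-+ x y e = ι y , (begin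
        ι y *F a                    ≡⟨ cong (ι y *F_) (ι-toℕ a) ⟨
        ι y *F ι (toℕ a)            ≡⟨ ι-* y (toℕ a) ⟩
        ι (y ℕ.* toℕ a)             ≡⟨ cong ι e ⟨
        ι (1 ℕ.+ x ℕ.* ℓ)           ≡⟨ ι-+ 1 (x ℕ.* ℓ) ⟨
        1F +F ι (x ℕ.* ℓ)           ≡⟨ cong (1F +F_) (trans (sym (ι-* x ℓ)) (trans (cong (ι x *F_) ι-ℓ) (R.zeroʳ (ι x)))) ⟩
        1F +F 0F                    ≡⟨ R.+-identityʳ 1F ⟩
        1F                          ∎)
    ... | Bézout.+- x y e = -F ι y , (begin
        (-F ι y) *F a               ≡⟨ solve 2 (λ y a → (:- y) :* a := :1 :- (:1 :+ y :* a)) refl (ι y) a ⟩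
        1F +F (-F (1F +F (ι y *F a)))  ≡⟨ cong (λ z → 1F +F (-F z)) z≡0 ⟩
        1F +F (-F 0F)               ≡⟨ solve 0 (:1 :- :0 := :1) refl ⟩
        1F                          ∎)
      where
      open RS
      z≡0 : 1F +F (ι y *F a) ≡ 0F
      z≡0 = begin
        1F +F (ι y *F a)            ≡⟨ cong (λ z → 1F +F (ι y *F z)) (ι-toℕ a) ⟨
        1F +F (ι y *F ι (toℕ a))    ≡⟨ cong (1F +F_) (ι-* y (toℕ a)) ⟩
        1F +F ι (y ℕ.* toℕ a)       ≡⟨ ι-+ 1 _ ⟩
        ι (1 ℕ.+ y ℕ.* toℕ a)       ≡⟨ cong ι e ⟩
        ι (x ℕ.* ℓ)                 ≡⟨ ι-* x ℓ ⟨
        ι x *F ι ℓ                  ≡⟨ cong (ι x *F_) ι-ℓ ⟩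
        ι x *F 0F                   ≡⟨ R.zeroʳ (ι x) ⟩
        0F                          ∎

-- Counting over finite types

𝟙 : ∀ {P : Set} → Dec P → ℕ
𝟙 d = if does d then 1 else 0

𝟙-yes : ∀ {P : Set} (d : Dec P) → P → 𝟙 d ≡ 1
𝟙-yes (yes _) p = refl
𝟙-yes (no ¬p) p = contradiction p ¬p

𝟙-no : ∀ {P : Set} (d : Dec P) → ¬ P → 𝟙 d ≡ 0
𝟙-no (yes p) ¬p = contradiction p ¬p
𝟙-no (no _) ¬p = refl

𝟙-cong : ∀ {P Q : Set} (d : Dec P) (e : Dec Q) → (P → Q) → (Q → P) → 𝟙 d ≡ 𝟙 e
𝟙-cong (yes p) e f g = sym (𝟙-yes e (f p))
𝟙-cong (no ¬p) e f g = sym (𝟙-no e (¬p ∘ g))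

𝟙-× : ∀ {P Q : Set} (d : Dec P) (e : Dec Q) → 𝟙 (d ×-dec e) ≡ 𝟙 d * 𝟙 e
𝟙-× (yes p) e = sym (ℕP.*-identityˡ (𝟙 e))
𝟙-× (no ¬p) e = refl

𝟙-¬ : ∀ {P : Set} (d : Dec P) → 𝟙 d + 𝟙 (¬? d) ≡ 1
𝟙-¬ (yes p) = refl
𝟙-¬ (no ¬p) = refl

𝟙-≤1 : ∀ {P : Set} (d : Dec P) → 𝟙 d ≤ 1
𝟙-≤1 (yes p) = s≤s z≤n
𝟙-≤1 (no ¬p) = z≤n

𝟙-mono : ∀ {P Q : Set} (d : Dec P) (e : Dec Q) → (P → Q) → 𝟙 d ≤ 𝟙 e
𝟙-mono (yes p) e f = ℕP.≤-reflexive (sym (𝟙-yes e (f p)))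
𝟙-mono (no ¬p) e f = z≤n

𝟙-*-cong : ∀ {P : Set} (d : Dec P) {m n} → (P → m ≡ n) → 𝟙 d * m ≡ 𝟙 d * n
𝟙-*-cong (yes p) eq = cong (_+ 0) (eq p)
𝟙-*-cong (no ¬p) eq = refl

if-yes : ∀ {P A : Set} (d : Dec P) {x y : A} → P → (if does d then x else y) ≡ x
if-yes (yes _) p = refl
if-yes (no ¬p) p = contradiction p ¬p

if-no : ∀ {P A : Set} (d : Dec P) {x y : A} → ¬ P → (if does d then x else y) ≡ y
if-no (yes p) ¬p = contradiction p ¬p
if-no (no _)  ¬p = refl

∑ : ∀ {A : Set} → List A → (A → ℕ) → ℕ
∑ []      f = 0
∑ (x ∷ L) f = f x + ∑ L f

module _ {A : Set} where

  ∑-cong : ∀ (L : List A) {f g} → (∀ x → f x ≡ g x) → ∑ L f ≡ ∑ L g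
  ∑-cong []      eq = refl
  ∑-cong (x ∷ L) eq = cong₂ _+_ (eq x) (∑-cong L eq)

  ∑-mono : ∀ (L : List A) {f g} → (∀ x → f x ≤ g x) → ∑ L f ≤ ∑ L g
  ∑-mono []      le = z≤n
  ∑-mono (x ∷ L) le = ℕP.+-mono-≤ (le x) (∑-mono L le)

  ∑-zero : ∀ (L : List A) → ∑ L (λ _ → 0) ≡ 0
  ∑-zero []      = refl
  ∑-zero (x ∷ L) = ∑-zero L

  ∑-+ : ∀ (L : List A) f g → ∑ L (λ x → f x + g x) ≡ ∑ L f + ∑ L g
  ∑-+ []      f g = refl
  ∑-+ (x ∷ L) f g = begin
    f x + g x + ∑ L (λ x → f x + g x)  ≡⟨ cong (f x + g x +_) (∑-+ L f g) ⟩
    f x + g x + (∑ L f + ∑ L g)        ≡⟨ solve 4 (λ a b c d → a :+ b :+ (c :+ d) := a :+ c :+ (b :+ d)) refl (f x) (g x) (∑ L f) (∑ L g) ⟩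
    f x + ∑ L f + (g x + ∑ L g)        ∎
    where open ≡-Reasoning
          open NS

  ∑-*ˡ : ∀ (L : List A) c f → ∑ L (λ x → c * f x) ≡ c * ∑ L f
  ∑-*ˡ []      c f = sym (ℕP.*-zeroʳ c)
  ∑-*ˡ (x ∷ L) c f = trans (cong (c * f x +_) (∑-*ˡ L c f)) (sym (ℕP.*-distribˡ-+ c (f x) (∑ L f)))

  ∑-*ʳ : ∀ (L : List A) c f → ∑ L (λ x → f x * c) ≡ ∑ L f * c
  ∑-*ʳ L c f = trans (∑-cong L λ x → ℕP.*-comm (f x) c) (trans (∑-*ˡ L c f) (ℕP.*-comm c _))

  ∑-++ : ∀ (L M : List A) f → ∑ (L ++ M) f ≡ ∑ L f + ∑ M f
  ∑-++ []      M f = refl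
  ∑-++ (x ∷ L) M f = trans (cong (f x +_) (∑-++ L M f)) (sym (ℕP.+-assoc (f x) (∑ L f) (∑ M f)))

  -- The pigeonhole principle in additive form: strict inequality at one member would separate the
  -- totals.
  ∑-≤-≡ : ∀ (L : List A) {f g} → (∀ x → f x ≤ g x) → ∑ L f ≡ ∑ L g → ∀ {x} → x ∈ L → f x ≡ g x
  ∑-≤-≡ (y ∷ L) {f} {g} le eq = λ where
      (here refl) → ℕP.≤-antisym (le y) (ℕP.+-cancelʳ-≤ (∑ L g) (g y) (f y)
        (ℕP.≤-trans (ℕP.≤-reflexive (sym eq)) (ℕP.+-monoʳ-≤ (f y) (∑-mono L le))))
      (there x∈L) → ∑-≤-≡ L le (ℕP.≤-antisym (∑-mono L le) (ℕP.+-cancelˡ-≤ (f y) (∑ L g) (∑ L f)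
        (ℕP.≤-trans (ℕP.+-monoˡ-≤ (∑ L g) (le y)) (ℕP.≤-reflexive (sym eq))))) x∈L

  length-filter-∑ : ∀ {P : A → Set} (P? : Decidable P) L → length (filter P? L) ≡ ∑ L (λ x → 𝟙 (P? x))
  length-filter-∑ P? [] = refl
  length-filter-∑ P? (x ∷ L) with does (P? x)
  ... | true  = cong suc (length-filter-∑ P? L)
  ... | false = length-filter-∑ P? L

∑-swap : ∀ {A B : Set} (L : List A) (M : List B) (f : A → B → ℕ) →
         ∑ L (λ x → ∑ M (f x)) ≡ ∑ M (λ y → ∑ L (λ x → f x y))
∑-swap []      M f = sym (∑-zero M)
∑-swap (x ∷ L) M f = trans (cong (∑ M (f x) +_) (∑-swap L M f)) (sym (∑-+ M (f x) _))

∑-map : ∀ {A B : Set} (g : A → B) L f → ∑ (List.map g L) f ≡ ∑ L (f ∘ g)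
∑-map g []      f = refl
∑-map g (x ∷ L) f = cong (f (g x) +_) (∑-map g L f)

∑-cartesianProductWith : ∀ {A B C : Set} (h : A → B → C) L M f →
  ∑ (cartesianProductWith h L M) f ≡ ∑ L (λ x → ∑ M (λ y → f (h x y)))
∑-cartesianProductWith h []      M f = refl
∑-cartesianProductWith h (x ∷ L) M f = trans (∑-++ (List.map (h x) M) _ f)
  (cong₂ _+_ (∑-map (h x) M f) (∑-cartesianProductWith h L M f))

∑-once⇒∑-δ : ∀ {A : Set} (L : List A) (_≟_ : ∀ (x y : A) → Dec (x ≡ y)) a f →
  ∑ L (λ x → 𝟙 (x ≟ a)) ≡ 1 → ∑ L (λ x → 𝟙 (x ≟ a) * f x) ≡ f a
∑-once⇒∑-δ L _≟_ a f once = begin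
  ∑ L (λ x → 𝟙 (x ≟ a) * f x)  ≡⟨ ∑-cong L (λ x → 𝟙-*-cong (x ≟ a) (cong f)) ⟩
  ∑ L (λ x → 𝟙 (x ≟ a) * f a)  ≡⟨ ∑-*ʳ L (f a) _ ⟩
  ∑ L (λ x → 𝟙 (x ≟ a)) * f a  ≡⟨ cong (_* f a) once ⟩
  1 * f a                      ≡⟨ ℕP.*-identityˡ (f a) ⟩
  f a                          ∎
  where open ≡-Reasoning

-- `once` gives every element multiplicity one, so a sum over `elems` is a sum over the type. For
-- matrices over the field, `elems` is definitionally the list on which the cardinalities in the
-- theorem are taken.
record Enumeration (A : Set) : Set where
  field
    elems    : List A
    _≟_      : (x y : A) → Dec (x ≡ y)
    complete : ∀ a → a ∈ elems
    once     : ∀ a → ∑ elems (λ x → 𝟙 (x ≟ a)) ≡ 1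

  sum : (A → ℕ) → ℕ
  sum = ∑ elems

  search : ∀ {P : A → Set} → Decidable P → Dec (∃ P)
  search P? with Any.any? P? elems
  ... | yes p = yes (Any.satisfied p)
  ... | no ¬p = no λ (a , pa) → ¬p (lose (complete a) pa)

  sum-δ : ∀ a f → sum (λ x → 𝟙 (x ≟ a) * f x) ≡ f a
  sum-δ a f = ∑-once⇒∑-δ elems _≟_ a f (once a)

  sum-unique : ∀ {P : A → Set} (P? : Decidable P) → (∀ {x y} → P x → P y → x ≡ y) → sum (𝟙 ∘ P?) ≤ 1
  sum-unique P? uniq with search P?
  ... | yes (a , pa) = ℕP.≤-trans (∑-mono elems (λ x → 𝟙-mono (P? x) (x ≟ a) (λ px → uniq px pa))) (ℕP.≤-reflexive (once a))
  ... | no ¬∃ = ℕP.≤-trans (ℕP.≤-reflexive (trans (∑-cong elems (λ x → 𝟙-no (P? x) (λ px → ¬∃ (x , px)))) (∑-zero elems))) z≤n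

  sum-single : ∀ {P : A → Set} (P? : Decidable P) a → P a → (∀ x → P x → x ≡ a) → sum (𝟙 ∘ P?) ≡ 1
  sum-single {P} P? a pa uniq = trans (∑-cong elems (λ x → 𝟙-cong (P? x) (x ≟ a) (uniq x) (λ e → subst P (sym e) pa))) (once a)

open Enumeration using (elems; sum; once; search; sum-δ; sum-single)

module _ {A B : Set} (EA : Enumeration A) (EB : Enumeration B) where
  private
    module A = Enumeration EA
    module B = Enumeration EB

  sum-fibres : ∀ (φ : A → B) (f : A → ℕ) → A.sum f ≡ B.sum (λ b → A.sum (λ a → 𝟙 (b B.≟ φ a) * f a))
  sum-fibres φ f = trans (∑-cong A.elems (λ a → sym (B.sum-δ (φ a) (λ _ → f a)))) (∑-swap A.elems B.elems _)

  -- The elements of `P` are sorted by their image b: at most one lies over each b, and none where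
  -- `Q` fails.
  count-injection : ∀ {P : A → Set} {Q : B → Set} (P? : Decidable P) (Q? : Decidable Q) (φ : A → B) →
    (∀ {a} → P a → Q (φ a)) → (∀ {a a′} → P a → P a′ → φ a ≡ φ a′ → a ≡ a′) →
    A.sum (𝟙 ∘ P?) ≤ B.sum (𝟙 ∘ Q?)
  count-injection P? Q? φ P⇒Q inj = ℕP.≤-trans (ℕP.≤-reflexive (sum-fibres φ (𝟙 ∘ P?))) (∑-mono B.elems bound)
    where
    bound : ∀ b → A.sum (λ a → 𝟙 (b B.≟ φ a) * 𝟙 (P? a)) ≤ 𝟙 (Q? b)
    bound b with Q? b
    ... | yes _ = ℕP.≤-trans (ℕP.≤-reflexive (∑-cong A.elems (λ a → sym (𝟙-× (b B.≟ φ a) (P? a)))))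
                    (A.sum-unique (λ a → (b B.≟ φ a) ×-dec P? a)
                      (λ (e , p) (e′ , p′) → inj p p′ (trans (sym e) e′)))
    ... | no ¬q = ℕP.≤-reflexive (trans (∑-cong A.elems (λ a → trans (sym (𝟙-× (b B.≟ φ a) (P? a)))
                    (𝟙-no ((b B.≟ φ a) ×-dec P? a) λ { (refl , p) → ¬q (P⇒Q p) }))) (∑-zero A.elems))

module _ {A : Set} (EA : Enumeration A) where
  private module A = Enumeration EA

  module _ (φ : A → A) (inj : ∀ {x y} → φ x ≡ φ y → x ≡ y) where
    private
      fibre : A → ℕ
      fibre y = A.sum (λ x → 𝟙 (y A.≟ φ x))

      -- Injectivity bounds every fibre by 1, and the fibre sizes add up to the cardinality of `A`,
      -- as do the ones; hence no fibre is empty.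
      fibre≡1 : ∀ y → fibre y ≡ 1
      fibre≡1 y = ∑-≤-≡ A.elems
        (λ y → A.sum-unique (λ x → y A.≟ φ x) (λ e e′ → inj (trans (sym e) e′)))
        (trans (∑-cong A.elems (λ y → ∑-cong A.elems (λ x → sym (ℕP.*-identityʳ _)))) (sym (sum-fibres EA EA φ (λ _ → 1))))
        (A.complete y)

    sum-reindex : ∀ f → A.sum (f ∘ φ) ≡ A.sum f
    sum-reindex f = begin
      A.sum (f ∘ φ)                                           ≡⟨ sum-fibres EA EA φ (f ∘ φ) ⟩
      A.sum (λ y → A.sum (λ x → 𝟙 (y A.≟ φ x) * f (φ x)))     ≡⟨ ∑-cong A.elems (λ y → ∑-cong A.elems (λ x → 𝟙-*-cong (y A.≟ φ x) (cong f ∘ sym))) ⟩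
      A.sum (λ y → A.sum (λ x → 𝟙 (y A.≟ φ x) * f y))         ≡⟨ ∑-cong A.elems (λ y → ∑-*ʳ A.elems (f y) _) ⟩
      A.sum (λ y → fibre y * f y)                             ≡⟨ ∑-cong A.elems (λ y → trans (cong (_* f y) (fibre≡1 y)) (ℕP.*-identityˡ (f y))) ⟩
      A.sum f                                                 ∎
      where open ≡-Reasoning

    injective⇒surjective : ∀ y → ∃ λ x → φ x ≡ y
    injective⇒surjective y with A.search (λ x → φ x A.≟ y)
    ... | yes p = p
    ... | no ¬p = contradiction (trans (sym (fibre≡1 y)) (trans (∑-cong A.elems (λ x → 𝟙-no (y A.≟ φ x) (λ e → ¬p (x , sym e)))) (∑-zero A.elems))) λ ()

∑-allFin-suc : ∀ {n} (f : Fin (suc n) → ℕ) → ∑ (allFin (suc n)) f ≡ f zero + ∑ (allFin n) (f ∘ suc)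
∑-allFin-suc {n} f = cong (f zero +_) (trans (cong (λ L → ∑ L f) (sym (ListP.map-tabulate {n = n} id Fin.suc)))
  (∑-map Fin.suc (allFin n) f))

allFin-once : ∀ {n} (a : Fin n) → ∑ (allFin n) (λ x → 𝟙 (x FinP.≟ a)) ≡ 1
allFin-once {suc n} zero = trans (∑-allFin-suc {n} (λ x → 𝟙 (x FinP.≟ zero))) (cong suc (∑-zero (allFin n)))
allFin-once {suc n} (suc a) = begin
  ∑ (allFin (suc n)) (λ x → 𝟙 (x FinP.≟ suc a))  ≡⟨ ∑-allFin-suc (λ x → 𝟙 (x FinP.≟ suc a)) ⟩
  ∑ (allFin n) (λ x → 𝟙 (suc x FinP.≟ suc a))    ≡⟨ ∑-cong (allFin n) (λ x → 𝟙-cong (suc x FinP.≟ suc a) (x FinP.≟ a) FinP.suc-injective (cong suc)) ⟩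
  ∑ (allFin n) (λ x → 𝟙 (x FinP.≟ a))            ≡⟨ allFin-once a ⟩
  1                                              ∎
  where open ≡-Reasoning

allFinEnum : ∀ n → Enumeration (Fin n)
allFinEnum n = record { elems = allFin n ; _≟_ = FinP._≟_ ; complete = ∈-allFin ; once = allFin-once }

module _ (ℓ : ℕ) {{nz : NonZero ℓ}} where
  open Field ℓ {{nz}} using (allVecsOf; allVecsOf-complete)

  ∑-allVecsOf-suc : ∀ {A : Set} (L : List A) n f →
    ∑ (allVecsOf L (suc n)) f ≡ ∑ L (λ x → ∑ (allVecsOf L n) (λ xs → f (x ∷ xs)))
  ∑-allVecsOf-suc L n f = ∑-cartesianProductWith _∷_ L (allVecsOf L n) f

  vecEnum : ∀ {A : Set} → Enumeration A → ∀ n → Enumeration (Vec A n)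
  vecEnum EA n = record
    { elems = allVecsOf A.elems n ; _≟_ = ≡-dec A._≟_
    ; complete = allVecsOf-complete A.elems A.complete ; once = once′ }
    where
    module A = Enumeration EA
    once′ : ∀ {m} (v : Vec _ m) → ∑ (allVecsOf A.elems m) (λ w → 𝟙 (≡-dec A._≟_ w v)) ≡ 1
    once′ [] = refl
    once′ {suc m} (a ∷ v) = begin
      ∑ (allVecsOf A.elems (suc m)) (λ w → 𝟙 (≡-dec A._≟_ w (a ∷ v)))
        ≡⟨ ∑-allVecsOf-suc A.elems m _ ⟩
      ∑ A.elems (λ x → ∑ (allVecsOf A.elems m) (λ w → 𝟙 (≡-dec A._≟_ (x ∷ w) (a ∷ v))))
        ≡⟨ ∑-cong A.elems (λ x → ∑-cong (allVecsOf A.elems m) (λ w →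
             trans (𝟙-cong (≡-dec A._≟_ (x ∷ w) (a ∷ v)) ((x A.≟ a) ×-dec ≡-dec A._≟_ w v)
                     ∷-injective (λ (e , e′) → cong₂ _∷_ e e′))
                   (𝟙-× (x A.≟ a) (≡-dec A._≟_ w v)))) ⟩
      ∑ A.elems (λ x → ∑ (allVecsOf A.elems m) (λ w → 𝟙 (x A.≟ a) * 𝟙 (≡-dec A._≟_ w v)))
        ≡⟨ ∑-cong A.elems (λ x → trans (∑-*ˡ (allVecsOf A.elems m) (𝟙 (x A.≟ a)) _)
             (trans (cong (𝟙 (x A.≟ a) *_) (once′ v)) (ℕP.*-identityʳ _))) ⟩
      ∑ A.elems (λ x → 𝟙 (x A.≟ a))  ≡⟨ A.once a ⟩
      1                              ∎
      where open ≡-Reasoning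

-- Linear algebra over a finite prime field

module Vectors (ℓ : ℕ) {{nz : NonZero ℓ}} where
  open PrimeField ℓ {{nz}} public
  open ≡-Reasoning

  FE : Enumeration F
  FE = allFinEnum ℓ

  VE : ∀ n → Enumeration (Vec F n)
  VE n = vecEnum ℓ FE n

  sumF : (F → ℕ) → ℕ
  sumF = Enumeration.sum FE

  sumV : ∀ {n} → (Vec F n → ℕ) → ℕ
  sumV {n} = Enumeration.sum (VE n)

  infixl 6 _+V_
  infixl 7 _*V_

  _+V_ : ∀ {n} → Vec F n → Vec F n → Vec F n
  _+V_ = Vec.zipWith _+F_

  _*V_ : ∀ {n} → F → Vec F n → Vec F n
  c *V v = Vec.map (c *F_) v

  -1F : F
  -1F = -F 1F

  lincomb : ∀ {m n} → Vec F m → Vec (Vec F n) m → Vec F n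
  lincomb []      []      = zeroVec
  lincomb (a ∷ x) (w ∷ W) = a *V w +V lincomb x W

  module _ where
    open RS

    +V-comm : ∀ {n} (u v : Vec F n) → u +V v ≡ v +V u
    +V-comm []      []      = refl
    +V-comm (a ∷ u) (b ∷ v) = cong₂ _∷_ (R.+-comm a b) (+V-comm u v)

    +V-assoc : ∀ {n} (u v w : Vec F n) → u +V v +V w ≡ u +V (v +V w)
    +V-assoc []      []      []      = refl
    +V-assoc (a ∷ u) (b ∷ v) (c ∷ w) = cong₂ _∷_ (R.+-assoc a b c) (+V-assoc u v w)

    +V-interchange : ∀ {n} (u v w x : Vec F n) → (u +V v) +V (w +V x) ≡ (u +V w) +V (v +V x)
    +V-interchange []      []      []      []      = refl
    +V-interchange (a ∷ u) (b ∷ v) (c ∷ w) (d ∷ x) = cong₂ _∷_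
      (solve 4 (λ a b c d → (a :+ b) :+ (c :+ d) := (a :+ c) :+ (b :+ d)) refl a b c d) (+V-interchange u v w x)

    +V-identityˡ : ∀ {n} (u : Vec F n) → zeroVec +V u ≡ u
    +V-identityˡ []      = refl
    +V-identityˡ (a ∷ u) = cong₂ _∷_ (R.+-identityˡ a) (+V-identityˡ u)

    +V-identityʳ : ∀ {n} (u : Vec F n) → u +V zeroVec ≡ u
    +V-identityʳ u = trans (+V-comm u zeroVec) (+V-identityˡ u)

    +V-inverseʳ : ∀ {n} (u : Vec F n) → u +V -1F *V u ≡ zeroVec
    +V-inverseʳ []      = refl
    +V-inverseʳ (a ∷ u) = cong₂ _∷_ (solve 1 (λ a → a :+ (:- :1) :* a := :0) refl a) (+V-inverseʳ u)

    +V-cancelʳ : ∀ {n} (w : Vec F n) {u v} → u +V w ≡ v +V w → u ≡ v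
    +V-cancelʳ w {u} {v} eq = trans (sym (undo u)) (trans (cong (_+V -1F *V w) eq) (undo v))
      where
      undo : ∀ u → u +V w +V -1F *V w ≡ u
      undo u = trans (+V-assoc u w _) (trans (cong (u +V_) (+V-inverseʳ w)) (+V-identityʳ u))

    +V-cancelˡ : ∀ {n} (w : Vec F n) {u v} → w +V u ≡ w +V v → u ≡ v
    +V-cancelˡ w {u} {v} eq = +V-cancelʳ w (trans (+V-comm u w) (trans eq (+V-comm w v)))

    *V-zeroˡ : ∀ {n} (u : Vec F n) → 0F *V u ≡ zeroVec
    *V-zeroˡ []      = refl
    *V-zeroˡ (a ∷ u) = cong₂ _∷_ (R.zeroˡ a) (*V-zeroˡ u)

    *V-zeroʳ : ∀ {n} c → c *V zeroVec {n} ≡ zeroVec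
    *V-zeroʳ {zero}  c = refl
    *V-zeroʳ {suc n} c = cong₂ _∷_ (R.zeroʳ c) (*V-zeroʳ c)

    *V-identityˡ : ∀ {n} (u : Vec F n) → 1F *V u ≡ u
    *V-identityˡ []      = refl
    *V-identityˡ (a ∷ u) = cong₂ _∷_ (R.*-identityˡ a) (*V-identityˡ u)

    *V-assoc : ∀ {n} c d (u : Vec F n) → (c *F d) *V u ≡ c *V (d *V u)
    *V-assoc c d []      = refl
    *V-assoc c d (a ∷ u) = cong₂ _∷_ (R.*-assoc c d a) (*V-assoc c d u)

    *V-distribˡ : ∀ {n} c (u v : Vec F n) → c *V (u +V v) ≡ c *V u +V c *V v
    *V-distribˡ c []      []      = refl
    *V-distribˡ c (a ∷ u) (b ∷ v) = cong₂ _∷_ (R.distribˡ c a b) (*V-distribˡ c u v)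

    *V-distribʳ : ∀ {n} c d (u : Vec F n) → (c +F d) *V u ≡ c *V u +V d *V u
    *V-distribʳ c d []      = refl
    *V-distribʳ c d (a ∷ u) = cong₂ _∷_ (R.distribʳ a c d) (*V-distribʳ c d u)

    dot-comm : ∀ {n} (u v : Vec F n) → dot u v ≡ dot v u
    dot-comm []      []      = refl
    dot-comm (a ∷ u) (b ∷ v) = cong₂ _+F_ (R.*-comm a b) (dot-comm u v)

    dot-+ˡ : ∀ {n} (u v w : Vec F n) → dot (u +V v) w ≡ dot u w +F dot v w
    dot-+ˡ []      []      []      = sym (R.+-identityʳ 0F)
    dot-+ˡ (a ∷ u) (b ∷ v) (c ∷ w) = trans (cong (((a +F b) *F c) +F_) (dot-+ˡ u v w))
      (solve 5 (λ a b c d e → (a :+ b) :* c :+ (d :+ e) := (a :* c :+ d) :+ (b :* c :+ e)) refl a b c (dot u w) (dot v w))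

    dot-*ˡ : ∀ {n} c (u v : Vec F n) → dot (c *V u) v ≡ c *F dot u v
    dot-*ˡ c []      []      = sym (R.zeroʳ c)
    dot-*ˡ c (a ∷ u) (b ∷ v) = trans (cong (((c *F a) *F b) +F_) (dot-*ˡ c u v))
      (solve 4 (λ c a b d → (c :* a) :* b :+ c :* d := c :* (a :* b :+ d)) refl c a b (dot u v))

    dot-zeroˡ : ∀ {n} (u : Vec F n) → dot zeroVec u ≡ 0F
    dot-zeroˡ []      = refl
    dot-zeroˡ (a ∷ u) = trans (cong₂ _+F_ (R.zeroˡ a) (dot-zeroˡ u)) (R.+-identityʳ 0F)

  dot-zeroʳ : ∀ {n} (u : Vec F n) → dot u zeroVec ≡ 0F
  dot-zeroʳ u = trans (dot-comm u zeroVec) (dot-zeroˡ u)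

  dot-+ʳ : ∀ {n} (u v w : Vec F n) → dot u (v +V w) ≡ dot u v +F dot u w
  dot-+ʳ u v w = trans (dot-comm u _) (trans (dot-+ˡ v w u) (cong₂ _+F_ (dot-comm v u) (dot-comm w u)))

  dot-*ʳ : ∀ {n} c (u v : Vec F n) → dot u (c *V v) ≡ c *F dot u v
  dot-*ʳ c u v = trans (dot-comm u _) (trans (dot-*ˡ c v u) (cong (c *F_) (dot-comm v u)))

  lincomb-+ : ∀ {m n} (a b : Vec F m) (W : Vec (Vec F n) m) → lincomb (a +V b) W ≡ lincomb a W +V lincomb b W
  lincomb-+ []      []      []      = sym (+V-identityˡ _)
  lincomb-+ (a ∷ x) (b ∷ y) (w ∷ W) = begin
    (a +F b) *V w +V lincomb (x +V y) W                       ≡⟨ cong₂ _+V_ (*V-distribʳ a b w) (lincomb-+ x y W) ⟩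
    (a *V w +V b *V w) +V (lincomb x W +V lincomb y W)        ≡⟨ +V-interchange _ _ _ _ ⟩
    (a *V w +V lincomb x W) +V (b *V w +V lincomb y W)        ∎

  lincomb-* : ∀ {m n} c (a : Vec F m) (W : Vec (Vec F n) m) → lincomb (c *V a) W ≡ c *V lincomb a W
  lincomb-* c []      []      = sym (*V-zeroʳ c)
  lincomb-* c (a ∷ x) (w ∷ W) = begin
    (c *F a) *V w +V lincomb (c *V x) W  ≡⟨ cong₂ _+V_ (*V-assoc c a w) (lincomb-* c x W) ⟩
    c *V (a *V w) +V c *V lincomb x W    ≡⟨ *V-distribˡ c _ _ ⟨
    c *V (a *V w +V lincomb x W)         ∎

  lincomb-zero : ∀ {m n} (W : Vec (Vec F n) m) → lincomb zeroVec W ≡ zeroVec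
  lincomb-zero []      = refl
  lincomb-zero (w ∷ W) = trans (cong₂ _+V_ (*V-zeroˡ w) (lincomb-zero W)) (+V-identityˡ _)

  sumF-const : ∀ c → sumF (λ _ → c) ≡ ℓ * c
  sumF-const c = trans (∑-cong (elems FE) (λ x → sym (ℕP.*-identityˡ c)))
                       (trans (∑-*ʳ (elems FE) c _) (cong (_* c) (∑-allFin-1 ℓ)))
    where
    ∑-allFin-1 : ∀ n → ∑ (allFin n) (λ _ → 1) ≡ n
    ∑-allFin-1 zero    = refl
    ∑-allFin-1 (suc n) = trans (∑-allFin-suc {n} (λ _ → 1)) (cong suc (∑-allFin-1 n))

  sumV-suc : ∀ {n} (f : Vec F (suc n) → ℕ) → sumV f ≡ sumF (λ a → sumV (λ v → f (a ∷ v)))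
  sumV-suc {n} f = ∑-allVecsOf-suc ℓ (elems FE) n f

  sumV-1 : ∀ n → sumV {n} (λ _ → 1) ≡ ℓ ^ n
  sumV-1 zero    = refl
  sumV-1 (suc n) = trans (sumV-suc {n} (λ _ → 1)) (trans (∑-cong (elems FE) (λ _ → sumV-1 n)) (sumF-const (ℓ ^ n)))

  -- Alternation is demanded by itself because for ℓ = 2 skew-symmetry does not force `β u u` to
  -- vanish.
  record SymplecticForm (n : ℕ) : Set where
    field
      β               : Vec F n → Vec F n → F
      β-+ˡ            : ∀ u v w → β (u +V v) w ≡ β u w +F β v w
      β-*ˡ            : ∀ c u w → β (c *V u) w ≡ c *F β u w
      β-alternating   : ∀ u → β u u ≡ 0F
      β-skew          : ∀ u v → β u v ≡ -F β v u
      β-nondegenerate : ∀ u → (∀ v → β u v ≡ 0F) → u ≡ zeroVec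

module Spans (ℓ : ℕ) {{nz : NonZero ℓ}} (ℓ-prime : Prime ℓ) where
  open Vectors ℓ {{nz}} public
  open ≡-Reasoning

  InSpan : ∀ {m n} → Vec (Vec F n) m → Vec F n → Set
  InSpan W x = ∃ λ a → lincomb a W ≡ x

  inSpan? : ∀ {m n} (W : Vec (Vec F n) m) x → Dec (InSpan W x)
  inSpan? {m} W x = Enumeration.search (VE m) (λ a → lincomb a W ≟V x)

  Indep : ∀ {m n} → Vec (Vec F n) m → Set
  Indep []      = ⊤
  Indep (x ∷ W) = Indep W × ¬ InSpan W x

  isolate : ∀ {n} a b (w u v : Vec F n) → a *V w +V u ≡ b *V w +V v → (a +F (-F b)) *V w ≡ v +V -1F *V u
  isolate a b []      []      []      eq = refl
  isolate a b (c ∷ w) (d ∷ u) (e ∷ v) eq = cong₂ _∷_ (begin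
      (a +F (-F b)) *F c              ≡⟨ solve 4 (λ a b c d → (a :- b) :* c := (a :* c :+ d) :- b :* c :- d) refl a b c d ⟩
      (((a *F c) +F d) +F (-F (b *F c))) +F (-F d)  ≡⟨ cong (λ z → (z +F (-F (b *F c))) +F (-F d)) (∷-injectiveˡ eq) ⟩
      (((b *F c) +F e) +F (-F (b *F c))) +F (-F d)  ≡⟨ solve 4 (λ b c d e → (b :* c :+ e) :- b :* c :- d := e :+ (:- :1) :* d) refl b c d e ⟩
      e +F (-1F *F d) ∎)
    (isolate a b w u v (∷-injectiveʳ eq))
    where open RS

  -- If the head coefficients differ, their difference is invertible, and solving for the head `w`
  -- puts it into the span of `W`.
  lincomb-injective : ∀ {m n} (W : Vec (Vec F n) m) → Indep W → ∀ {a b} → lincomb a W ≡ lincomb b W → a ≡ b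
  lincomb-injective []      _ {[]} {[]} eq = refl
  lincomb-injective (w ∷ W) (iW , w∉W) {a ∷ x} {b ∷ y} eq = compare (Enumeration._≟_ FE a b)
    where
    a-b≡0⇒a≡b : a +F (-F b) ≡ 0F → a ≡ b
    a-b≡0⇒a≡b e = trans (RS.solve 2 (λ a b → a RS.:= (a RS.:- b) RS.:+ b) refl a b) (trans (cong (_+F b) e) (R.+-identityˡ b))

    w∈W : ∀ c → c *F (a +F (-F b)) ≡ 1F → InSpan W w
    w∈W c c[a-b]≡1 = c *V (y +V -1F *V x) , (begin
      lincomb (c *V (y +V -1F *V x)) W          ≡⟨ lincomb-* c (y +V -1F *V x) W ⟩
      c *V lincomb (y +V -1F *V x) W            ≡⟨ cong (c *V_) (trans (lincomb-+ y _ W) (cong (lincomb y W +V_) (lincomb-* -1F x W))) ⟩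
      c *V (lincomb y W +V -1F *V lincomb x W)  ≡⟨ cong (c *V_) (isolate a b w _ _ eq) ⟨
      c *V ((a +F (-F b)) *V w)                 ≡⟨ *V-assoc c _ w ⟨
      (c *F (a +F (-F b))) *V w                 ≡⟨ cong (_*V w) c[a-b]≡1 ⟩
      1F *V w                                   ≡⟨ *V-identityˡ w ⟩
      w                                         ∎)

    compare : Dec (a ≡ b) → a ∷ x ≡ b ∷ y
    compare (yes refl) = cong (a ∷_) (lincomb-injective W iW (+V-cancelˡ (a *V w) eq))
    compare (no a≢b)   = contradiction (w∈W (proj₁ a-b⁻¹) (proj₂ a-b⁻¹)) w∉W
      where a-b⁻¹ = inverse ℓ-prime (a +F (-F b)) (a≢b ∘ a-b≡0⇒a≡b)

  span-size : ∀ {m n} (W : Vec (Vec F n) m) → Indep W → sumV (λ x → 𝟙 (inSpan? W x)) ≡ ℓ ^ m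
  span-size {m} {n} W iW = begin
    sumV (λ x → 𝟙 (inSpan? W x))                        ≡⟨ ∑-cong (elems (VE n)) unique-coords ⟩
    sumV (λ x → sumV (λ a → 𝟙 (x ≟V lincomb a W) * 1))  ≡⟨ sum-fibres (VE m) (VE n) (λ a → lincomb a W) (λ _ → 1) ⟨
    sumV {m} (λ _ → 1)                                  ≡⟨ sumV-1 m ⟩
    ℓ ^ m                                               ∎
    where
    unique-coords : ∀ x → 𝟙 (inSpan? W x) ≡ sumV (λ a → 𝟙 (x ≟V lincomb a W) * 1)
    unique-coords x = trans (step (inSpan? W x)) (∑-cong (elems (VE m)) (λ a → sym (ℕP.*-identityʳ _)))
      where
      step : (d : Dec (InSpan W x)) → 𝟙 d ≡ sumV (λ a → 𝟙 (x ≟V lincomb a W))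
      step (yes (a , e)) = sym (sum-single (VE m) (λ b → x ≟V lincomb b W) a (sym e)
                             (λ b e′ → lincomb-injective W iW (trans (sym e′) (sym e))))
      step (no ¬e) = sym (trans (∑-cong (elems (VE m)) (λ a → 𝟙-no (x ≟V lincomb a W) (λ e → ¬e (a , sym e)))) (∑-zero (elems (VE m))))

-- Column positions are shifted by g and compared with g throughout, so positions are natural
-- numbers rather than elements of `Fin`. Reads beyond the end return the default `z`.
at : ∀ {A : Set} {m} → A → Vec A m → ℕ → A
at z []      i       = z
at z (x ∷ v) zero    = x
at z (x ∷ v) (suc i) = at z v i

fill : ∀ {A : Set} m → (ℕ → A) → Vec A m
fill zero    h = []
fill (suc m) h = h 0 ∷ fill m (h ∘ suc)

module _ {A : Set} where
  at-fill : ∀ (z : A) {m} h {i} → i < m → at z (fill m h) i ≡ h i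
  at-fill z h {zero}  (s≤s _)   = refl
  at-fill z h {suc i} (s≤s i<m) = at-fill z (h ∘ suc) i<m

  fill-at : ∀ (z : A) {m} (v : Vec A m) → fill m (at z v) ≡ v
  fill-at z []      = refl
  fill-at z (x ∷ v) = cong (x ∷_) (fill-at z v)

  fill-cong : ∀ m {h k : ℕ → A} → (∀ i → i < m → h i ≡ k i) → fill m h ≡ fill m k
  fill-cong zero    eq = refl
  fill-cong (suc m) eq = cong₂ _∷_ (eq 0 (s≤s z≤n)) (fill-cong m (λ i i<m → eq (suc i) (s≤s i<m)))

  at-ext : ∀ (z : A) {m} (u v : Vec A m) → (∀ i → i < m → at z u i ≡ at z v i) → u ≡ v
  at-ext z u v eq = trans (sym (fill-at z u)) (trans (fill-cong _ eq) (fill-at z v))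

  at-map : ∀ {B : Set} (f : A → B) z z′ {m} (v : Vec A m) {i} → i < m → at z′ (Vec.map f v) i ≡ f (at z v i)
  at-map f z z′ (x ∷ v) {zero}  _         = refl
  at-map f z z′ (x ∷ v) {suc i} (s≤s i<m) = at-map f z z′ v i<m

  fill-const : ∀ m (z : A) → fill m (λ _ → z) ≡ Vec.replicate m z
  fill-const zero    z = refl
  fill-const (suc m) z = cong (z ∷_) (fill-const m z)

prod-range : (ℕ → ℕ) → ℕ → ℕ → ℕ
prod-range e k zero    = 1
prod-range e k (suc d) = e (d + k) * prod-range e k d

prod-range-cong : ∀ {e e′} k d → (∀ i → i < d → e (i + k) ≡ e′ (i + k)) → prod-range e k d ≡ prod-range e′ k d
prod-range-cong k zero    eq = refl
prod-range-cong k (suc d) eq = cong₂ _*_ (eq d ℕP.≤-refl) (prod-range-cong k d (λ i i<d → eq i (ℕP.m<n⇒m<1+n i<d)))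

prod-range-bottom : ∀ e k d → prod-range e k (suc d) ≡ prod-range e (suc k) d * e k
prod-range-bottom e k zero    = ℕP.*-comm (e k) 1
prod-range-bottom e k (suc d) = trans (cong₂ _*_ (cong e (sym (ℕP.+-suc d k))) (prod-range-bottom e k d))
  (sym (ℕP.*-assoc (e (d + suc k)) _ (e k)))

-- Frames grow at the head, so these are the k columns chosen first. The equation is an argument
-- because `d` will usually be `n ∸ k`.
suffix : ∀ {A : Set} d {k N} → d + k ≡ N → Vec A N → Vec A k
suffix d eq C = Vec.drop d (subst (Vec _) (sym eq) C)

suffix-map : ∀ {A B : Set} (f : A → B) d {k N} (eq : d + k ≡ N) C → suffix d eq (Vec.map f C) ≡ Vec.map f (suffix d eq C)
suffix-map f d refl C = drop-map f d C

module _ (ℓ : ℕ) {{nz : NonZero ℓ}} {A : Set} (EA : Enumeration A) where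
  private
    E : ∀ n → Enumeration (Vec A n)
    E = vecEnum ℓ EA

  -- The number of one-step extensions depends only on the length, so all admissible `W` of length k
  -- have equally many completions, and a weight that sees only `W` factors out.
  sum-completions : ∀ (h : ∀ {m} → Vec A m → ℕ) (e : ℕ → ℕ) k d {N} (eq : d + k ≡ N) →
    (∀ i → i < d → ∀ (W : Vec A (i + k)) → sum EA (λ x → h (x ∷ W)) ≡ h W * e (i + k)) →
    (f : Vec A k → ℕ) →
    sum (E N) (λ C → h C * f (suffix d eq C)) ≡ prod-range e k d * sum (E k) (λ W → h W * f W)
  sum-completions h e k zero    refl step f = sym (ℕP.*-identityˡ _)
  sum-completions h e k (suc d) refl step f = begin
    sum (E (suc d + k)) (λ C → h C * f (Vec.drop (suc d) C))
      ≡⟨ ∑-allVecsOf-suc ℓ (elems EA) (d + k) _ ⟩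
    sum EA (λ x → sum (E (d + k)) (λ W → h (x ∷ W) * f (Vec.drop d W)))
      ≡⟨ ∑-swap (elems EA) (elems (E (d + k))) _ ⟩
    sum (E (d + k)) (λ W → sum EA (λ x → h (x ∷ W) * f (Vec.drop d W)))
      ≡⟨ ∑-cong (elems (E (d + k))) (λ W → trans (∑-*ʳ (elems EA) (f (Vec.drop d W)) _)
           (trans (cong (_* f (Vec.drop d W)) (step d ℕP.≤-refl W)) (rearrange (h W) (e (d + k)) (f (Vec.drop d W))))) ⟩
    sum (E (d + k)) (λ W → e (d + k) * (h W * f (Vec.drop d W)))
      ≡⟨ ∑-*ˡ (elems (E (d + k))) (e (d + k)) _ ⟩
    e (d + k) * sum (E (d + k)) (λ W → h W * f (Vec.drop d W))
      ≡⟨ cong (e (d + k) *_) (sum-completions h e k d refl (λ i i<d → step i (ℕP.m<n⇒m<1+n i<d)) f) ⟩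
    e (d + k) * (prod-range e k d * sum (E k) (λ W → h W * f W))
      ≡⟨ ℕP.*-assoc (e (d + k)) _ _ ⟨
    prod-range e k (suc d) * sum (E k) (λ W → h W * f W) ∎
    where
    open ≡-Reasoning
    rearrange : ∀ a b c → a * b * c ≡ b * (a * c)
    rearrange a b c = trans (cong (_* c) (ℕP.*-comm a b)) (ℕP.*-assoc b a c)

-- Counting frames in a symplectic space

module SymplecticSpace (ℓ : ℕ) {{nz : NonZero ℓ}} (ℓ-prime : Prime ℓ) (n : ℕ)
  (form : Vectors.SymplecticForm ℓ n) where
  open Spans ℓ {{nz}} ℓ-prime public
  open SymplecticForm form public
  open ≡-Reasoning

  V : Set
  V = Vec F n

  Frame : ℕ → Set
  Frame m = Vec V m

  frameEnum : ∀ m → Enumeration (Frame m)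
  frameEnum = vecEnum ℓ (VE n)

  sumFrames : ∀ m → (Frame m → ℕ) → ℕ
  sumFrames m = sum (frameEnum m)

  β-+ʳ : ∀ u v w → β u (v +V w) ≡ β u v +F β u w
  β-+ʳ u v w = begin
    β u (v +V w)              ≡⟨ β-skew u (v +V w) ⟩
    -F β (v +V w) u           ≡⟨ cong -F_ (β-+ˡ v w u) ⟩
    -F (β v u +F β w u)       ≡⟨ RS.solve 2 (λ a b → RS.:- (a RS.:+ b) RS.:= RS.:- a RS.:+ RS.:- b) refl (β v u) (β w u) ⟩
    (-F β v u) +F (-F β w u)  ≡⟨ cong₂ _+F_ (β-skew u v) (β-skew u w) ⟨
    β u v +F β u w            ∎

  β-*ʳ : ∀ c u v → β u (c *V v) ≡ c *F β u v
  β-*ʳ c u v = begin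
    β u (c *V v)      ≡⟨ β-skew u (c *V v) ⟩
    -F β (c *V v) u   ≡⟨ cong -F_ (β-*ˡ c v u) ⟩
    -F (c *F β v u)   ≡⟨ RS.solve 2 (λ c a → RS.:- (c RS.:* a) RS.:= c RS.:* (RS.:- a)) refl c (β v u) ⟩
    c *F (-F β v u)   ≡⟨ cong (c *F_) (β-skew u v) ⟨
    c *F β u v        ∎

  β-zeroˡ : ∀ u → β zeroVec u ≡ 0F
  β-zeroˡ u = trans (cong (λ z → β z u) (sym (*V-zeroˡ zeroVec))) (trans (β-*ˡ 0F zeroVec u) (R.zeroˡ _))

  β-zeroʳ : ∀ u → β u zeroVec ≡ 0F
  β-zeroʳ u = trans (cong (β u) (sym (*V-zeroˡ zeroVec))) (trans (β-*ʳ 0F u zeroVec) (R.zeroˡ _))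

  pair : ∀ {m} → Frame m → V → Vec F m
  pair W v = Vec.map (λ w → β w v) W

  pair-+ : ∀ {m} (W : Frame m) u v → pair W (u +V v) ≡ pair W u +V pair W v
  pair-+ []      u v = refl
  pair-+ (w ∷ W) u v = cong₂ _∷_ (β-+ʳ w u v) (pair-+ W u v)

  pair-* : ∀ {m} (W : Frame m) c v → pair W (c *V v) ≡ c *V pair W v
  pair-* []      c v = refl
  pair-* (w ∷ W) c v = cong₂ _∷_ (β-*ʳ c w v) (pair-* W c v)

  β-lincombˡ : ∀ {m} a (W : Frame m) v → β (lincomb a W) v ≡ dot a (pair W v)
  β-lincombˡ []      []      v = β-zeroˡ v
  β-lincombˡ (a ∷ x) (w ∷ W) v = trans (β-+ˡ _ _ v) (cong₂ _+F_ (β-*ˡ a w v) (β-lincombˡ x W v))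

  -- Contrapositive of `vanish⇒inSpan` for the same `W`: if `w` vanished on the orthogonal
  -- complement of `W`, it would lie in the span. A vector on which it does not vanish is rescaled.
  -- The two lemmas recurse through each other along the frame.
  dual-vector : ∀ {m} (W : Frame m) {w} → Indep W → ¬ InSpan W w → ∃ λ k → pair W k ≡ zeroVec × β w k ≡ 1F
  -- The double orthogonal complement is the span; the empty frame is nondegeneracy. For `w ∷ W`,
  -- let k be dual to `w` and orthogonal to `W`. Any v orthogonal to `W` becomes orthogonal to `w`
  -- as well on subtracting a multiple of k, so `x` minus `β x k` times `w` vanishes at v, and the
  -- induction hypothesis applies to it.
  vanish⇒inSpan : ∀ {m} (W : Frame m) {x} → Indep W → (∀ v → pair W v ≡ zeroVec → β x v ≡ 0F) → InSpan W x

  dual-vector W {w} iW w∉W = decide (search (VE n) (λ k → (pair W k ≟V zeroVec) ×-dec ¬? (Enumeration._≟_ FE (β w k) 0F)))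
    where
    decide : Dec (∃ λ k → pair W k ≡ zeroVec × β w k ≢ 0F) → ∃ λ k → pair W k ≡ zeroVec × β w k ≡ 1F
    decide (yes (k , pk , bk)) = proj₁ b *V k
      , trans (pair-* W (proj₁ b) k) (trans (cong (proj₁ b *V_) pk) (*V-zeroʳ (proj₁ b)))
      , trans (β-*ʳ (proj₁ b) w k) (proj₂ b)
      where b = inverse ℓ-prime (β w k) bk
    decide (no ¬k) = contradiction (vanish⇒inSpan W iW (λ v pv → zero? v pv (Enumeration._≟_ FE (β w v) 0F))) w∉W
      where
      zero? : ∀ v → pair W v ≡ zeroVec → Dec (β w v ≡ 0F) → β w v ≡ 0F
      zero? v pv (yes e) = e
      zero? v pv (no ¬e) = contradiction (v , pv , ¬e) ¬k

  vanish⇒inSpan []      {x} iW         van = [] , sym (β-nondegenerate x (λ v → van v refl))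
  vanish⇒inSpan (w ∷ W) {x} (iW , w∉W) van = β x k ∷ proj₁ x′∈W , (begin
    β x k *V w +V lincomb (proj₁ x′∈W) W             ≡⟨ cong (β x k *V w +V_) (proj₂ x′∈W) ⟩
    β x k *V w +V (x +V -1F *V (β x k *V w))         ≡⟨ cong (β x k *V w +V_) (+V-comm x _) ⟩
    β x k *V w +V (-1F *V (β x k *V w) +V x)         ≡⟨ +V-assoc _ _ _ ⟨
    β x k *V w +V -1F *V (β x k *V w) +V x           ≡⟨ cong (_+V x) (+V-inverseʳ _) ⟩
    zeroVec +V x                                     ≡⟨ +V-identityˡ x ⟩
    x                                                ∎)
    where
    dual = dual-vector W iW w∉W
    k = proj₁ dual
    x′ = x +V -1F *V (β x k *V w)

    x′-vanishes : ∀ v → pair W v ≡ zeroVec → β x′ v ≡ 0F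
    x′-vanishes v pv = begin
      β x′ v                                     ≡⟨ trans (β-+ˡ x _ v) (cong (β x v +F_) (trans (β-*ˡ -1F _ v) (cong (-1F *F_) (β-*ˡ (β x k) w v)))) ⟩
      β x v +F (-1F *F (β x k *F β w v))         ≡⟨ solve 3 (λ a b c → a :+ (:- :1) :* (b :* c) := a :+ (:- c) :* b) refl (β x v) (β x k) (β w v) ⟩
      β x v +F ((-F β w v) *F β x k)             ≡⟨ trans (β-+ʳ x v _) (cong (β x v +F_) (β-*ʳ (-F β w v) x k)) ⟨
      β x (v +V (-F β w v) *V k)                 ≡⟨ van _ (cong₂ _∷_ w-zero W-zero) ⟩
      0F                                         ∎
      where
      open RS
      w-zero : β w (v +V (-F β w v) *V k) ≡ 0F
      w-zero = begin
        β w (v +V (-F β w v) *V k)      ≡⟨ trans (β-+ʳ w v _) (cong (β w v +F_) (trans (β-*ʳ (-F β w v) w k) (cong ((-F β w v) *F_) (proj₂ (proj₂ dual))))) ⟩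
        β w v +F ((-F β w v) *F 1F)     ≡⟨ solve 1 (λ a → a :+ (:- a) :* :1 := :0) refl (β w v) ⟩
        0F                              ∎
      W-zero : pair W (v +V (-F β w v) *V k) ≡ zeroVec
      W-zero = begin
        pair W (v +V (-F β w v) *V k)          ≡⟨ trans (pair-+ W v _) (cong₂ _+V_ pv (trans (pair-* W (-F β w v) k) (cong ((-F β w v) *V_) (proj₁ (proj₂ dual))))) ⟩
        zeroVec +V (-F β w v) *V zeroVec       ≡⟨ trans (+V-identityˡ _) (*V-zeroʳ (-F β w v)) ⟩
        zeroVec                                ∎

    x′∈W : InSpan W x′
    x′∈W = vanish⇒inSpan W iW x′-vanishes

  -- Translations along a vector dual to `w` and orthogonal to `W` permute the ℓ slices according to
  -- the value of `β w`, so these are equally large. The product form avoids a difference in the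
  -- exponent.
  pair-equidistributed : ∀ {m} (W : Frame m) → Indep W → ∀ c → sumV (λ v → 𝟙 (pair W v ≟V c)) * ℓ ^ m ≡ ℓ ^ n
  pair-equidistributed [] _ [] = trans (ℕP.*-identityʳ _) (sumV-1 n)
  pair-equidistributed {suc m} (w ∷ W) (iW , w∉W) (a ∷ c) = begin
    sumV (λ v → 𝟙 (pair (w ∷ W) v ≟V (a ∷ c))) * (ℓ * ℓ ^ m)
      ≡⟨ cong (_* (ℓ * ℓ ^ m)) (∑-cong (elems (VE n)) (λ v → trans
           (𝟙-cong (pair (w ∷ W) v ≟V (a ∷ c)) ((β w v F.≟ a) ×-dec (pair W v ≟V c)) ∷-injective (λ (e , e′) → cong₂ _∷_ e e′))
           (𝟙-× (β w v F.≟ a) (pair W v ≟V c)))) ⟩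
    slice a * (ℓ * ℓ ^ m)                               ≡⟨ trans (sym (ℕP.*-assoc (slice a) ℓ _)) (cong (_* ℓ ^ m) (ℕP.*-comm (slice a) ℓ)) ⟩
    ℓ * slice a * ℓ ^ m                                 ≡⟨ cong (_* ℓ ^ m) all-slices ⟨
    sumV (λ v → 𝟙 (pair W v ≟V c)) * ℓ ^ m              ≡⟨ pair-equidistributed W iW c ⟩
    ℓ ^ n                                               ∎
    where
    module F = Enumeration FE
    dual = dual-vector W iW w∉W
    k = proj₁ dual
    slice : F → ℕ
    slice b = sumV (λ v → 𝟙 (β w v F.≟ b) * 𝟙 (pair W v ≟V c))

    -- translating by b k moves the slice over 0 to the slice over b
    slice-const : ∀ b → slice b ≡ slice 0F
    slice-const b = begin
      slice b                                                                  ≡⟨ sum-reindex (VE n) (_+V b *V k) (+V-cancelʳ (b *V k)) _ ⟨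
      sumV (λ v → 𝟙 (β w (v +V b *V k) F.≟ b) * 𝟙 (pair W (v +V b *V k) ≟V c))
        ≡⟨ ∑-cong (elems (VE n)) (λ v → cong₂ _*_ (cong (λ z → 𝟙 (z F.≟ b)) (w-shift v)) (cong (λ z → 𝟙 (z ≟V c)) (W-shift v))) ⟩
      sumV (λ v → 𝟙 ((β w v +F b) F.≟ b) * 𝟙 (pair W v ≟V c))
        ≡⟨ ∑-cong (elems (VE n)) (λ v → cong (_* 𝟙 (pair W v ≟V c)) (𝟙-cong ((β w v +F b) F.≟ b) (β w v F.≟ 0F) (cancel b) (λ e → trans (cong (_+F b) e) (R.+-identityˡ b)))) ⟩
      slice 0F                                                                 ∎
      where
      cancel : ∀ b {a} → a +F b ≡ b → a ≡ 0F
      cancel b {a} e = begin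
        a                    ≡⟨ RS.solve 2 (λ a b → a RS.:= (a RS.:+ b) RS.:- b) refl a b ⟩
        (a +F b) +F (-F b)   ≡⟨ cong (_+F (-F b)) e ⟩
        b +F (-F b)          ≡⟨ R.-‿inverseʳ b ⟩
        0F                   ∎
      w-shift : ∀ v → β w (v +V b *V k) ≡ β w v +F b
      w-shift v = trans (β-+ʳ w v _) (cong (β w v +F_) (trans (β-*ʳ b w k) (trans (cong (b *F_) (proj₂ (proj₂ dual))) (R.*-identityʳ b))))
      W-shift : ∀ v → pair W (v +V b *V k) ≡ pair W v
      W-shift v = trans (pair-+ W v _) (trans (cong (pair W v +V_) (trans (pair-* W b k) (trans (cong (b *V_) (proj₁ (proj₂ dual))) (*V-zeroʳ b)))) (+V-identityʳ _))

    all-slices : sumV (λ v → 𝟙 (pair W v ≟V c)) ≡ ℓ * slice a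
    all-slices = begin
      sumV (λ v → 𝟙 (pair W v ≟V c))                                ≡⟨ sum-fibres (VE n) FE (β w) _ ⟩
      sumF (λ b → sumV (λ v → 𝟙 (b F.≟ β w v) * 𝟙 (pair W v ≟V c)))
        ≡⟨ ∑-cong (elems FE) (λ b → ∑-cong (elems (VE n)) (λ v → cong (_* 𝟙 (pair W v ≟V c)) (𝟙-cong (b F.≟ β w v) (β w v F.≟ b) sym sym))) ⟩
      sumF slice                                                    ≡⟨ ∑-cong (elems FE) (λ b → trans (slice-const b) (sym (slice-const a))) ⟩
      sumF (λ _ → slice a)                                          ≡⟨ sumF-const (slice a) ⟩
      ℓ * slice a                                                   ∎

-- Frames with a prescribed Gram matrix

module GramFrames (ℓ : ℕ) {{nz : NonZero ℓ}} (ℓ-prime : Prime ℓ) (n : ℕ)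
  (form : Vectors.SymplecticForm ℓ n) where
  open SymplecticSpace ℓ {{nz}} ℓ-prime n form public
  open ≡-Reasoning

  -- Frames grow at the head, so the columns of a matrix are chosen from the last one to the first;
  -- τ d prescribes the pairing of two columns whose positions differ by d + 1.
  Good : (ℕ → F) → ∀ {m} → Frame m → Set
  Good τ []              = ⊤
  Good τ {suc m} (x ∷ W) = Good τ W × ¬ InSpan W x × pair W x ≡ fill m τ

  good? : ∀ τ {m} (W : Frame m) → Dec (Good τ W)
  good? τ []      = yes tt
  good? τ (x ∷ W) = good? τ W ×-dec (¬? (inSpan? W x) ×-dec (pair W x ≟V fill _ τ))

  good⇒indep : ∀ {τ m} (W : Frame m) → Good τ W → Indep W
  good⇒indep []      _              = tt
  good⇒indep (x ∷ W) (gW , x∉W , _) = good⇒indep W gW , x∉W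

  good-cong : ∀ {τ τ′ m} (W : Frame m) → (∀ d → suc d < m → τ d ≡ τ′ d) → Good τ W → Good τ′ W
  good-cong []      eq _               = tt
  good-cong (x ∷ W) eq (gW , x∉W , pW) = good-cong W (λ d d<m → eq d (ℕP.m<n⇒m<1+n d<m)) gW , x∉W
    , trans pW (fill-cong _ (λ d d<m → eq d (s≤s d<m)))

  _‼_ : ∀ {m} → Frame m → ℕ → V
  _‼_ = at zeroVec

  at-pair : ∀ {m} (W : Frame m) v {i} → i < m → at 0F (pair W v) i ≡ β (W ‼ i) v
  at-pair W v i<m = at-map (λ w → β w v) zeroVec 0F W i<m

  at-zeroVec : ∀ {m i} → i < m → at 0F (zeroVec {m}) i ≡ 0F
  at-zeroVec {m} {i} i<m = trans (cong (λ z → at 0F z i) (sym (fill-const m 0F))) (at-fill 0F (λ _ → 0F) i<m)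

  good-gram : ∀ {τ m} (W : Frame m) → Good τ W → ∀ j d → suc (j + d) < m → β (W ‼ suc (j + d)) (W ‼ j) ≡ τ d
  good-gram {τ} {suc m} (x ∷ W) (gW , _ , pW) zero d (s≤s d<m) = begin
    β (W ‼ d) x              ≡⟨ at-pair W x d<m ⟨
    at 0F (pair W x) d       ≡⟨ cong (λ (z : Vec F m) → at 0F z d) pW ⟩
    at 0F (fill m τ) d       ≡⟨ at-fill 0F τ d<m ⟩
    τ d                      ∎
  good-gram (x ∷ W) (gW , _ , _) (suc j) d (s≤s lt) = good-gram W gW j d lt

  -- Column k meets the columns in front of it at offsets below k and those behind it at offsets d
  -- with k + 1 + d < m. The two hypotheses make `τ` vanish at all of these; the diagonal is
  -- alternation.
  good-perp : ∀ {τ m} (W : Frame m) → Good τ W → ∀ k → k < m →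
    (∀ d → d < k → τ d ≡ 0F) → (∀ d → suc (k + d) < m → τ d ≡ 0F) → ∀ i → i < m → β (W ‼ k) (W ‼ i) ≡ 0F
  good-perp {τ} {m} W gW k k<m lo hi i i<m = by-cases (ℕP.<-cmp i k)
    where
    by-cases : _ → β (W ‼ k) (W ‼ i) ≡ 0F
    by-cases (tri≈ _ refl _) = β-alternating _
    by-cases (tri< i<k _ _) = trans (cong (λ j → β (W ‼ j) (W ‼ i)) (sym (proj₂ o)))
      (trans (good-gram W gW i (proj₁ o) (subst (_< m) (sym (proj₂ o)) k<m)) (lo _ d<k))
      where
      o = ℕP.m≤n⇒∃[o]m+o≡n i<k
      d<k : proj₁ o < k
      d<k = subst (proj₁ o <_) (proj₂ o) (s≤s (ℕP.m≤n+m (proj₁ o) i))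
    by-cases (tri> _ _ k<i) = trans (β-skew _ _) (trans (cong -F_ (trans (cong (λ j → β (W ‼ j) (W ‼ k)) (sym (proj₂ o)))
      (trans (good-gram W gW k (proj₁ o) lt) (hi _ lt)))) (RS.solve 0 (RS.:- RS.:0 RS.:= RS.:0) refl))
      where
      o = ℕP.m≤n⇒∃[o]m+o≡n k<i
      lt : suc (k + proj₁ o) < m
      lt = subst (_< m) (sym (proj₂ o)) i<m

  perp-lincomb : ∀ {m} (W : Frame m) u → (∀ i → i < m → β u (W ‼ i) ≡ 0F) → ∀ a → β u (lincomb a W) ≡ 0F
  perp-lincomb []      u perp []      = β-zeroʳ u
  perp-lincomb (w ∷ W) u perp (a ∷ x) = begin
    β u (a *V w +V lincomb x W)         ≡⟨ β-+ʳ u _ _ ⟩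
    β u (a *V w) +F β u (lincomb x W)   ≡⟨ cong₂ _+F_ (trans (β-*ʳ a u w) (trans (cong (a *F_) (perp 0 (s≤s z≤n))) (R.zeroʳ a)))
                                                      (perp-lincomb W u (λ i i<m → perp (suc i) (s≤s i<m)) x) ⟩
    0F +F 0F                            ≡⟨ R.+-identityʳ 0F ⟩
    0F                                  ∎

  pair-lincomb-isotropic : ∀ {τ m} (W : Frame m) → Good τ W → (∀ d → suc d < m → τ d ≡ 0F) → ∀ a → pair W (lincomb a W) ≡ zeroVec
  pair-lincomb-isotropic {τ} {m} W gW τ≡0 a = at-ext 0F _ _ λ i i<m →
    trans (at-pair W _ i<m) (trans (perp-lincomb W (W ‼ i) (good-perp W gW i i<m
        (λ d d<i → τ≡0 d (ℕP.≤-<-trans d<i i<m))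
        (λ d lt → τ≡0 d (ℕP.≤-<-trans (s≤s (ℕP.m≤n+m d i)) lt))) a)
      (sym (at-zeroVec i<m)))

  pair-count : ∀ {m} (W : Frame m) → Indep W → m ≤ n → ∀ c → sumV (λ v → 𝟙 (pair W v ≟V c)) ≡ ℓ ^ (n ∸ m)
  pair-count {m} W iW m≤n c = ℕP.*-cancelʳ-≡ _ _ (ℓ ^ m) {{ℕP.m^n≢0 ℓ m}} (begin
    sumV (λ v → 𝟙 (pair W v ≟V c)) * ℓ ^ m   ≡⟨ pair-equidistributed W iW c ⟩
    ℓ ^ n                                    ≡⟨ cong (ℓ ^_) (ℕP.m∸n+n≡m m≤n) ⟨
    ℓ ^ (n ∸ m + m)                          ≡⟨ ℕP.^-distribˡ-+-* ℓ (n ∸ m) m ⟩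
    ℓ ^ (n ∸ m) * ℓ ^ m                      ∎)

  private
    sum-extensions : ∀ τ {m} (W : Frame m) r → (Good τ W → sumV (λ x → 𝟙 (¬? (inSpan? W x) ×-dec (pair W x ≟V fill m τ))) ≡ r) →
      sumV (λ x → 𝟙 (good? τ (x ∷ W))) ≡ 𝟙 (good? τ W) * r
    sum-extensions τ {m} W r eq = begin
      sumV (λ x → 𝟙 (good? τ (x ∷ W)))          ≡⟨ ∑-cong (elems (VE n)) (λ x → 𝟙-× (good? τ W) (new? x)) ⟩
      sumV (λ x → 𝟙 (good? τ W) * 𝟙 (new? x))   ≡⟨ ∑-*ˡ (elems (VE n)) (𝟙 (good? τ W)) _ ⟩
      𝟙 (good? τ W) * sumV (λ x → 𝟙 (new? x))   ≡⟨ 𝟙-*-cong (good? τ W) eq ⟩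
      𝟙 (good? τ W) * r                         ∎
      where
      new? : ∀ x → Dec (¬ InSpan W x × pair W x ≡ fill m τ)
      new? x = ¬? (inSpan? W x) ×-dec (pair W x ≟V fill m τ)

  -- Here `W` is isotropic, so its whole span solves the pairing equations; exactly ℓ^m of the
  -- ℓ^(n-m) solutions are lost to dependence.
  isotropic-extensions : ∀ τ {m} (W : Frame m) → m ≤ n → (∀ d → d < m → τ d ≡ 0F) →
    sumV (λ x → 𝟙 (good? τ (x ∷ W))) ≡ 𝟙 (good? τ W) * (ℓ ^ (n ∸ m) ∸ ℓ ^ m)
  isotropic-extensions τ {m} W m≤n τ≡0 = sum-extensions τ W _ λ gW → begin
    sumV (λ x → 𝟙 (new? x))                                       ≡⟨ ℕP.m+n∸n≡m _ (ℓ ^ m) ⟨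
    sumV (λ x → 𝟙 (new? x)) + ℓ ^ m ∸ ℓ ^ m                       ≡⟨ cong (λ z → sumV (λ x → 𝟙 (new? x)) + z ∸ ℓ ^ m) (span-size W (good⇒indep W gW)) ⟨
    sumV (λ x → 𝟙 (new? x)) + sumV (λ x → 𝟙 (inSpan? W x)) ∸ ℓ ^ m  ≡⟨ cong (_∸ ℓ ^ m) (∑-+ (elems (VE n)) _ _) ⟨
    sumV (λ x → 𝟙 (new? x) + 𝟙 (inSpan? W x)) ∸ ℓ ^ m             ≡⟨ cong (_∸ ℓ ^ m) (∑-cong (elems (VE n)) (split gW)) ⟩
    sumV (λ x → 𝟙 (pair W x ≟V fill m τ)) ∸ ℓ ^ m                 ≡⟨ cong (_∸ ℓ ^ m) (pair-count W (good⇒indep W gW) m≤n (fill m τ)) ⟩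
    ℓ ^ (n ∸ m) ∸ ℓ ^ m                                           ∎
    where
    new? : ∀ x → Dec (¬ InSpan W x × pair W x ≡ fill m τ)
    new? x = ¬? (inSpan? W x) ×-dec (pair W x ≟V fill m τ)

    fill≡0 : fill m τ ≡ zeroVec
    fill≡0 = trans (fill-cong m τ≡0) (fill-const m 0F)

    split : Good τ W → ∀ x → 𝟙 (new? x) + 𝟙 (inSpan? W x) ≡ 𝟙 (pair W x ≟V fill m τ)
    split gW x = by-cases (inSpan? W x)
      where
      by-cases : (d : Dec (InSpan W x)) → 𝟙 (¬? d ×-dec (pair W x ≟V fill m τ)) + 𝟙 d ≡ 𝟙 (pair W x ≟V fill m τ)
      by-cases (no _) = ℕP.+-identityʳ _
      by-cases (yes (a , refl)) = sym (𝟙-yes (pair W x ≟V fill m τ)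
        (trans (pair-lincomb-isotropic W gW (λ d d<m → τ≡0 d (ℕP.<-trans (ℕP.n<1+n d) d<m)) a) (sym fill≡0)))

  -- Column k is orthogonal to the whole span of `W`, yet its pairing with the new vector must be
  -- `τ k`, which is not zero. So no solution lies in the span and none is lost.
  hyperbolic-extensions : ∀ τ {m} (W : Frame m) → m ≤ n → ∀ k → k < m → τ k ≢ 0F →
    (∀ d → d < k → τ d ≡ 0F) → (∀ d → suc (k + d) < m → τ d ≡ 0F) →
    sumV (λ x → 𝟙 (good? τ (x ∷ W))) ≡ 𝟙 (good? τ W) * ℓ ^ (n ∸ m)
  hyperbolic-extensions τ {m} W m≤n k k<m τk≢0 lo hi = sum-extensions τ W _ λ gW →
    trans (∑-cong (elems (VE n)) (λ x → 𝟙-cong (¬? (inSpan? W x) ×-dec (pair W x ≟V fill m τ)) (pair W x ≟V fill m τ) proj₂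
             (λ p → (λ (a , e) → τk≢0 (begin
               τ k                     ≡⟨ at-fill 0F τ k<m ⟨
               at 0F (fill m τ) k      ≡⟨ cong (λ z → at 0F z k) p ⟨
               at 0F (pair W x) k      ≡⟨ at-pair W x k<m ⟩
               β (W ‼ k) x             ≡⟨ cong (β (W ‼ k)) e ⟨
               β (W ‼ k) (lincomb a W) ≡⟨ perp-lincomb W (W ‼ k) (good-perp W gW k k<m lo hi) a ⟩
               0F                      ∎)) , p)))
          (pair-count W (good⇒indep W gW) m≤n (fill m τ))

-- Matrices as lists of columns

module Matrices (ℓ : ℕ) {{nz : NonZero ℓ}} where
  open Vectors ℓ {{nz}}
  open ≡-Reasoning

  unit-columns : ∀ m → Vec (Vec F m) m
  unit-columns zero    = []
  unit-columns (suc m) = (1F ∷ zeroVec) ∷ Vec.map (0F ∷_) (unit-columns m)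

  lincomb-map-0∷ : ∀ {k m} x (W : Vec (Vec F m) k) → lincomb x (Vec.map (0F ∷_) W) ≡ 0F ∷ lincomb x W
  lincomb-map-0∷ []      []      = refl
  lincomb-map-0∷ (a ∷ x) (w ∷ W) = trans (cong (a *V (0F ∷ w) +V_) (lincomb-map-0∷ x W))
    (cong (_∷ (a *V w +V lincomb x W)) (trans (R.+-identityʳ _) (R.zeroʳ a)))

  lincomb-unit-columns : ∀ {m} (x : Vec F m) → lincomb x (unit-columns m) ≡ x
  lincomb-unit-columns []      = refl
  lincomb-unit-columns {suc m} (a ∷ x) = begin
    a *V (1F ∷ zeroVec) +V lincomb x (Vec.map (0F ∷_) (unit-columns m))  ≡⟨ cong (a *V (1F ∷ zeroVec) +V_) (trans (lincomb-map-0∷ x _) (cong (0F ∷_) (lincomb-unit-columns x))) ⟩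
    ((a *F 1F) +F 0F) ∷ (a *V zeroVec +V x)                              ≡⟨ cong₂ _∷_ (trans (R.+-identityʳ _) (R.*-identityʳ a)) (trans (cong (_+V x) (*V-zeroʳ a)) (+V-identityˡ x)) ⟩
    a ∷ x                                                                ∎

  infixr 8 _∙_ _⊙_

  _∙_ : ∀ {m n} → Vec (Vec F n) m → Vec F m → Vec F n
  C ∙ x = lincomb x C

  _⊙_ : ∀ {k m n} → Vec (Vec F n) m → Vec (Vec F m) k → Vec (Vec F n) k
  C ⊙ W = Vec.map (C ∙_) W

  ⊙-unit-columns : ∀ {m n} (C : Vec (Vec F n) m) → C ⊙ unit-columns m ≡ C
  ⊙-unit-columns []      = refl
  ⊙-unit-columns {suc m} (c ∷ C) = cong₂ _∷_
    (trans (cong₂ _+V_ (*V-identityˡ c) (lincomb-zero C)) (+V-identityʳ c))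
    (begin
      Vec.map ((c ∷ C) ∙_) (Vec.map (0F ∷_) (unit-columns m))  ≡⟨ map-∘ _ _ (unit-columns m) ⟨
      Vec.map (λ x → 0F *V c +V C ∙ x) (unit-columns m)        ≡⟨ map-cong (λ x → trans (cong (_+V C ∙ x) (*V-zeroˡ c)) (+V-identityˡ _)) (unit-columns m) ⟩
      C ⊙ unit-columns m                                       ≡⟨ ⊙-unit-columns C ⟩
      C                                                        ∎)

  lincomb-⊙ : ∀ {k m n} (C : Vec (Vec F n) m) a (W : Vec (Vec F m) k) → lincomb a (C ⊙ W) ≡ C ∙ lincomb a W
  lincomb-⊙ C []      []      = sym (lincomb-zero C)
  lincomb-⊙ C (a ∷ x) (w ∷ W) = begin
    a *V C ∙ w +V lincomb x (C ⊙ W)     ≡⟨ cong₂ _+V_ (lincomb-* a w C) (sym (lincomb-⊙ C x W)) ⟨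
    C ∙ (a *V w) +V C ∙ lincomb x W     ≡⟨ lincomb-+ (a *V w) (lincomb x W) C ⟨
    C ∙ (a *V w +V lincomb x W)         ∎

  ∙-ext : ∀ {m n} (C D : Vec (Vec F n) m) → (∀ x → C ∙ x ≡ D ∙ x) → C ≡ D
  ∙-ext C D eq = trans (sym (⊙-unit-columns C)) (trans (map-cong eq _) (⊙-unit-columns D))

-- Similitudes and their fixed frames

module Similitudes (ℓ : ℕ) {{nz : NonZero ℓ}} (ℓ-prime : Prime ℓ) (n : ℕ)
  (form : Vectors.SymplecticForm ℓ n) (g : ℕ) (g+g≡n : g + g ≡ n) where
  open GramFrames ℓ {{nz}} ℓ-prime n form public
  open Matrices ℓ {{nz}} public
  open ≡-Reasoning

  -- Below the diagonal, Ω has the entry -1 at the positions (j + g , j) and zeros elsewhere.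
  σ : ℕ → F
  σ d = if does (suc d ℕ.≟ g) then -1F else 0F

  σ-zero : ∀ d → suc d ≢ g → σ d ≡ 0F
  σ-zero d = if-no (suc d ℕ.≟ g)

  σ-one : ∀ d → suc d ≡ g → σ d ≡ -1F
  σ-one d = if-yes (suc d ℕ.≟ g)

  _·σ : F → ℕ → F
  (c ·σ) d = c *F σ d

  fill-*V : ∀ c m h → fill m (λ d → c *F h d) ≡ c *V fill m h
  fill-*V c zero    h = refl
  fill-*V c (suc m) h = cong ((c *F h 0) ∷_) (fill-*V c m (h ∘ suc))

  -- The offsets fix one half of the Gram matrix, alternation and skewness the rest. Proportional
  -- prescriptions therefore give proportional bilinear forms in the coordinates.
  β-good : ∀ c {m} (C D : Frame m) → Good (c ·σ) C → Good σ D → ∀ x y →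
    β (lincomb x C) (lincomb y C) ≡ c *F β (lincomb x D) (lincomb y D)
  β-good c []      []      _ _ []      []      = trans (β-alternating _) (sym (trans (cong (c *F_) (β-alternating _)) (R.zeroʳ c)))
  β-good c {suc m} (u ∷ C) (v ∷ D) (gC , _ , pC) (gD , _ , pD) (a ∷ x) (b ∷ y) = begin
    β (a *V u +V lincomb x C) (b *V u +V lincomb y C)
      ≡⟨ expand u C x y ⟩
    (a *F (-F dot y (pair C u))) +F ((b *F dot x (pair C u)) +F β (lincomb x C) (lincomb y C))
      ≡⟨ cong₂ (λ p q → (a *F (-F dot y p)) +F ((b *F dot x p) +F q)) (trans pC (fill-*V c m σ)) (β-good c C D gC gD x y) ⟩
    (a *F (-F dot y (c *V fill m σ))) +F ((b *F dot x (c *V fill m σ)) +F (c *F β (lincomb x D) (lincomb y D)))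
      ≡⟨ cong₂ (λ p q → (a *F (-F p)) +F ((b *F q) +F (c *F β (lincomb x D) (lincomb y D)))) (dot-*ʳ c y _) (dot-*ʳ c x _) ⟩
    (a *F (-F (c *F dot y (fill m σ)))) +F ((b *F (c *F dot x (fill m σ))) +F (c *F β (lincomb x D) (lincomb y D)))
      ≡⟨ solve 6 (λ a b c p q r → a :* (:- (c :* p)) :+ (b :* (c :* q) :+ c :* r) := c :* (a :* (:- p) :+ (b :* q :+ r))) refl a b c (dot y (fill m σ)) (dot x (fill m σ)) _ ⟩
    c *F ((a *F (-F dot y (fill m σ))) +F ((b *F dot x (fill m σ)) +F β (lincomb x D) (lincomb y D)))
      ≡⟨ cong (λ p → c *F ((a *F (-F dot y p)) +F ((b *F dot x p) +F β (lincomb x D) (lincomb y D)))) pD ⟨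
    c *F ((a *F (-F dot y (pair D v))) +F ((b *F dot x (pair D v)) +F β (lincomb x D) (lincomb y D)))
      ≡⟨ cong (c *F_) (expand v D x y) ⟨
    c *F β (a *V v +V lincomb x D) (b *V v +V lincomb y D) ∎
    where
    open RS
    expand : ∀ u (C : Frame m) x y → β (a *V u +V lincomb x C) (b *V u +V lincomb y C) ≡
      (a *F (-F dot y (pair C u))) +F ((b *F dot x (pair C u)) +F β (lincomb x C) (lincomb y C))
    expand u C x y = begin
      β (a *V u +V lincomb x C) (b *V u +V lincomb y C)
        ≡⟨ trans (β-+ˡ _ _ _) (cong₂ _+F_ (trans (β-*ˡ a u _) (cong (a *F_) (β-+ʳ u _ _))) (β-+ʳ _ _ _)) ⟩
      (a *F (β u (b *V u) +F β u (lincomb y C))) +F (β (lincomb x C) (b *V u) +F β (lincomb x C) (lincomb y C))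
        ≡⟨ cong₂ (λ p q → (a *F p) +F (q +F β (lincomb x C) (lincomb y C)))
             (trans (cong₂ _+F_ (trans (β-*ʳ b u u) (trans (cong (b *F_) (β-alternating u)) (R.zeroʳ b)))
                                (trans (β-skew u _) (cong -F_ (β-lincombˡ y C u)))) (R.+-identityˡ _))
             (trans (β-*ʳ b _ u) (cong (b *F_) (β-lincombˡ x C u))) ⟩
      (a *F (-F dot y (pair C u))) +F ((b *F dot x (pair C u)) +F β (lincomb x C) (lincomb y C)) ∎

  Sim : F → Frame n → Set
  Sim c C = ∀ x y → β (C ∙ x) (C ∙ y) ≡ c *F β x y

  sim-∙-zero : ∀ {c} → c ≢ 0F → ∀ {C} → Sim c C → ∀ {x} → C ∙ x ≡ zeroVec → x ≡ zeroVec
  sim-∙-zero {c} c≢0 {C} sim {x} Cx≡0 = β-nondegenerate x λ y → begin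
    β x y                  ≡⟨ R.*-identityˡ _ ⟨
    1F *F β x y            ≡⟨ cong (_*F β x y) (proj₂ c⁻¹) ⟨
    (proj₁ c⁻¹ *F c) *F β x y   ≡⟨ R.*-assoc (proj₁ c⁻¹) c (β x y) ⟩
    proj₁ c⁻¹ *F (c *F β x y)   ≡⟨ cong (proj₁ c⁻¹ *F_) (trans (sym (sim x y)) (trans (cong (λ z → β z (C ∙ y)) Cx≡0) (β-zeroˡ _))) ⟩
    proj₁ c⁻¹ *F 0F        ≡⟨ R.zeroʳ (proj₁ c⁻¹) ⟩
    0F                     ∎
    where c⁻¹ = inverse ℓ-prime c c≢0

  ∙-injective : ∀ {C : Frame n} → (∀ {x} → C ∙ x ≡ zeroVec → x ≡ zeroVec) → ∀ {x y} → C ∙ x ≡ C ∙ y → x ≡ y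
  ∙-injective {C} ker {x} {y} eq = +V-cancelʳ (-1F *V y) (trans (ker (begin
    C ∙ (x +V -1F *V y)            ≡⟨ trans (lincomb-+ x _ C) (cong₂ _+V_ eq (lincomb-* -1F y C)) ⟩
    C ∙ y +V -1F *V C ∙ y          ≡⟨ +V-inverseʳ _ ⟩
    zeroVec                        ∎)) (sym (+V-inverseʳ y)))

  sim-good : ∀ {c C} → c ≢ 0F → Sim c C → ∀ {m} (W : Frame m) → Good σ W → Good (c ·σ) (C ⊙ W)
  sim-good c≢0 sim []      _ = tt
  sim-good {c} {C} c≢0 sim {suc m} (x ∷ W) (gW , x∉W , pW) = sim-good c≢0 sim W gW
    , (λ (a , e) → x∉W (a , ∙-injective {C} (sim-∙-zero c≢0 {C} sim) (trans (sym (lincomb-⊙ C a W)) e)))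
    , trans (pair-⊙ W) (trans (cong (c *V_) pW) (sym (fill-*V c m σ)))
    where
    pair-⊙ : ∀ {k} (W : Frame k) → pair (C ⊙ W) (C ∙ x) ≡ c *V pair W x
    pair-⊙ []      = refl
    pair-⊙ (w ∷ W) = cong₂ _∷_ (sim w x) (pair-⊙ W)

  injective⇒indep : ∀ {m} (W : Frame m) → (∀ {a b} → lincomb a W ≡ lincomb b W → a ≡ b) → Indep W
  injective⇒indep []      inj = tt
  injective⇒indep (x ∷ W) inj = injective⇒indep W (λ {a} {b} e → ∷-injectiveʳ (inj {0F ∷ a} {0F ∷ b} (cong (0F *V x +V_) e)))
    , λ (a , e) → 0F≢1F ℓ-prime (∷-injectiveˡ (inj {0F ∷ a} {1F ∷ zeroVec} (begin
        0F *V x +V lincomb a W          ≡⟨ trans (cong₂ _+V_ (*V-zeroˡ x) e) (+V-identityˡ x) ⟩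
        x                               ≡⟨ trans (cong₂ _+V_ (*V-identityˡ x) (lincomb-zero W)) (+V-identityʳ x) ⟨
        1F *V x +V lincomb zeroVec W    ∎)))

-- That the unit columns are good for `σ` is what ties the abstract form to Ω; `StandardForm`
-- supplies it.
module SimilitudeCounts (ℓ : ℕ) {{nz : NonZero ℓ}} (ℓ-prime : Prime ℓ) (n : ℕ)
  (form : Vectors.SymplecticForm ℓ n) (g : ℕ) (g+g≡n : g + g ≡ n)
  (unit-columns-good : Similitudes.Good ℓ ℓ-prime n form g g+g≡n (Similitudes.σ ℓ ℓ-prime n form g g+g≡n) (Matrices.unit-columns ℓ n))
  where
  open Similitudes ℓ {{nz}} ℓ-prime n form g g+g≡n public
  open ≡-Reasoning

  GSp? : ∀ c (C : Frame n) → Dec (Good (c ·σ) C)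
  GSp? c = good? (c ·σ)

  good⇒sim : ∀ c C → Good (c ·σ) C → Sim c C
  good⇒sim c C gC x y = trans (β-good c C (unit-columns n) gC unit-columns-good x y)
    (cong (c *F_) (cong₂ β (lincomb-unit-columns x) (lincomb-unit-columns y)))

  sim⇒good : ∀ c C → c ≢ 0F → Sim c C → Good (c ·σ) C
  sim⇒good c C c≢0 sim = subst (Good (c ·σ)) (⊙-unit-columns C) (sim-good {c} {C} c≢0 sim (unit-columns n) unit-columns-good)

  1F≢0F : 1F ≢ 0F
  1F≢0F = 0F≢1F ℓ-prime ∘ sym

  sim-1-injective : ∀ {P} → Sim 1F P → ∀ {x y} → P ∙ x ≡ P ∙ y → x ≡ y
  sim-1-injective {P} sP = ∙-injective {P} (sim-∙-zero 1F≢0F {P} sP)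

  sim-1-surjective : ∀ {P} → Sim 1F P → ∀ y → ∃ λ x → P ∙ x ≡ y
  sim-1-surjective {P} sP = injective⇒surjective (VE n) (P ∙_) (sim-1-injective {P} sP)

  ⊙-injectiveˡ : ∀ {P} → Sim 1F P → ∀ {M N : Frame n} → M ⊙ P ≡ N ⊙ P → M ≡ N
  ⊙-injectiveˡ {P} sP {M} {N} eq = ∙-ext M N λ y → let x , Px≡y = sim-1-surjective {P} sP y in begin
    M ∙ y              ≡⟨ cong (M ∙_) Px≡y ⟨
    M ∙ P ∙ x          ≡⟨ lincomb-⊙ M x P ⟨
    (M ⊙ P) ∙ x        ≡⟨ cong (_∙ x) eq ⟩
    (N ⊙ P) ∙ x        ≡⟨ lincomb-⊙ N x P ⟩
    N ∙ P ∙ x          ≡⟨ cong (N ∙_) Px≡y ⟩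
    N ∙ y              ∎

  sim-⊙⁺ : ∀ {c M P} → Sim 1F P → Sim c M → Sim c (M ⊙ P)
  sim-⊙⁺ {c} {M} {P} sP sM x y = begin
    β ((M ⊙ P) ∙ x) ((M ⊙ P) ∙ y)   ≡⟨ cong₂ β (lincomb-⊙ M x P) (lincomb-⊙ M y P) ⟩
    β (M ∙ P ∙ x) (M ∙ P ∙ y)       ≡⟨ sM (P ∙ x) (P ∙ y) ⟩
    c *F β (P ∙ x) (P ∙ y)          ≡⟨ cong (c *F_) (trans (sP x y) (R.*-identityˡ _)) ⟩
    c *F β x y                      ∎

  sim-⊙⁻ : ∀ {c M P} → Sim 1F P → Sim c (M ⊙ P) → Sim c M
  sim-⊙⁻ {c} {M} {P} sP sMP x y = begin
    β (M ∙ x) (M ∙ y)                   ≡⟨ cong₂ β (trans (cong (M ∙_) (sym (proj₂ x′))) (sym (lincomb-⊙ M (proj₁ x′) P)))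
                                                   (trans (cong (M ∙_) (sym (proj₂ y′))) (sym (lincomb-⊙ M (proj₁ y′) P))) ⟩
    β ((M ⊙ P) ∙ proj₁ x′) ((M ⊙ P) ∙ proj₁ y′)  ≡⟨ sMP (proj₁ x′) (proj₁ y′) ⟩
    c *F β (proj₁ x′) (proj₁ y′)        ≡⟨ cong (c *F_) (trans (sP (proj₁ x′) (proj₁ y′)) (R.*-identityˡ _)) ⟨
    c *F β (P ∙ proj₁ x′) (P ∙ proj₁ y′)  ≡⟨ cong (c *F_) (cong₂ β (proj₂ x′) (proj₂ y′)) ⟩
    c *F β x y                          ∎
    where
    x′ = sim-1-surjective {P} sP x
    y′ = sim-1-surjective {P} sP y

  -- The first g chosen columns have to be mutually orthogonal. After that, each new column pairs
  -- nontrivially with exactly one of the earlier ones, the one at distance g.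
  step-count : ℕ → ℕ
  step-count m = if does (m ℕ.<? g) then ℓ ^ (n ∸ m) ∸ ℓ ^ m else ℓ ^ (n ∸ m)

  completions : ℕ → ℕ → ℕ
  completions k d = prod-range step-count k d

  g≤n : g ≤ n
  g≤n = subst (g ≤_) g+g≡n (ℕP.m≤m+n g g)

  -1F≢0F : -1F ≢ 0F
  -1F≢0F eq = 1F≢0F (begin
    1F                   ≡⟨ RS.solve 1 (λ a → a RS.:= RS.:- (RS.:- a)) refl 1F ⟩
    -F -1F               ≡⟨ cong -F_ eq ⟩
    -F 0F                ≡⟨ RS.solve 0 (RS.:- RS.:0 RS.:= RS.:0) refl ⟩
    0F                   ∎)

  *F-nonzero : ∀ {a b} → a ≢ 0F → b ≢ 0F → (a *F b) ≢ 0F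
  *F-nonzero {a} {b} a≢0 b≢0 eq = b≢0 (begin
    b                       ≡⟨ R.*-identityˡ b ⟨
    1F *F b                 ≡⟨ cong (_*F b) (proj₂ a⁻¹) ⟨
    (proj₁ a⁻¹ *F a) *F b   ≡⟨ R.*-assoc (proj₁ a⁻¹) a b ⟩
    proj₁ a⁻¹ *F (a *F b)   ≡⟨ cong (proj₁ a⁻¹ *F_) eq ⟩
    proj₁ a⁻¹ *F 0F         ≡⟨ R.zeroʳ (proj₁ a⁻¹) ⟩
    0F                      ∎)
    where a⁻¹ = inverse ℓ-prime a a≢0

  ·σ-zero : ∀ c d → suc d ≢ g → (c ·σ) d ≡ 0F
  ·σ-zero c d ne = trans (cong (c *F_) (σ-zero d ne)) (R.zeroʳ c)

  g∸1 : ∀ {m} → g ≤ m → m < n → ∃ λ p → suc p ≡ g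
  g∸1 {m} g≤m m<n = pred-of g refl
    where
    pred-of : ∀ h → h ≡ g → ∃ λ p → suc p ≡ g
    pred-of zero    refl = contradiction (subst (m <_) (sym g+g≡n) m<n) λ ()
    pred-of (suc p) e    = p , e

  good-extensions : ∀ {c m} → c ≢ 0F → m < n → ∀ (W : Frame m) →
    sumV (λ x → 𝟙 (good? (c ·σ) (x ∷ W))) ≡ 𝟙 (good? (c ·σ) W) * step-count m
  good-extensions {c} {m} c≢0 m<n W = by-cases (m ℕ.<? g)
    where
    by-cases : Dec (m < g) → sumV (λ x → 𝟙 (good? (c ·σ) (x ∷ W))) ≡ 𝟙 (good? (c ·σ) W) * step-count m
    by-cases (yes m<g) = trans
      (isotropic-extensions (c ·σ) W (ℕP.<⇒≤ m<n) (λ d d<m → ·σ-zero c d (λ e → ℕP.<⇒≢ (ℕP.≤-<-trans d<m m<g) e)))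
      (cong (𝟙 (good? (c ·σ) W) *_) (sym (if-yes (m ℕ.<? g) m<g)))
    by-cases (no m≮g) = trans
      (hyperbolic-extensions (c ·σ) W (ℕP.<⇒≤ m<n) p (subst (_≤ m) (sym 1+p≡g) g≤m)
        (λ e → *F-nonzero c≢0 -1F≢0F (trans (cong (c *F_) (sym (σ-one p 1+p≡g))) e))
        (λ d d<p → ·σ-zero c d (λ e → ℕP.<⇒≢ d<p (ℕP.suc-injective (trans e (sym 1+p≡g)))))
        -- For `suc d ≡ g` the position `suc (p + d)` would be n - 1, which is not below m because m
        -- < n: behind column p, no column of `W` is at distance g.
        (λ d lt → ·σ-zero c d (λ e → ℕP.<-irrefl (n≡2+p+d e) (ℕP.≤-<-trans lt m<n))))
      (cong (𝟙 (good? (c ·σ) W) *_) (sym (if-no (m ℕ.<? g) m≮g)))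
      where
      g≤m = ℕP.≮⇒≥ m≮g
      p = proj₁ (g∸1 g≤m m<n)
      1+p≡g = proj₂ (g∸1 g≤m m<n)
      n≡2+p+d : ∀ {d} → suc d ≡ g → suc (suc (p + d)) ≡ n
      n≡2+p+d {d} e = trans (cong suc (sym (ℕP.+-suc p d))) (trans (cong₂ _+_ 1+p≡g e) g+g≡n)

  isotropic : ℕ → F
  isotropic _ = 0F

  iso? : ∀ {m} (W : Frame m) → Dec (Good isotropic W)
  iso? = good? isotropic

  #iso : ℕ → ℕ
  #iso k = sumFrames k (λ W → 𝟙 (iso? W))

  -- Among at most g consecutive columns no two are at distance g, so the only nonzero value of `σ`
  -- is never prescribed.
  𝟙-good≡𝟙-iso : ∀ c {k} → k ≤ g → (W : Frame k) → 𝟙 (good? (c ·σ) W) ≡ 𝟙 (iso? W)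
  𝟙-good≡𝟙-iso c {k} k≤g W = 𝟙-cong (good? (c ·σ) W) (iso? W)
    (good-cong W (λ d d<k → zero′ d d<k)) (good-cong W (λ d d<k → sym (zero′ d d<k)))
    where
    zero′ : ∀ d → suc d < k → (c ·σ) d ≡ 0F
    zero′ d d<k = ·σ-zero c d (ℕP.<⇒≢ (ℕP.<-≤-trans d<k k≤g))

  #iso-suc : ∀ k → k ≤ n → #iso (suc k) ≡ #iso k * (ℓ ^ (n ∸ k) ∸ ℓ ^ k)
  #iso-suc k k≤n = begin
    #iso (suc k)                                                    ≡⟨ ∑-allVecsOf-suc ℓ (elems (VE n)) k _ ⟩
    sumV (λ x → sumFrames k (λ W → 𝟙 (iso? (x ∷ W))))               ≡⟨ ∑-swap (elems (VE n)) (elems (frameEnum k)) _ ⟩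
    sumFrames k (λ W → sumV (λ x → 𝟙 (iso? (x ∷ W))))               ≡⟨ ∑-cong (elems (frameEnum k)) (λ W → isotropic-extensions isotropic W k≤n (λ _ _ → refl)) ⟩
    sumFrames k (λ W → 𝟙 (iso? W) * (ℓ ^ (n ∸ k) ∸ ℓ ^ k))          ≡⟨ ∑-*ʳ (elems (frameEnum k)) _ _ ⟩
    #iso k * (ℓ ^ (n ∸ k) ∸ ℓ ^ k)                                  ∎

  -- Isotropic subspaces have dimension at most g; here this is the vanishing of the last factor
  -- ℓ^(n-g) - ℓ^g, and it is what ends the Möbius sums at g.
  #iso-vanishes : #iso (suc g) ≡ 0
  #iso-vanishes = trans (#iso-suc g g≤n) (trans (cong (λ z → #iso g * (ℓ ^ z ∸ ℓ ^ g)) n∸g≡g)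
    (trans (cong (#iso g *_) (ℕP.n∸n≡0 (ℓ ^ g))) (ℕP.*-zeroʳ (#iso g))))
    where
    n∸g≡g : n ∸ g ≡ g
    n∸g≡g = trans (cong (_∸ g) (sym g+g≡n)) (ℕP.m+n∸n≡m g g)

  sum-by-suffix : ∀ {c} → c ≢ 0F → ∀ {k d} (eq : d + k ≡ n) → k ≤ g → (f : Frame k → ℕ) →
    sumFrames n (λ C → 𝟙 (GSp? c C) * f (suffix d eq C)) ≡ completions k d * sumFrames k (λ W → 𝟙 (iso? W) * f W)
  sum-by-suffix {c} c≢0 {k} {d} eq k≤g f = trans
    (sum-completions ℓ (VE n) (λ W → 𝟙 (good? (c ·σ) W)) step-count k d eq
      (λ i i<d W → good-extensions c≢0 (subst (i + k <_) eq (ℕP.+-monoˡ-< k i<d)) W) f)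
    (cong (completions k d *_) (∑-cong (elems (frameEnum k)) (λ W → cong (_* f W) (𝟙-good≡𝟙-iso c k≤g W))))

  order : ℕ
  order = completions 0 n

  #GSp≡order : ∀ {c} → c ≢ 0F → sumFrames n (λ C → 𝟙 (GSp? c C)) ≡ order
  #GSp≡order {c} c≢0 = begin
    sumFrames n (λ C → 𝟙 (GSp? c C))       ≡⟨ ∑-cong (elems (frameEnum n)) (λ C → sym (ℕP.*-identityʳ _)) ⟩
    sumFrames n (λ C → 𝟙 (GSp? c C) * 1)   ≡⟨ sum-by-suffix c≢0 {0} {n} (ℕP.+-identityʳ n) z≤n (λ _ → 1) ⟩
    order * 1                              ≡⟨ ℕP.*-identityʳ order ⟩
    order                                  ∎

  order≡completions*#iso : ∀ {k d} → d + k ≡ n → k ≤ g → order ≡ completions k d * #iso k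
  order≡completions*#iso {k} {d} eq k≤g = begin
    order                                          ≡⟨ #GSp≡order 1F≢0F ⟨
    sumFrames n (λ C → 𝟙 (GSp? 1F C))              ≡⟨ ∑-cong (elems (frameEnum n)) (λ C → sym (ℕP.*-identityʳ _)) ⟩
    sumFrames n (λ C → 𝟙 (GSp? 1F C) * 1)          ≡⟨ sum-by-suffix 1F≢0F eq k≤g (λ _ → 1) ⟩
    completions k d * sumFrames k (λ W → 𝟙 (iso? W) * 1)  ≡⟨ cong (completions k d *_) (∑-cong (elems (frameEnum k)) (λ W → ℕP.*-identityʳ _)) ⟩
    completions k d * #iso k                       ∎

  1<ℓ : 1 < ℓ
  1<ℓ = ℕ.nonTrivial⇒n>1 ℓ {{prime⇒nonTrivial ℓ-prime}}

  step-count≢0 : ∀ m → m < n → step-count m ≢ 0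
  step-count≢0 m m<n = by-cases (m ℕ.<? g)
    where
    by-cases : Dec (m < g) → step-count m ≢ 0
    by-cases (yes m<g) eq = ℕP.m>n⇒m∸n≢0 (ℕP.^-monoʳ-< ℓ 1<ℓ m<n∸m) (trans (sym (if-yes (m ℕ.<? g) m<g)) eq)
      where
      m<n∸m : m < n ∸ m
      m<n∸m = ℕP.m+n≤o⇒m≤o∸n (suc m) (subst (suc m + m ≤_) g+g≡n (ℕP.+-mono-≤ m<g (ℕP.<⇒≤ m<g)))
    by-cases (no m≮g) eq = ℕ.≢-nonZero⁻¹ (ℓ ^ (n ∸ m)) {{ℕP.m^n≢0 ℓ (n ∸ m)}} (trans (sym (if-no (m ℕ.<? g) m≮g)) eq)

  completions≢0 : ∀ k d → d + k ≤ n → completions k d ≢ 0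
  completions≢0 k zero    le ()
  completions≢0 k (suc d) le eq with ℕP.m*n≡0⇒m≡0∨n≡0 (step-count (d + k)) eq
  ... | inj₁ e = step-count≢0 (d + k) le e
  ... | inj₂ e = completions≢0 k d (ℕP.≤-trans (ℕP.n≤1+n _) le) e

  good-suffix : ∀ τ d {k N} (eq : d + k ≡ N) (C : Frame N) → Good τ C → Good τ (suffix d eq C)
  good-suffix τ zero    refl C       gC        = gC
  good-suffix τ (suc d) refl (x ∷ C) (gC , _) = good-suffix τ d refl C gC

  -- Averaging over Sp replaces its transitivity on isotropic frames.
  sum-isotropic-frames : ∀ {k d} (eq : d + k ≡ n) → k ≤ g → (Ψ : Frame k → ℕ) (K : ℕ) →
    (∀ P → Good (1F ·σ) P → Ψ (suffix d eq P) ≡ K) → sumFrames k (λ W → 𝟙 (iso? W) * Ψ W) ≡ #iso k * K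
  sum-isotropic-frames {k} {d} eq k≤g Ψ K const = ℕP.*-cancelˡ-≡ _ _ (completions k d)
    {{ℕ.≢-nonZero (completions≢0 k d (ℕP.≤-reflexive eq))}} (begin
      completions k d * sumFrames k (λ W → 𝟙 (iso? W) * Ψ W)     ≡⟨ sum-by-suffix 1F≢0F eq k≤g Ψ ⟨
      sumFrames n (λ P → 𝟙 (GSp? 1F P) * Ψ (suffix d eq P))      ≡⟨ ∑-cong (elems (frameEnum n)) (λ P → 𝟙-*-cong (GSp? 1F P) (const P)) ⟩
      sumFrames n (λ P → 𝟙 (GSp? 1F P) * K)                      ≡⟨ ∑-*ʳ (elems (frameEnum n)) K _ ⟩
      sumFrames n (λ P → 𝟙 (GSp? 1F P)) * K                      ≡⟨ cong (_* K) (trans (#GSp≡order 1F≢0F) (order≡completions*#iso eq k≤g)) ⟩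
      completions k d * #iso k * K                               ≡⟨ ℕP.*-assoc (completions k d) _ _ ⟩
      completions k d * (#iso k * K)                             ∎)

  _≟Fr_ : ∀ {k} (W W′ : Frame k) → Dec (W ≡ W′)
  _≟Fr_ {k} = Enumeration._≟_ (frameEnum k)

  -- With the two sums exchanged, `W` may be taken as the last k columns of a symplectic `P`.
  -- Replacing M by M P turns "M fixes W" into "the last k columns of the similitude are those of
  -- P", and the number of completions does not depend on P.
  sum-fixed-frames : ∀ {c} → c ≢ 0F → ∀ {k} → k ≤ g →
    sumFrames n (λ M → 𝟙 (GSp? c M) * sumFrames k (λ W → 𝟙 (iso? W) * 𝟙 ((M ⊙ W) ≟Fr W))) ≡ order
  sum-fixed-frames {c} c≢0 {k} k≤g = begin
    sumFrames n (λ M → 𝟙 (GSp? c M) * sumFrames k (λ W → 𝟙 (iso? W) * 𝟙 ((M ⊙ W) ≟Fr W)))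
      ≡⟨ ∑-cong (elems (frameEnum n)) (λ M → sym (∑-*ˡ (elems (frameEnum k)) (𝟙 (GSp? c M)) _)) ⟩
    sumFrames n (λ M → sumFrames k (λ W → 𝟙 (GSp? c M) * (𝟙 (iso? W) * 𝟙 ((M ⊙ W) ≟Fr W))))
      ≡⟨ ∑-swap (elems (frameEnum n)) (elems (frameEnum k)) _ ⟩
    sumFrames k (λ W → sumFrames n (λ M → 𝟙 (GSp? c M) * (𝟙 (iso? W) * 𝟙 ((M ⊙ W) ≟Fr W))))
      ≡⟨ ∑-cong (elems (frameEnum k)) (λ W → trans (∑-cong (elems (frameEnum n)) (λ M → x∙yz≈y∙xz (𝟙 (GSp? c M)) (𝟙 (iso? W)) _))
           (∑-*ˡ (elems (frameEnum n)) (𝟙 (iso? W)) _)) ⟩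
    sumFrames k (λ W → 𝟙 (iso? W) * Ψ W)   ≡⟨ sum-isotropic-frames eq k≤g Ψ (completions k d) Ψ-const ⟩
    #iso k * completions k d               ≡⟨ ℕP.*-comm (#iso k) _ ⟩
    completions k d * #iso k               ≡⟨ order≡completions*#iso eq k≤g ⟨
    order                                  ∎
    where
    d = n ∸ k
    eq : d + k ≡ n
    eq = ℕP.m∸n+n≡m (ℕP.≤-trans k≤g g≤n)

    Ψ : Frame k → ℕ
    Ψ W = sumFrames n (λ M → 𝟙 (GSp? c M) * 𝟙 ((M ⊙ W) ≟Fr W))

    Ψ-const : ∀ P → Good (1F ·σ) P → Ψ (suffix d eq P) ≡ completions k d
    Ψ-const P gP = begin
      Ψ (suffix d eq P)
        ≡⟨ ∑-cong (elems (frameEnum n)) (λ M → cong₂ _*_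
             (𝟙-cong (GSp? c M) (GSp? c (M ⊙ P))
               (λ gM → sim⇒good c (M ⊙ P) c≢0 (sim-⊙⁺ {c} {M} {P} sP (good⇒sim c M gM)))
               (λ gMP → sim⇒good c M c≢0 (sim-⊙⁻ {c} {M} {P} sP (good⇒sim c (M ⊙ P) gMP))))
             (cong (λ z → 𝟙 (z ≟Fr suffix d eq P)) (sym (suffix-map (M ∙_) d eq P)))) ⟩
      sumFrames n (λ M → 𝟙 (GSp? c (M ⊙ P)) * 𝟙 (suffix d eq (M ⊙ P) ≟Fr suffix d eq P))
        ≡⟨ sum-reindex (frameEnum n) (_⊙ P) (⊙-injectiveˡ {P} sP) (λ M → 𝟙 (GSp? c M) * 𝟙 (suffix d eq M ≟Fr suffix d eq P)) ⟩
      sumFrames n (λ M → 𝟙 (GSp? c M) * 𝟙 (suffix d eq M ≟Fr suffix d eq P))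
        ≡⟨ sum-by-suffix c≢0 eq k≤g (λ W → 𝟙 (W ≟Fr suffix d eq P)) ⟩
      completions k d * sumFrames k (λ W → 𝟙 (iso? W) * 𝟙 (W ≟Fr suffix d eq P))
        ≡⟨ cong (completions k d *_) (∑-cong (elems (frameEnum k)) (λ W → ℕP.*-comm (𝟙 (iso? W)) _)) ⟩
      completions k d * sumFrames k (λ W → 𝟙 (W ≟Fr suffix d eq P) * 𝟙 (iso? W))
        ≡⟨ cong (completions k d *_) (sum-δ (frameEnum k) (suffix d eq P) (λ W → 𝟙 (iso? W))) ⟩
      completions k d * 𝟙 (iso? (suffix d eq P))
        ≡⟨ cong (completions k d *_) (trans (sym (𝟙-good≡𝟙-iso 1F k≤g (suffix d eq P))) (𝟙-yes (GSp-suffix?) (good-suffix (1F ·σ) d eq P gP))) ⟩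
      completions k d * 1
        ≡⟨ ℕP.*-identityʳ _ ⟩
      completions k d ∎
      where
      sP = good⇒sim 1F P gP
      GSp-suffix? = good? (1F ·σ) (suffix d eq P)

-- From counts to rational sums

Σ₁-+ : ∀ m f h → Σ₁ m (λ k → f k ℚ.+ h k) ≡ Σ₁ m f ℚ.+ Σ₁ m h
Σ₁-+ zero    f h = refl
Σ₁-+ (suc m) f h = trans (cong (ℚ._+ (f (suc m) ℚ.+ h (suc m))) (Σ₁-+ m f h))
  (QS.solve 4 (λ a b c d → (a QS.:+ b) QS.:+ (c QS.:+ d) QS.:= (a QS.:+ c) QS.:+ (b QS.:+ d)) refl (Σ₁ m f) (Σ₁ m h) (f (suc m)) (h (suc m)))

Σ₁-zero : ∀ m {f} → (∀ k → f k ≡ 0ℚ) → Σ₁ m f ≡ 0ℚ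
Σ₁-zero zero    eq = refl
Σ₁-zero (suc m) eq = cong₂ ℚ._+_ (Σ₁-zero m eq) (eq (suc m))

∑-expansion : ∀ {A : Set} (L : List A) (m : ℕ) (t w : A → ℕ) (f : ℕ → A → ℕ) (p : ℕ → ℚ) →
  (∀ M → ℕ→ℚ (t M) ≡ ℕ→ℚ (w M) ℚ.+ Σ₁ m (λ k → ℕ→ℚ (f k M) ℚ.* p k)) →
  ℕ→ℚ (∑ L t) ≡ ℕ→ℚ (∑ L w) ℚ.+ Σ₁ m (λ k → ℕ→ℚ (∑ L (f k)) ℚ.* p k)
∑-expansion []      m t w f p eq = sym (trans (ℚP.+-identityˡ _) (Σ₁-zero m (λ k → ℚP.*-zeroˡ (p k))))
∑-expansion (M ∷ L) m t w f p eq = begin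
  ℕ→ℚ (t M + ∑ L t)
    ≡⟨ trans (ℕ→ℚ-+ (t M) (∑ L t)) (cong₂ ℚ._+_ (eq M) (∑-expansion L m t w f p eq)) ⟩
  (ℕ→ℚ (w M) ℚ.+ S₁) ℚ.+ (ℕ→ℚ (∑ L w) ℚ.+ S₂)
    ≡⟨ QS.solve 4 (λ a b c d → (a QS.:+ b) QS.:+ (c QS.:+ d) QS.:= (a QS.:+ c) QS.:+ (b QS.:+ d)) refl (ℕ→ℚ (w M)) S₁ (ℕ→ℚ (∑ L w)) S₂ ⟩
  (ℕ→ℚ (w M) ℚ.+ ℕ→ℚ (∑ L w)) ℚ.+ (S₁ ℚ.+ S₂)
    ≡⟨ cong₂ ℚ._+_ (sym (ℕ→ℚ-+ (w M) (∑ L w))) (trans (sym (Σ₁-+ m _ _)) (Σ₁-cong m λ k →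
         trans (sym (ℚP.*-distribʳ-+ (p k) (ℕ→ℚ (f k M)) (ℕ→ℚ (∑ L (f k))))) (cong (ℚ._* p k) (sym (ℕ→ℚ-+ (f k M) (∑ L (f k))))))) ⟩
  ℕ→ℚ (w M + ∑ L w) ℚ.+ Σ₁ m (λ k → ℕ→ℚ (f k M + ∑ L (f k)) ℚ.* p k) ∎
  where
  open ≡-Reasoning
  S₁ = Σ₁ m (λ k → ℕ→ℚ (f k M) ℚ.* p k)
  S₂ = Σ₁ m (λ k → ℕ→ℚ (∑ L (f k)) ℚ.* p k)

module InverseFactors (ℓ : ℕ) {{nz : NonZero ℓ}} (ℓ-prime : Prime ℓ) where
  invFactor invFactor² : ℕ → ℚ
  invFactor j = inv (1ℚ ℚ.- ℕ→ℚ (ℓ ^ j))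
  invFactor² j = inv (1ℚ ℚ.- ℕ→ℚ (ℓ ^ (2 * j)))

  ℓℚ : ℚ
  ℓℚ = ℕ→ℚ ℓ

  private
    1<ℓ : 1 < ℓ
    1<ℓ = ℕ.nonTrivial⇒n>1 ℓ {{prime⇒nonTrivial ℓ-prime}}

    1-ℓ^≢0 : ∀ j → 0 < j → 1ℚ ℚ.- ℕ→ℚ (ℓ ^ j) ≢ 0ℚ
    1-ℓ^≢0 j 0<j eq = ℕP.<⇒≢ (ℕP.^-monoʳ-< ℓ 1<ℓ 0<j) (ℕ→ℚ-injective {1} {ℓ ^ j} (begin
      1ℚ                                            ≡⟨ QS.solve 1 (λ y → QS.:1 QS.:= (QS.:1 QS.:- y) QS.:+ y) refl (ℕ→ℚ (ℓ ^ j)) ⟩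
      1ℚ ℚ.- ℕ→ℚ (ℓ ^ j) ℚ.+ ℕ→ℚ (ℓ ^ j)            ≡⟨ cong (ℚ._+ ℕ→ℚ (ℓ ^ j)) eq ⟩
      0ℚ ℚ.+ ℕ→ℚ (ℓ ^ j)                            ≡⟨ ℚP.+-identityˡ _ ⟩
      ℕ→ℚ (ℓ ^ j)                                   ∎))
      where open ≡-Reasoning

  invFactor-inverse : ∀ j → (1ℚ ℚ.- pw ℓℚ (suc j)) ℚ.* invFactor (suc j) ≡ 1ℚ
  invFactor-inverse j = trans (cong (λ z → (1ℚ ℚ.- z) ℚ.* invFactor (suc j)) (sym (ℕ→ℚ-^ ℓ (suc j)))) (*-invʳ _ (1-ℓ^≢0 (suc j) (s≤s z≤n)))

  invFactor²-inverse : ∀ j → (1ℚ ℚ.- pw ℓℚ (suc j) ℚ.* pw ℓℚ (suc j)) ℚ.* invFactor² (suc j) ≡ 1ℚ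
  invFactor²-inverse j = trans (cong (λ z → (1ℚ ℚ.- z) ℚ.* invFactor² (suc j)) (sym square)) (*-invʳ _ (1-ℓ^≢0 (2 * suc j) (s≤s z≤n)))
    where
    square : ℕ→ℚ (ℓ ^ (2 * suc j)) ≡ pw ℓℚ (suc j) ℚ.* pw ℓℚ (suc j)
    square = trans (cong (λ m → ℕ→ℚ (ℓ ^ (suc j + m))) (ℕP.+-identityʳ (suc j)))
      (trans (cong ℕ→ℚ (ℕP.^-distribˡ-+-* ℓ (suc j) (suc j)))
        (trans (ℕ→ℚ-* (ℓ ^ suc j) (ℓ ^ suc j)) (cong₂ ℚ._*_ (ℕ→ℚ-^ ℓ (suc j)) (ℕ→ℚ-^ ℓ (suc j)))))

-- Möbius inversion for isotropic subspaces

module IsotropicSubspaces (ℓ : ℕ) {{nz : NonZero ℓ}} (ℓ-prime : Prime ℓ) (n : ℕ)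
  (form : Vectors.SymplecticForm ℓ n) (g : ℕ) (g+g≡n : g + g ≡ n)
  (unit-columns-good : Similitudes.Good ℓ ℓ-prime n form g g+g≡n (Similitudes.σ ℓ ℓ-prime n form g g+g≡n) (Matrices.unit-columns ℓ n))
  where
  open SimilitudeCounts ℓ {{nz}} ℓ-prime n form g g+g≡n unit-columns-good public
  open InverseFactors ℓ {{nz}} ℓ-prime public
  open ≡-Reasoning

  record IsotropicSubspace : Set₁ where
    field
      U       : V → Set
      U?      : ∀ x → Dec (U x)
      U-zero  : U zeroVec
      U-lin   : ∀ a {x y} → U x → U y → U (a *V x +V y)
      U-iso   : ∀ {x y} → U x → U y → β x y ≡ 0F

    U-span : ∀ {m} {W : Frame m} → All U W → ∀ {x} → InSpan W x → U x
    U-span all (a , refl) = U-lincomb all a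
      where
      U-lincomb : ∀ {m} {W : Frame m} → All U W → ∀ a → U (lincomb a W)
      U-lincomb []         []      = U-zero
      U-lincomb (ux ∷ all) (a ∷ b) = U-lin a ux (U-lincomb all b)

    U-pair : ∀ {m} {W : Frame m} → All U W → ∀ {x} → U x → pair W x ≡ fill m isotropic
    U-pair []         ux = refl
    U-pair (uw ∷ all) ux = cong₂ _∷_ (U-iso uw ux) (U-pair all ux)

    #U : ℕ
    #U = sumV (λ x → 𝟙 (U? x))

    -- Inside the isotropic `U` all pairings vanish, so `iso?` tests only independence; in this form
    -- the count is visibly bounded by `#iso k`.
    #frames : ℕ → ℕ
    #frames k = sumFrames k (λ W → 𝟙 (iso? W) * 𝟙 (all? U? W))

    nontrivial? : Dec (∃ λ x → x ≢ zeroVec × U x)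
    nontrivial? = search (VE n) (λ x → ¬? (x ≟V zeroVec) ×-dec U? x)

    -- A frame inside `U` is extended by precisely the vectors of `U` outside its span, which has
    -- ℓ^k elements and lies in `U`. The additive form avoids truncated subtraction.
    #frames-suc : ∀ k → #frames (suc k) + #frames k * ℓ ^ k ≡ #frames k * #U
    #frames-suc k = begin
      #frames (suc k) + #frames k * ℓ ^ k
        ≡⟨ cong₂ _+_ (trans (∑-allVecsOf-suc ℓ (elems (VE n)) k _) (∑-swap (elems (VE n)) (elems (frameEnum k)) _))
                     (sym (∑-*ʳ (elems (frameEnum k)) (ℓ ^ k) _)) ⟩
      sumFrames k (λ W → sumV (λ x → new x W)) + sumFrames k (λ W → old W * ℓ ^ k)
        ≡⟨ ∑-+ (elems (frameEnum k)) _ _ ⟨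
      sumFrames k (λ W → sumV (λ x → new x W) + old W * ℓ ^ k)
        ≡⟨ ∑-cong (elems (frameEnum k)) (λ W → by-cases W (iso? W) refl (all? U? W) refl) ⟩
      sumFrames k (λ W → old W * #U)
        ≡⟨ ∑-*ʳ (elems (frameEnum k)) #U _ ⟩
      #frames k * #U ∎
      where
      new : V → Frame k → ℕ
      new x W = 𝟙 (iso? (x ∷ W)) * 𝟙 (all? U? (x ∷ W))
      old : Frame k → ℕ
      old W = 𝟙 (iso? W) * 𝟙 (all? U? W)

      extend : ∀ W → Good isotropic W → All U W → ∀ x → new x W + 𝟙 (inSpan? W x) ≡ 𝟙 (U? x)
      extend W gW aW x = split (U? x) (inSpan? W x)
        where
        split : Dec (U x) → Dec (InSpan W x) → new x W + 𝟙 (inSpan? W x) ≡ 𝟙 (U? x)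
        split _ (yes x∈W) = trans (cong₂ _+_ (cong (_* 𝟙 (all? U? (x ∷ W))) (𝟙-no (iso? (x ∷ W)) (λ (_ , x∉W , _) → x∉W x∈W))) (𝟙-yes (inSpan? W x) x∈W))
                                  (sym (𝟙-yes (U? x) (U-span aW x∈W)))
        split (yes ux) (no x∉W) = trans (cong₂ _+_ (cong₂ _*_ (𝟙-yes (iso? (x ∷ W)) (gW , x∉W , U-pair aW ux)) (𝟙-yes (all? U? (x ∷ W)) (ux ∷ aW))) (𝟙-no (inSpan? W x) x∉W))
                                  (sym (𝟙-yes (U? x) ux))
        split (no ¬ux) (no x∉W) = trans (cong₂ _+_ (trans (cong (𝟙 (iso? (x ∷ W)) *_) (𝟙-no (all? U? (x ∷ W)) (λ { (ux ∷ _) → ¬ux ux }))) (ℕP.*-zeroʳ (𝟙 (iso? (x ∷ W))))) (𝟙-no (inSpan? W x) x∉W))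
                                  (sym (𝟙-no (U? x) ¬ux))

      no-extension : ∀ W → ¬ (Good isotropic W × All U W) → sumV (λ x → new x W) ≡ 0
      no-extension W ¬gaW = trans (∑-cong (elems (VE n)) (λ x → trans (sym (𝟙-× (iso? (x ∷ W)) (all? U? (x ∷ W))))
        (𝟙-no (iso? (x ∷ W) ×-dec all? U? (x ∷ W)) (λ { ((gW , _) , (_ ∷ aW)) → ¬gaW (gW , aW) })))) (∑-zero (elems (VE n)))

      by-cases : ∀ W (d : Dec (Good isotropic W)) → 𝟙 (iso? W) ≡ 𝟙 d → (e : Dec (All U W)) → 𝟙 (all? U? W) ≡ 𝟙 e →
        sumV (λ x → new x W) + old W * ℓ ^ k ≡ old W * #U
      by-cases W (yes gW) eq (yes aW) eq′ = begin
        sumV (λ x → new x W) + old W * ℓ ^ k                          ≡⟨ cong (λ z → sumV (λ x → new x W) + z * ℓ ^ k) old≡1 ⟩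
        sumV (λ x → new x W) + 1 * ℓ ^ k                              ≡⟨ cong (sumV (λ x → new x W) +_) (trans (ℕP.*-identityˡ _) (sym (span-size W (good⇒indep W gW)))) ⟩
        sumV (λ x → new x W) + sumV (λ x → 𝟙 (inSpan? W x))           ≡⟨ ∑-+ (elems (VE n)) _ _ ⟨
        sumV (λ x → new x W + 𝟙 (inSpan? W x))                        ≡⟨ ∑-cong (elems (VE n)) (extend W gW aW) ⟩
        #U                                                            ≡⟨ ℕP.*-identityˡ #U ⟨
        1 * #U                                                        ≡⟨ cong (_* #U) old≡1 ⟨
        old W * #U                                                    ∎
        where
        old≡1 : old W ≡ 1
        old≡1 = cong₂ _*_ eq eq′
      by-cases W (no ¬gW) eq e eq′ = trans (cong₂ _+_ (no-extension W (¬gW ∘ proj₁)) (cong (λ z → z * 𝟙 (all? U? W) * ℓ ^ k) eq)) (sym (cong (λ z → z * 𝟙 (all? U? W) * #U) eq))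
      by-cases W (yes gW) eq (no ¬aW) eq′ = trans (cong₂ _+_ (no-extension W (¬aW ∘ proj₂)) (cong (_* ℓ ^ k) old≡0)) (sym (cong (_* #U) old≡0))
        where
        old≡0 : old W ≡ 0
        old≡0 = cong₂ _*_ eq eq′

    #frames-vanishes : #frames (suc g) ≡ 0
    #frames-vanishes = ℕP.n≤0⇒n≡0 (ℕP.≤-trans (∑-mono (elems (frameEnum (suc g))) (λ W →
        ℕP.≤-trans (ℕP.*-monoʳ-≤ (𝟙 (iso? W)) (𝟙-≤1 (all? U? W))) (ℕP.≤-reflexive (ℕP.*-identityʳ _))))
      (ℕP.≤-reflexive #iso-vanishes))

    #U≡1 : ¬ (∃ λ x → x ≢ zeroVec × U x) → #U ≡ 1
    #U≡1 trivial = sum-single (VE n) U? zeroVec U-zero (λ x ux → zero? x ux (x ≟V zeroVec))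
      where
      zero? : ∀ x → U x → Dec (x ≡ zeroVec) → x ≡ zeroVec
      zero? x ux (yes e) = e
      zero? x ux (no ne) = contradiction (x , ne , ux) trivial

    #U≢1 : (∃ λ x → x ≢ zeroVec × U x) → #U ≢ 1
    #U≢1 (x , x≢0 , ux) eq = contradiction (subst (2 ≤_) eq 2≤#U) λ { (s≤s ()) }
      where
      2≤#U : 2 ≤ #U
      2≤#U = ℕP.≤-trans (ℕP.≤-reflexive (sym (trans (∑-+ (elems (VE n)) _ _) (cong₂ _+_ (once (VE n) zeroVec) (once (VE n) x)))))
        (∑-mono (elems (VE n)) λ y → below y (y ≟V zeroVec) (y ≟V x))
        where
        below : ∀ y (d : Dec (y ≡ zeroVec)) (e : Dec (y ≡ x)) → 𝟙 d + 𝟙 e ≤ 𝟙 (U? y)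
        below y (yes refl) (yes e)    = contradiction (sym e) x≢0
        below y (yes refl) (no _)     = ℕP.≤-reflexive (sym (𝟙-yes (U? y) U-zero))
        below y (no _)     (yes refl) = ℕP.≤-reflexive (sym (𝟙-yes (U? y) ux))
        below y (no _)     (no _)     = z≤n

    -- Since there are no frames of length g + 1, `frame-inversion` at g says that `#U` - 1 times
    -- the sum is zero. This decides the nontrivial case; if `U` is trivial the factor is zero
    -- itself, but then no nonempty frame exists and only the leading 1 remains.
    trivial-indicator : ℕ→ℚ (𝟙 (¬? nontrivial?)) ≡ 1ℚ ℚ.+ Σ₁ g (λ k → ℕ→ℚ (#frames k) ℚ.* Π₁ k invFactor)
    trivial-indicator = by-cases nontrivial?
      where
      recurrence : ∀ k → ℕ→ℚ (#frames (suc k)) ℚ.+ ℕ→ℚ (#frames k) ℚ.* pw ℓℚ k ≡ ℕ→ℚ (#frames k) ℚ.* ℕ→ℚ #U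
      recurrence k = begin
        ℕ→ℚ (#frames (suc k)) ℚ.+ ℕ→ℚ (#frames k) ℚ.* pw ℓℚ k
          ≡⟨ cong (λ z → ℕ→ℚ (#frames (suc k)) ℚ.+ ℕ→ℚ (#frames k) ℚ.* z) (ℕ→ℚ-^ ℓ k) ⟨
        ℕ→ℚ (#frames (suc k)) ℚ.+ ℕ→ℚ (#frames k) ℚ.* ℕ→ℚ (ℓ ^ k)
          ≡⟨ cong (ℕ→ℚ (#frames (suc k)) ℚ.+_) (sym (ℕ→ℚ-* (#frames k) (ℓ ^ k))) ⟩
        ℕ→ℚ (#frames (suc k)) ℚ.+ ℕ→ℚ (#frames k * ℓ ^ k)
          ≡⟨ ℕ→ℚ-+ (#frames (suc k)) (#frames k * ℓ ^ k) ⟨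
        ℕ→ℚ (#frames (suc k) + #frames k * ℓ ^ k)
          ≡⟨ cong ℕ→ℚ (#frames-suc k) ⟩
        ℕ→ℚ (#frames k * #U)
          ≡⟨ ℕ→ℚ-* (#frames k) #U ⟩
        ℕ→ℚ (#frames k) ℚ.* ℕ→ℚ #U ∎

      by-cases : (d : Dec (∃ λ x → x ≢ zeroVec × U x)) → ℕ→ℚ (𝟙 (¬? d)) ≡ 1ℚ ℚ.+ Σ₁ g (λ k → ℕ→ℚ (#frames k) ℚ.* Π₁ k invFactor)
      by-cases (yes nt) = sym (product-zero (ℕ→ℚ #U ℚ.- 1ℚ) _
          (λ e → #U≢1 nt (ℕ→ℚ-injective (trans (minus-zero (ℕ→ℚ #U) e) refl)))
          (trans (frame-inversion ℓℚ (ℕ→ℚ #U) invFactor (ℕ→ℚ ∘ #frames) invFactor-inverse refl recurrence g)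
            (trans (cong (λ z → ℕ→ℚ z ℚ.* Π₁ g invFactor) #frames-vanishes) (ℚP.*-zeroˡ (Π₁ g invFactor)))))
        where
        minus-zero : ∀ y → y ℚ.- 1ℚ ≡ 0ℚ → y ≡ 1ℚ
        minus-zero y e = trans (QS.solve 1 (λ y → y QS.:= (y QS.:- QS.:1) QS.:+ QS.:1) refl y) (trans (cong (ℚ._+ 1ℚ) e) (ℚP.+-identityˡ 1ℚ))
        product-zero : ∀ y z → y ≢ 0ℚ → y ℚ.* z ≡ 0ℚ → z ≡ 0ℚ
        product-zero y z y≢0 e = begin
          z                        ≡⟨ ℚP.*-identityˡ z ⟨
          1ℚ ℚ.* z                 ≡⟨ cong (ℚ._* z) (trans (ℚP.*-comm (inv y) y) (*-invʳ y y≢0)) ⟨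
          inv y ℚ.* y ℚ.* z        ≡⟨ trans (ℚP.*-assoc (inv y) y z) (cong (inv y ℚ.*_) e) ⟩
          inv y ℚ.* 0ℚ             ≡⟨ ℚP.*-zeroʳ (inv y) ⟩
          0ℚ                       ∎
      by-cases (no tr) = sym (trans (cong (1ℚ ℚ.+_) (trans (Σ₁≡psum g _) (trans (psum-cong g (λ k →
          trans (cong (λ z → ℕ→ℚ z ℚ.* Π₁ (suc k) invFactor) (no-frames k)) (ℚP.*-zeroˡ (Π₁ (suc k) invFactor)))) (psum-zero g)))) (ℚP.+-identityʳ 1ℚ))
        where
        psum-zero : ∀ m → psum m (λ _ → 0ℚ) ≡ 0ℚ
        psum-zero zero    = refl
        psum-zero (suc m) = trans (ℚP.+-identityʳ _) (psum-zero m)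

        no-frames : ∀ k → #frames (suc k) ≡ 0
        no-frames zero    = ℕP.+-cancelʳ-≡ 1 _ _ (trans (#frames-suc 0) (trans (ℕP.*-identityˡ #U) (#U≡1 tr)))
        no-frames (suc k) = ℕP.m+n≡0⇒m≡0 _ (trans (#frames-suc (suc k)) (cong (_* #U) (no-frames k)))

  -- Serves both cases of the theorem: with the fixed spaces of similitudes for q ≢ 1, and with the
  -- kernels of the matrices B for q ≡ 1. Isotropy is asked only of the M that are counted.
  module TrivialCount {P : Frame n → Set} (P? : ∀ M → Dec (P M))
    {U : Frame n → V → Set} (U? : ∀ M x → Dec (U M x))
    (U-zero : ∀ M → U M zeroVec) (U-lin : ∀ M a {x y} → U M x → U M y → U M (a *V x +V y))
    (U-iso : ∀ M → P M → ∀ {x y} → U M x → U M y → β x y ≡ 0F) where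

    nontrivial? : ∀ M → Dec (∃ λ x → x ≢ zeroVec × U M x)
    nontrivial? M = search (VE n) (λ x → ¬? (x ≟V zeroVec) ×-dec U? M x)

    #frames : ℕ → Frame n → ℕ
    #frames k M = sumFrames k (λ W → 𝟙 (iso? W) * 𝟙 (all? (U? M) W))

    trivial-count : ℕ→ℚ (sumFrames n (λ M → 𝟙 (P? M) * 𝟙 (¬? (nontrivial? M)))) ≡
      ℕ→ℚ (sumFrames n (λ M → 𝟙 (P? M))) ℚ.+ Σ₁ g (λ k → ℕ→ℚ (sumFrames n (λ M → 𝟙 (P? M) * #frames k M)) ℚ.* Π₁ k invFactor)
    trivial-count = ∑-expansion (elems (frameEnum n)) g _ _ (λ k M → 𝟙 (P? M) * #frames k M) (λ k → Π₁ k invFactor) (λ M → pointwise M (P? M))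
      where
      pointwise : ∀ M (d : Dec (P M)) → ℕ→ℚ (𝟙 d * 𝟙 (¬? (nontrivial? M))) ≡
        ℕ→ℚ (𝟙 d) ℚ.+ Σ₁ g (λ k → ℕ→ℚ (𝟙 d * #frames k M) ℚ.* Π₁ k invFactor)
      pointwise M (yes pM) = trans (cong ℕ→ℚ (ℕP.*-identityˡ (𝟙 (¬? (nontrivial? M))))) (trans (IsotropicSubspace.trivial-indicator S)
        (cong (1ℚ ℚ.+_) (Σ₁-cong g (λ k → cong (λ z → ℕ→ℚ z ℚ.* Π₁ k invFactor) (sym (ℕP.*-identityˡ (#frames k M)))))))
        where
        S : IsotropicSubspace
        S = record { U = U M ; U? = U? M ; U-zero = U-zero M ; U-lin = U-lin M ; U-iso = U-iso M pM }
      pointwise M (no _) = sym (trans (ℚP.+-identityˡ _) (Σ₁-zero g (λ k → ℚP.*-zeroˡ (Π₁ k invFactor))))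

tabulate-fill : ∀ {A : Set} n (h : ℕ → A) → Vec.tabulate {n = n} (λ i → h (toℕ i)) ≡ fill n h
tabulate-fill zero    h = refl
tabulate-fill (suc n) h = cong (h 0 ∷_) (tabulate-fill n (h ∘ suc))

map-fill : ∀ {A B : Set} (f : A → B) n h → Vec.map f (fill n h) ≡ fill n (f ∘ h)
map-fill f zero    h = refl
map-fill f (suc n) h = cong (f (h 0) ∷_) (map-fill f n (h ∘ suc))

-- Defs stores matrices by rows, while Frame n and _∙_ use columns; Vec.transpose passes between the two.
module RowMatrices (ℓ : ℕ) {{nz : NonZero ℓ}} (ℓ-prime : Prime ℓ) where
  open Vectors ℓ {{nz}}
  open Matrices ℓ {{nz}}
  open ≡-Reasoning

  rows·_ : ∀ {m n} → Vec (Vec F n) m → Vec F n → Vec F m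
  (rows· W) v = Vec.map (λ row → dot row v) W

  dot-lincomb : ∀ {m n} x (W : Vec (Vec F n) m) v → dot (lincomb x W) v ≡ dot x ((rows· W) v)
  dot-lincomb []      []      v = dot-zeroˡ v
  dot-lincomb (a ∷ x) (w ∷ W) v = trans (dot-+ˡ (a *V w) (lincomb x W) v) (cong₂ _+F_ (dot-*ˡ a w v) (dot-lincomb x W v))

  lincomb-zip-∷ : ∀ {m n} v (r : Vec F n) (T : Vec (Vec F m) n) → lincomb v (Vec.zipWith _∷_ r T) ≡ dot v r ∷ lincomb v T
  lincomb-zip-∷ []      []      []      = refl
  lincomb-zip-∷ (a ∷ v) (b ∷ r) (t ∷ T) = cong ((a *V (b ∷ t)) +V_) (lincomb-zip-∷ v r T)

  transpose-∷ : ∀ {m n} (r : Vec F n) (M : Vec (Vec F n) m) → Vec.transpose (r ∷ M) ≡ Vec.zipWith _∷_ r (Vec.transpose M)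
  transpose-∷ {n = n} r M = sym (zipWith-is-⊛ _∷_ r (Vec.transpose M))

  lincomb-transpose : ∀ {m n} (M : Vec (Vec F n) m) v → lincomb v (Vec.transpose M) ≡ (rows· M) v
  lincomb-transpose {n = n} []      v = empty (lincomb v (Vec.replicate n []))
    where
    empty : (w : Vec F 0) → w ≡ []
    empty [] = refl
  lincomb-transpose (r ∷ M) v = begin
    lincomb v (Vec.transpose (r ∷ M))                 ≡⟨ cong (lincomb v) (transpose-∷ r M) ⟩
    lincomb v (Vec.zipWith _∷_ r (Vec.transpose M))   ≡⟨ lincomb-zip-∷ v r (Vec.transpose M) ⟩
    dot v r ∷ lincomb v (Vec.transpose M)             ≡⟨ cong₂ _∷_ (dot-comm v r) (lincomb-transpose M v) ⟩
    dot r v ∷ (rows· M) v                             ∎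

  dot-adjoint : ∀ {m n} (M : Vec (Vec F n) m) x u → dot ((rows· M) x) u ≡ dot x ((rows· (Vec.transpose M)) u)
  dot-adjoint M x u = trans (cong (λ z → dot z u) (sym (lincomb-transpose M x))) (dot-lincomb x (Vec.transpose M) u)

  ⊗-· : ∀ {n} (A B : Mat n) v → (A ⊗ B) · v ≡ A · (B · v)
  ⊗-· A B v = trans (sym (map-∘ (λ row → dot row v) (λ row → Vec.map (λ col → dot row col) (Vec.transpose B)) A)) (map-cong row-wise A)
    where
    row-wise : ∀ row → dot (Vec.map (λ col → dot row col) (Vec.transpose B)) v ≡ dot row (B · v)
    row-wise row = begin
      dot (Vec.map (λ col → dot row col) (Vec.transpose B)) v   ≡⟨ cong (λ z → dot z v) (map-cong (dot-comm row) (Vec.transpose B)) ⟩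
      dot ((rows· (Vec.transpose B)) row) v                     ≡⟨ dot-comm _ v ⟩
      dot v ((rows· (Vec.transpose B)) row)                     ≡⟨ dot-adjoint B v row ⟨
      dot (B · v) row                                           ≡⟨ dot-comm (B · v) row ⟩
      dot row (B · v)                                           ∎

  scale-· : ∀ {n} c (A : Mat n) v → scale c A · v ≡ c *V (A · v)
  scale-· c A v = go A
    where
    go : ∀ {m} (W : Vec (Vec F _) m) → (rows· (Vec.map (Vec.map (c *F_)) W)) v ≡ c *V (rows· W) v
    go []      = refl
    go (w ∷ W) = cong₂ _∷_ (dot-*ˡ c w v) (go W)

  dot-ext : ∀ {n} (a b : Vec F n) → (∀ v → dot a v ≡ dot b v) → a ≡ b
  dot-ext []      []      eq = refl
  dot-ext (a ∷ u) (b ∷ v) eq = cong₂ _∷_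
    (trans (sym (head a u)) (trans (eq (1F ∷ zeroVec)) (head b v)))
    (dot-ext u v (λ w → trans (sym (tail a u w)) (trans (eq (0F ∷ w)) (tail b v w))))
    where
    head : ∀ {n} a (u : Vec F n) → dot (a ∷ u) (1F ∷ zeroVec) ≡ a
    head a u = trans (cong₂ _+F_ (R.*-identityʳ a) (dot-zeroʳ u)) (R.+-identityʳ a)
    tail : ∀ {n} a (u w : Vec F n) → dot (a ∷ u) (0F ∷ w) ≡ dot u w
    tail a u w = trans (cong (_+F dot u w) (R.zeroʳ a)) (R.+-identityˡ (dot u w))

  dot-extʳ : ∀ {n} (a b : Vec F n) → (∀ v → dot v a ≡ dot v b) → a ≡ b
  dot-extʳ a b eq = dot-ext a b (λ v → trans (dot-comm a v) (trans (eq v) (dot-comm v b)))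

  rows-ext : ∀ {m n} (A B : Vec (Vec F n) m) → (∀ v → (rows· A) v ≡ (rows· B) v) → A ≡ B
  rows-ext []      []      eq = refl
  rows-ext (a ∷ A) (b ∷ B) eq = cong₂ _∷_ (dot-ext a b (λ v → ∷-injectiveˡ (eq v))) (rows-ext A B (λ v → ∷-injectiveʳ (eq v)))

  ᵗ-injective : ∀ {n} {A B : Mat n} → ᵗ A ≡ ᵗ B → A ≡ B
  ᵗ-injective {A = A} {B} eq = rows-ext A B (λ v → trans (sym (lincomb-transpose A v)) (trans (cong (lincomb v) eq) (lincomb-transpose B v)))

  Σ< : ℕ → (ℕ → F) → F
  Σ< zero    h = 0F
  Σ< (suc m) h = h 0 +F Σ< m (h ∘ suc)

  Σ<-cong : ∀ m {h k} → (∀ i → i < m → h i ≡ k i) → Σ< m h ≡ Σ< m k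
  Σ<-cong zero    eq = refl
  Σ<-cong (suc m) eq = cong₂ _+F_ (eq 0 (s≤s z≤n)) (Σ<-cong m (λ i i<m → eq (suc i) (s≤s i<m)))

  Σ<-split : ∀ m k h → Σ< (m + k) h ≡ Σ< m h +F Σ< k (λ i → h (m + i))
  Σ<-split zero    k h = sym (R.+-identityˡ _)
  Σ<-split (suc m) k h = trans (cong (h 0 +F_) (Σ<-split m k (h ∘ suc))) (sym (R.+-assoc (h 0) _ _))

  Σ<-+ : ∀ m h k → Σ< m (λ i → h i +F k i) ≡ Σ< m h +F Σ< m k
  Σ<-+ zero    h k = sym (R.+-identityʳ 0F)
  Σ<-+ (suc m) h k = trans (cong ((h 0 +F k 0) +F_) (Σ<-+ m (h ∘ suc) (k ∘ suc)))
    (solve 4 (λ a b c d → (a :+ b) :+ (c :+ d) := (a :+ c) :+ (b :+ d)) refl (h 0) (k 0) (Σ< m (h ∘ suc)) (Σ< m (k ∘ suc)))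
    where open RS

  Σ<-neg : ∀ m h → Σ< m (λ i → -F h i) ≡ -F Σ< m h
  Σ<-neg zero    h = RS.solve 0 (RS.:0 RS.:= RS.:- RS.:0) refl
  Σ<-neg (suc m) h = trans (cong ((-F h 0) +F_) (Σ<-neg m (h ∘ suc)))
    (RS.solve 2 (λ a b → (RS.:- a) RS.:+ (RS.:- b) RS.:= RS.:- (a RS.:+ b)) refl (h 0) (Σ< m (h ∘ suc)))

  Σ<-zero : ∀ m {h} → (∀ i → i < m → h i ≡ 0F) → Σ< m h ≡ 0F
  Σ<-zero zero    eq = refl
  Σ<-zero (suc m) eq = trans (cong₂ _+F_ (eq 0 (s≤s z≤n)) (Σ<-zero m (λ i i<m → eq (suc i) (s≤s i<m)))) (R.+-identityʳ 0F)

  Σ<-single : ∀ m j {h} → j < m → (∀ i → i < m → i ≢ j → h i ≡ 0F) → Σ< m h ≡ h j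
  Σ<-single (suc m) zero    {h} _         eq = trans (cong (h 0 +F_) (Σ<-zero m (λ i i<m → eq (suc i) (s≤s i<m) λ ()))) (R.+-identityʳ (h 0))
  Σ<-single (suc m) (suc j) {h} (s≤s j<m) eq = trans (cong₂ _+F_ (eq 0 (s≤s z≤n) λ ()) (Σ<-single m j j<m (λ i i<m ne → eq (suc i) (s≤s i<m) (ne ∘ ℕP.suc-injective)))) (R.+-identityˡ (h (suc j)))

  _!_ : ∀ {n} → Vec F n → ℕ → F
  _!_ = at 0F

  dot-Σ< : ∀ {n} (u v : Vec F n) → dot u v ≡ Σ< n (λ i → (u ! i) *F (v ! i))
  dot-Σ< []      []      = refl
  dot-Σ< (a ∷ u) (b ∷ v) = cong ((a *F b) +F_) (dot-Σ< u v)

  at-zero : ∀ {m i} → (zeroVec {m}) ! i ≡ 0F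
  at-zero {zero}          = refl
  at-zero {suc m} {zero}  = refl
  at-zero {suc m} {suc i} = at-zero {m} {i}

  dot-unit-column : ∀ {n} i → i < n → (z : Vec F n) → dot (at zeroVec (unit-columns n) i) z ≡ z ! i
  dot-unit-column zero    (s≤s _)   (a ∷ z) = trans (cong₂ _+F_ (R.*-identityˡ a) (dot-zeroˡ z)) (R.+-identityʳ a)
  dot-unit-column {suc n} (suc i) (s≤s i<n) (a ∷ z) = begin
    dot (at zeroVec (Vec.map (0F ∷_) (unit-columns n)) i) (a ∷ z)   ≡⟨ cong (λ w → dot w (a ∷ z)) (at-map (0F ∷_) zeroVec zeroVec (unit-columns n) i<n) ⟩
    (0F *F a) +F dot (at zeroVec (unit-columns n) i) z               ≡⟨ trans (cong₂ _+F_ (R.zeroˡ a) (dot-unit-column i i<n z)) (R.+-identityˡ (z ! i)) ⟩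
    z ! i                                                           ∎

  unit-column-off : ∀ {n} j → j < n → ∀ i → i ≢ j → at zeroVec (unit-columns n) j ! i ≡ 0F
  unit-column-off zero    (s≤s _) zero    ne = contradiction refl ne
  unit-column-off {suc n} zero    (s≤s _) (suc i) ne = at-zero {n} {i}
  unit-column-off {suc n} (suc j) (s≤s j<n) i ne = trans (cong (_! i) (at-map (0F ∷_) zeroVec zeroVec (unit-columns n) j<n)) (shifted i ne)
    where
    shifted : ∀ i → i ≢ suc j → (0F ∷ at zeroVec (unit-columns n) j) ! i ≡ 0F
    shifted zero    ne = refl
    shifted (suc i) ne = unit-column-off j j<n i (ne ∘ cong suc)

  unit-column-on : ∀ {n} j → j < n → at zeroVec (unit-columns n) j ! j ≡ 1F
  unit-column-on zero    (s≤s _) = refl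
  unit-column-on {suc n} (suc j) (s≤s j<n) = trans (cong (_! suc j) (at-map (0F ∷_) zeroVec zeroVec (unit-columns n) j<n)) (unit-column-on j j<n)

-- The form Ω

module StandardForm (ℓ : ℕ) {{nz : NonZero ℓ}} (ℓ-prime : Prime ℓ) (g : ℕ) where
  open Vectors ℓ {{nz}}
  open Matrices ℓ {{nz}}
  open RowMatrices ℓ {{nz}} ℓ-prime public
  open ≡-Reasoning

  n : ℕ
  n = 2 * g

  g+g≡n : g + g ≡ n
  g+g≡n = cong (g +_) (sym (ℕP.+-identityʳ g))

  entry : ℕ → ℕ → F
  entry i j = if does (i ℕ.<? g) ∧ does (j ℕ.≟ i + g) then 1F
              else if does (j + g ℕ.≟ i) then -F 1F
              else 0F

  Ω-fill : Ω g ≡ fill n (λ i → fill n (entry i))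
  Ω-fill = trans (tabulate-cong (λ i → tabulate-fill n (entry (toℕ i)))) (tabulate-fill n (λ i → fill n (entry i)))

  J : Vec F n → Vec F n
  J y = Ω g · y

  J-! : ∀ y i → i < n → J y ! i ≡ Σ< n (λ j → entry i j *F (y ! j))
  J-! y i i<n = begin
    J y ! i                                              ≡⟨ cong (λ M → (M · y) ! i) Ω-fill ⟩
    (fill n (λ i → fill n (entry i)) · y) ! i            ≡⟨ cong (_! i) (map-fill (λ row → dot row y) n (λ i → fill n (entry i))) ⟩
    fill n (λ i → dot (fill n (entry i)) y) ! i          ≡⟨ at-fill 0F _ i<n ⟩
    dot (fill n (entry i)) y                             ≡⟨ dot-Σ< (fill n (entry i)) y ⟩
    Σ< n (λ j → (fill n (entry i) ! j) *F (y ! j))       ≡⟨ Σ<-cong n (λ j j<n → cong (_*F (y ! j)) (at-fill 0F (entry i) j<n)) ⟩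
    Σ< n (λ j → entry i j *F (y ! j))                    ∎

  entry-upper : ∀ i → i < g → entry i (i + g) ≡ 1F
  entry-upper i i<g = if-yes ((i ℕ.<? g) ×-dec (i + g ℕ.≟ i + g)) (i<g , refl)

  entry-upper-off : ∀ i j → i < g → j ≢ i + g → entry i j ≡ 0F
  entry-upper-off i j i<g ne = trans (if-no ((i ℕ.<? g) ×-dec (j ℕ.≟ i + g)) (ne ∘ proj₂))
    (if-no (j + g ℕ.≟ i) (λ e → ℕP.<-irrefl (sym e) (ℕP.<-≤-trans i<g (ℕP.m≤n+m g j))))

  entry-lower : ∀ i → entry (g + i) i ≡ -1F
  entry-lower i = trans (if-no ((g + i ℕ.<? g) ×-dec (i ℕ.≟ g + i + g)) (λ (lt , _) → ℕP.<⇒≱ lt (ℕP.m≤m+n g i)))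
    (if-yes (i + g ℕ.≟ g + i) (ℕP.+-comm i g))

  entry-lower-off : ∀ i j → j ≢ i → entry (g + i) j ≡ 0F
  entry-lower-off i j ne = trans (if-no ((g + i ℕ.<? g) ×-dec (j ℕ.≟ g + i + g)) (λ (lt , _) → ℕP.<⇒≱ lt (ℕP.m≤m+n g i)))
    (if-no (j + g ℕ.≟ g + i) (λ e → ne (ℕP.+-cancelʳ-≡ g j i (trans e (ℕP.+-comm g i)))))

  i<g⇒i<n : ∀ {i} → i < g → i < n
  i<g⇒i<n i<g = ℕP.<-≤-trans i<g (ℕP.m≤m+n g (g + 0))

  i<g⇒g+i<n : ∀ {i} → i < g → g + i < n
  i<g⇒g+i<n {i} i<g = subst (g + i <_) g+g≡n (ℕP.+-monoʳ-< g i<g)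

  J-upper : ∀ y i → i < g → J y ! i ≡ y ! (g + i)
  J-upper y i i<g = begin
    J y ! i                                  ≡⟨ J-! y i (i<g⇒i<n i<g) ⟩
    Σ< n (λ j → entry i j *F (y ! j))        ≡⟨ Σ<-single n (i + g) (subst (_< n) (ℕP.+-comm g i) (i<g⇒g+i<n i<g))
                                                  (λ j _ ne → trans (cong (_*F (y ! j)) (entry-upper-off i j i<g ne)) (R.zeroˡ (y ! j))) ⟩
    entry i (i + g) *F (y ! (i + g))         ≡⟨ trans (cong (_*F (y ! (i + g))) (entry-upper i i<g)) (R.*-identityˡ (y ! (i + g))) ⟩
    y ! (i + g)                              ≡⟨ cong (y !_) (ℕP.+-comm i g) ⟩
    y ! (g + i)                              ∎

  J-lower : ∀ y i → i < g → J y ! (g + i) ≡ -F (y ! i)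
  J-lower y i i<g = begin
    J y ! (g + i)                            ≡⟨ J-! y (g + i) (i<g⇒g+i<n i<g) ⟩
    Σ< n (λ j → entry (g + i) j *F (y ! j))  ≡⟨ Σ<-single n i (i<g⇒i<n i<g)
                                                  (λ j _ ne → trans (cong (_*F (y ! j)) (entry-lower-off i j ne)) (R.zeroˡ (y ! j))) ⟩
    entry (g + i) i *F (y ! i)               ≡⟨ cong (_*F (y ! i)) (entry-lower i) ⟩
    -1F *F (y ! i)                           ≡⟨ RS.solve 1 (λ a → (RS.:- RS.:1) RS.:* a RS.:= RS.:- a) refl (y ! i) ⟩
    -F (y ! i)                               ∎

  ω : Vec F n → Vec F n → F
  ω x y = dot x (J y)

  -- In these coordinates alternation and skewness hold term by term, in every characteristic.
  ω-Σ< : ∀ x y → ω x y ≡ Σ< g (λ i → ((x ! i) *F (y ! (g + i))) +F (-F ((x ! (g + i)) *F (y ! i))))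
  ω-Σ< x y = begin
    dot x (J y)                                   ≡⟨ dot-Σ< x (J y) ⟩
    Σ< n term                                     ≡⟨ cong (λ m → Σ< m term) g+g≡n ⟨
    Σ< (g + g) term                               ≡⟨ Σ<-split g g term ⟩
    Σ< g term +F Σ< g (λ i → term (g + i))        ≡⟨ Σ<-+ g term (λ i → term (g + i)) ⟨
    Σ< g (λ i → term i +F term (g + i))           ≡⟨ Σ<-cong g (λ i i<g → cong₂ _+F_ (cong ((x ! i) *F_) (J-upper y i i<g))
                                                       (trans (cong ((x ! (g + i)) *F_) (J-lower y i i<g))
                                                              (RS.solve 2 (λ a b → a RS.:* (RS.:- b) RS.:= RS.:- (a RS.:* b)) refl (x ! (g + i)) (y ! i)))) ⟩
    Σ< g (λ i → ((x ! i) *F (y ! (g + i))) +F (-F ((x ! (g + i)) *F (y ! i)))) ∎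
    where
    term : ℕ → F
    term i = (x ! i) *F (J y ! i)

  ω-alternating : ∀ x → ω x x ≡ 0F
  ω-alternating x = trans (ω-Σ< x x) (Σ<-zero g (λ i _ →
    RS.solve 2 (λ a b → a RS.:* b RS.:+ (RS.:- (b RS.:* a)) RS.:= RS.:0) refl (x ! i) (x ! (g + i))))

  ω-skew : ∀ x y → ω x y ≡ -F ω y x
  ω-skew x y = begin
    ω x y         ≡⟨ ω-Σ< x y ⟩
    Σ< g (λ i → ((x ! i) *F (y ! (g + i))) +F (-F ((x ! (g + i)) *F (y ! i))))
      ≡⟨ Σ<-cong g (λ i _ → RS.solve 4 (λ a b c d → a RS.:* b RS.:+ (RS.:- (c RS.:* d)) RS.:= RS.:- (d RS.:* c RS.:+ (RS.:- (b RS.:* a)))) refl (x ! i) (y ! (g + i)) (x ! (g + i)) (y ! i)) ⟩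
    Σ< g (λ i → -F (((y ! i) *F (x ! (g + i))) +F (-F ((y ! (g + i)) *F (x ! i)))))
      ≡⟨ Σ<-neg g _ ⟩
    -F Σ< g (λ i → ((y ! i) *F (x ! (g + i))) +F (-F ((y ! (g + i)) *F (x ! i))))
      ≡⟨ cong -F_ (ω-Σ< y x) ⟨
    -F ω y x      ∎

  J-injective-zero : ∀ x → J x ≡ zeroVec → x ≡ zeroVec
  J-injective-zero x Jx≡0 = at-ext 0F x zeroVec λ i i<n → trans (vanish i i<n (i ℕ.<? g)) (sym (at-zero {n} {i}))
    where
    Jx! : ∀ i → J x ! i ≡ 0F
    Jx! i = trans (cong (_! i) Jx≡0) (at-zero {n} {i})
    vanish : ∀ i → i < n → Dec (i < g) → x ! i ≡ 0F
    vanish i _ (yes i<g) = begin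
      x ! i               ≡⟨ RS.solve 1 (λ a → a RS.:= RS.:- (RS.:- a)) refl (x ! i) ⟩
      -F (-F (x ! i))     ≡⟨ cong -F_ (trans (sym (J-lower x i i<g)) (Jx! (g + i))) ⟩
      -F 0F               ≡⟨ RS.solve 0 (RS.:- RS.:0 RS.:= RS.:0) refl ⟩
      0F                  ∎
    vanish i i<n (no i≮g) = begin
      x ! i               ≡⟨ cong (x !_) g+o≡i ⟨
      x ! (g + o)         ≡⟨ J-upper x o o<g ⟨
      J x ! o             ≡⟨ Jx! o ⟩
      0F                  ∎
      where
      o = proj₁ (ℕP.m≤n⇒∃[o]m+o≡n (ℕP.≮⇒≥ i≮g))
      g+o≡i = proj₂ (ℕP.m≤n⇒∃[o]m+o≡n (ℕP.≮⇒≥ i≮g))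
      o<g : o < g
      o<g = ℕP.+-cancelˡ-< g o g (subst₂ _<_ (sym g+o≡i) (sym g+g≡n) i<n)

  ω-nondegenerate : ∀ x → (∀ y → ω x y ≡ 0F) → x ≡ zeroVec
  ω-nondegenerate x van = J-injective-zero x (dot-extʳ (J x) zeroVec λ v → begin
    ω v x          ≡⟨ ω-skew v x ⟩
    -F ω x v       ≡⟨ cong -F_ (van v) ⟩
    -F 0F          ≡⟨ RS.solve 0 (RS.:- RS.:0 RS.:= RS.:0) refl ⟩
    0F             ≡⟨ dot-zeroʳ v ⟨
    dot v zeroVec  ∎)

  form : SymplecticForm n
  form = record
    { β = ω ; β-+ˡ = λ u v w → dot-+ˡ u v (J w) ; β-*ˡ = λ c u w → dot-*ˡ c u (J w)
    ; β-alternating = ω-alternating ; β-skew = ω-skew ; β-nondegenerate = ω-nondegenerate }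

  private module S = Similitudes ℓ ℓ-prime n form g g+g≡n

  indep-gram⇒good : ∀ {τ m} (W : Vec (Vec F n) m) → S.Indep W →
    (∀ j d → suc (j + d) < m → ω (at zeroVec W (suc (j + d))) (at zeroVec W j) ≡ τ d) → S.Good τ W
  indep-gram⇒good []      _          gram = tt
  indep-gram⇒good {τ} {suc m} (x ∷ W) (iW , x∉W) gram = indep-gram⇒good W iW (λ j d lt → gram (suc j) d (s≤s lt)) , x∉W
    , at-ext 0F _ _ (λ d d<m → trans (S.at-pair W x d<m) (trans (gram 0 d (s≤s d<m)) (sym (at-fill 0F τ d<m))))

  -- For columns j and i = j + 1 + d, the entry of Ω is 0 if i < g; otherwise it is -1 exactly when
  -- i - g = j, that is, when d + 1 = g.
  unit-columns-good : S.Good S.σ (unit-columns n)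
  unit-columns-good = indep-gram⇒good (unit-columns n)
    (S.injective⇒indep (unit-columns n) (λ {a} {b} e → trans (sym (lincomb-unit-columns a)) (trans e (lincomb-unit-columns b))))
    (λ j d lt → trans (dot-unit-column (suc (j + d)) lt _) (gram j d lt (suc (j + d) ℕ.<? g)))
    where
    gram : ∀ j d → suc (j + d) < n → Dec (suc (j + d) < g) → J (at zeroVec (unit-columns n) j) ! suc (j + d) ≡ S.σ d
    gram j d lt (yes i<g) = begin
      J (at zeroVec (unit-columns n) j) ! suc (j + d)   ≡⟨ J-upper _ (suc (j + d)) i<g ⟩
      at zeroVec (unit-columns n) j ! (g + suc (j + d)) ≡⟨ unit-column-off j j<n _ (λ e → ℕP.<-irrefl (sym e) (ℕP.≤-trans (s≤s (ℕP.m≤m+n j d)) (ℕP.m≤n+m (suc (j + d)) g))) ⟩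
      0F                                                ≡⟨ S.σ-zero d (λ e → ℕP.<⇒≱ i<g (ℕP.≤-trans (ℕP.≤-reflexive (sym e)) (s≤s (ℕP.m≤n+m d j)))) ⟨
      S.σ d                                             ∎
      where j<n = ℕP.<-trans (s≤s (ℕP.m≤m+n j d)) lt
    gram j d lt (no i≮g) = begin
      J (at zeroVec (unit-columns n) j) ! suc (j + d)   ≡⟨ cong (J (at zeroVec (unit-columns n) j) !_) g+o≡i ⟨
      J (at zeroVec (unit-columns n) j) ! (g + o)       ≡⟨ J-lower _ o o<g ⟩
      -F (at zeroVec (unit-columns n) j ! o)            ≡⟨ compare (o ℕ.≟ j) ⟩
      S.σ d                                             ∎
      where
      j<n = ℕP.<-trans (s≤s (ℕP.m≤m+n j d)) lt
      o = proj₁ (ℕP.m≤n⇒∃[o]m+o≡n (ℕP.≮⇒≥ i≮g))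
      g+o≡i = proj₂ (ℕP.m≤n⇒∃[o]m+o≡n (ℕP.≮⇒≥ i≮g))
      o<g : o < g
      o<g = ℕP.+-cancelˡ-< g o g (subst₂ _<_ (sym g+o≡i) (sym g+g≡n) lt)
      compare : Dec (o ≡ j) → -F (at zeroVec (unit-columns n) j ! o) ≡ S.σ d
      compare (yes o≡j) = trans (cong (λ k → -F (at zeroVec (unit-columns n) j ! k)) o≡j) (trans (cong -F_ (unit-column-on j j<n))
        (sym (S.σ-one d (ℕP.+-cancelˡ-≡ j (suc d) g (trans (ℕP.+-suc j d) (trans (sym g+o≡i) (trans (cong (g +_) o≡j) (ℕP.+-comm g j))))))))
      compare (no o≢j) = trans (cong -F_ (unit-column-off j j<n o o≢j))
        (trans (RS.solve 0 (RS.:- RS.:0 RS.:= RS.:0) refl)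
          (sym (S.σ-zero d (λ e → o≢j (ℕP.+-cancelˡ-≡ g o j (trans g+o≡i (trans (sym (ℕP.+-suc j d)) (trans (cong (j +_) e) (ℕP.+-comm j g)))))))))

  InGSp⇒sim : ∀ q M → InGSp q g M → S.Sim (ι q) (ᵗ M)
  InGSp⇒sim q M eq x y = begin
    ω (lincomb x (ᵗ M)) (lincomb y (ᵗ M))            ≡⟨ cong₂ ω (lincomb-transpose M x) (lincomb-transpose M y) ⟩
    dot (M · x) (Ω g · (M · y))                      ≡⟨ dot-adjoint M x _ ⟩
    dot x ((ᵗ M) · (Ω g · (M · y)))                  ≡⟨ cong (λ z → dot x ((ᵗ M) · z)) (⊗-· (Ω g) M y) ⟨
    dot x ((ᵗ M) · ((Ω g ⊗ M) · y))                  ≡⟨ cong (dot x) (⊗-· (ᵗ M) (Ω g ⊗ M) y) ⟨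
    dot x (((ᵗ M) ⊗ (Ω g ⊗ M)) · y)                  ≡⟨ cong (λ A → dot x (A · y)) eq ⟩
    dot x (scale (ι q) (Ω g) · y)                    ≡⟨ cong (dot x) (scale-· (ι q) (Ω g) y) ⟩
    dot x (ι q *V J y)                               ≡⟨ dot-*ʳ (ι q) x (J y) ⟩
    ι q *F ω x y                                     ∎

  sim⇒InGSp : ∀ q M → S.Sim (ι q) (ᵗ M) → InGSp q g M
  sim⇒InGSp q M sim = rows-ext _ _ λ y → dot-extʳ _ _ λ x → begin
    dot x (((ᵗ M) ⊗ (Ω g ⊗ M)) · y)                  ≡⟨ cong (dot x) (⊗-· (ᵗ M) (Ω g ⊗ M) y) ⟩
    dot x ((ᵗ M) · ((Ω g ⊗ M) · y))                  ≡⟨ cong (λ z → dot x ((ᵗ M) · z)) (⊗-· (Ω g) M y) ⟩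
    dot x ((ᵗ M) · (Ω g · (M · y)))                  ≡⟨ dot-adjoint M x _ ⟨
    dot (M · x) (Ω g · (M · y))                      ≡⟨ cong₂ ω (lincomb-transpose M x) (lincomb-transpose M y) ⟨
    ω (lincomb x (ᵗ M)) (lincomb y (ᵗ M))            ≡⟨ sim x y ⟩
    ι q *F ω x y                                     ≡⟨ dot-*ʳ (ι q) x (J y) ⟨
    dot x (ι q *V J y)                               ≡⟨ cong (dot x) (scale-· (ι q) (Ω g) y) ⟨
    dot x (scale (ι q) (Ω g) · y)                    ∎

-- Linear maps, their matrices and inverses

module LinearMaps (ℓ : ℕ) {{nz : NonZero ℓ}} where
  open Vectors ℓ {{nz}}
  open Matrices ℓ {{nz}}
  open ≡-Reasoning

  Linear : ∀ {m n} → (Vec F m → Vec F n) → Set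
  Linear f = ∀ a x y → f (a *V x +V y) ≡ a *V f x +V f y

  linear-zero : ∀ {m n} (f : Vec F m → Vec F n) → Linear f → f zeroVec ≡ zeroVec
  linear-zero f lin = begin
    f zeroVec                          ≡⟨ cong f (trans (+V-comm _ zeroVec) (+V-inverseʳ zeroVec)) ⟨
    f (-1F *V zeroVec +V zeroVec)      ≡⟨ lin -1F zeroVec zeroVec ⟩
    -1F *V f zeroVec +V f zeroVec      ≡⟨ trans (+V-comm _ (f zeroVec)) (+V-inverseʳ (f zeroVec)) ⟩
    zeroVec                            ∎

  linear-lincomb : ∀ {k m n} (f : Vec F m → Vec F n) → Linear f → ∀ a (W : Vec (Vec F m) k) → lincomb a (Vec.map f W) ≡ f (lincomb a W)
  linear-lincomb f lin []      []      = sym (linear-zero f lin)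
  linear-lincomb f lin (a ∷ x) (w ∷ W) = trans (cong (a *V f w +V_) (linear-lincomb f lin x W)) (sym (lin a w (lincomb x W)))

  matrix : ∀ {m n} → (Vec F m → Vec F n) → Vec (Vec F n) m
  matrix f = Vec.map f (unit-columns _)

  matrix-∙ : ∀ {m n} (f : Vec F m → Vec F n) → Linear f → ∀ x → matrix f ∙ x ≡ f x
  matrix-∙ f lin x = trans (linear-lincomb f lin x (unit-columns _)) (cong f (lincomb-unit-columns x))

  ∙-linear : ∀ {m n} (C : Vec (Vec F n) m) → Linear (C ∙_)
  ∙-linear C a x y = trans (lincomb-+ (a *V x) y C) (cong (_+V C ∙ y) (lincomb-* a x C))

  rows-linear : ∀ {m n} (W : Vec (Vec F n) m) → Linear (λ v → Vec.map (λ row → dot row v) W)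
  rows-linear []      a x y = refl
  rows-linear (w ∷ W) a x y = cong₂ _∷_ (trans (dot-+ʳ w (a *V x) y) (cong (_+F dot w y) (dot-*ʳ a w x))) (rows-linear W a x y)

  ∘-linear : ∀ {k m n} (f : Vec F m → Vec F n) (h : Vec F k → Vec F m) → Linear f → Linear h → Linear (f ∘ h)
  ∘-linear f h lf lh a x y = trans (cong f (lh a x y)) (lf a (h x) (h y))

  +-linear : ∀ {m n} (f h : Vec F m → Vec F n) → Linear f → Linear h → Linear (λ x → f x +V h x)
  +-linear f h lf lh a x y = begin
    f (a *V x +V y) +V h (a *V x +V y)            ≡⟨ cong₂ _+V_ (lf a x y) (lh a x y) ⟩
    (a *V f x +V f y) +V (a *V h x +V h y)        ≡⟨ +V-interchange _ _ _ _ ⟩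
    (a *V f x +V a *V h x) +V (f y +V h y)        ≡⟨ cong (_+V (f y +V h y)) (*V-distribˡ a (f x) (h x)) ⟨
    a *V (f x +V h x) +V (f y +V h y)             ∎

  *V-comm : ∀ {n} a b (x : Vec F n) → a *V (b *V x) ≡ b *V (a *V x)
  *V-comm a b x = trans (sym (*V-assoc a b x)) (trans (cong (_*V x) (R.*-comm a b)) (*V-assoc b a x))

  *-linear : ∀ {m n} b (f : Vec F m → Vec F n) → Linear f → Linear (λ x → b *V f x)
  *-linear b f lf a x y = begin
    b *V f (a *V x +V y)              ≡⟨ cong (b *V_) (lf a x y) ⟩
    b *V (a *V f x +V f y)            ≡⟨ *V-distribˡ b (a *V f x) (f y) ⟩
    b *V (a *V f x) +V b *V f y       ≡⟨ cong (_+V b *V f y) (*V-comm b a (f x)) ⟩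
    a *V (b *V f x) +V b *V f y       ∎

  linear-injective : ∀ {m n} (f : Vec F m → Vec F n) → Linear f → (∀ x → f x ≡ zeroVec → x ≡ zeroVec) → ∀ {x y} → f x ≡ f y → x ≡ y
  linear-injective f lf ker {x} {y} eq = +V-cancelˡ (-1F *V y) (trans (ker (-1F *V y +V x) (begin
    f (-1F *V y +V x)       ≡⟨ lf -1F y x ⟩
    -1F *V f y +V f x       ≡⟨ trans (cong (-1F *V f y +V_) eq) (trans (+V-comm _ (f y)) (+V-inverseʳ (f y))) ⟩
    zeroVec                 ∎)) (sym (trans (+V-comm _ y) (+V-inverseʳ y))))

  module _ {n} (f : Vec F n → Vec F n) where
    private
      preimage : ∀ y → Dec (∃ λ x → f x ≡ y) → Vec F n
      preimage y (yes (x , _)) = x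
      preimage y (no _)        = zeroVec

    -- Obtained by exhaustive search, with value zero off the image. Being total, it allows the
    -- correspondence between M and B to be defined on all matrices, before anything is known to be
    -- invertible.
    pseudoinverse : Vec F n → Vec F n
    pseudoinverse y = preimage y (search (VE n) (λ x → f x ≟V y))

    module _ (inj : ∀ {x y} → f x ≡ f y → x ≡ y) where
      pseudoinverse-right : ∀ y → f (pseudoinverse y) ≡ y
      pseudoinverse-right y = check (search (VE n) (λ x → f x ≟V y))
        where
        check : (d : Dec (∃ λ x → f x ≡ y)) → f (preimage y d) ≡ y
        check (yes (_ , e)) = e
        check (no ¬e)       = contradiction (injective⇒surjective (VE n) f inj y) ¬e

      pseudoinverse-left : ∀ x → pseudoinverse (f x) ≡ x
      pseudoinverse-left x = inj (pseudoinverse-right (f x))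

      pseudoinverse-linear : Linear f → Linear pseudoinverse
      pseudoinverse-linear lf a x y = inj (begin
        f (pseudoinverse (a *V x +V y))                         ≡⟨ pseudoinverse-right _ ⟩
        a *V x +V y                                             ≡⟨ cong₂ (λ p q → a *V p +V q) (pseudoinverse-right x) (pseudoinverse-right y) ⟨
        a *V f (pseudoinverse x) +V f (pseudoinverse y)         ≡⟨ lf a (pseudoinverse x) (pseudoinverse y) ⟨
        f (a *V pseudoinverse x +V pseudoinverse y)             ∎)

      pseudoinverse-zero : Linear f → ∀ {y} → pseudoinverse y ≡ zeroVec → y ≡ zeroVec
      pseudoinverse-zero lf {y} e = trans (sym (pseudoinverse-right y)) (trans (cong f e) (linear-zero f lf))

  count-last-entries : ∀ d m {N} (eq : d + m ≡ N) (c : Vec F m) →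
    sumV {N} (λ y → 𝟙 (fill m (λ j → at 0F y (d + j)) ≟V c)) ≡ ℓ ^ d
  count-last-entries zero    m refl c = trans (∑-cong (elems (VE m)) (λ y → cong (λ z → 𝟙 (z ≟V c)) (fill-at 0F y))) (once (VE m) c)
  count-last-entries (suc d) m refl c = trans (sumV-suc {d + m} _)
    (trans (∑-cong (elems FE) (λ _ → count-last-entries d m refl c)) (sumF-const (ℓ ^ d)))

-- The matrices B with B - ᵗB = - Ω; those with trivial kernel correspond to the symplectic M
-- without eigenvalue 1 through B (M - 1) = Ω.
module SkewParts (ℓ : ℕ) {{nz : NonZero ℓ}} (ℓ-prime : Prime ℓ) (g : ℕ) where
  open StandardForm ℓ {{nz}} ℓ-prime g public
  open IsotropicSubspaces ℓ {{nz}} ℓ-prime n form g g+g≡n unit-columns-good public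
  open LinearMaps ℓ {{nz}} public
  open ≡-Reasoning

  SkewPart : Frame n → Set
  SkewPart B = ∀ u v → dot u (B ∙ v) ≡ dot v (B ∙ u) +F (-F ω u v)

  -- This is (ᵗB - Ω) v, the vectors stored in `B` being its columns; `SkewPart B` says that it
  -- agrees with `B ∙ v` for every v.
  partner : Frame n → V → V
  partner B v = (rows· B) v +V -1F *V J v

  partner-linear : ∀ B → Linear (partner B)
  partner-linear B = +-linear (rows· B) (λ v → -1F *V J v) (rows-linear B) (*-linear -1F J (rows-linear (Ω g)))

  dot-partner : ∀ B u v → dot u (partner B v) ≡ dot v (B ∙ u) +F (-F ω u v)
  dot-partner B u v = begin
    dot u ((rows· B) v +V -1F *V J v)             ≡⟨ dot-+ʳ u ((rows· B) v) (-1F *V J v) ⟩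
    dot u ((rows· B) v) +F dot u (-1F *V J v)     ≡⟨ cong₂ _+F_ (trans (sym (dot-lincomb u B v)) (dot-comm (lincomb u B) v)) (trans (dot-*ʳ -1F u (J v)) (RS.solve 1 (λ a → (RS.:- RS.:1) RS.:* a RS.:= RS.:- a) refl (ω u v))) ⟩
    dot v (B ∙ u) +F (-F ω u v)                   ∎

  e : ℕ → V
  e i = unit-columns n ‼ i

  SkewEntries : Frame n → Set
  SkewEntries B = ∀ i k → i < n → k < n → (B ‼ k) ! i ≡ ((B ‼ i) ! k) +F (-F ω (e i) (e k))

  dot-e : ∀ i → i < n → ∀ z → dot (e i) z ≡ z ! i
  dot-e i i<n z = dot-unit-column i i<n z

  ∙-e : ∀ (B : Frame n) k → k < n → B ∙ e k ≡ B ‼ k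
  ∙-e B k k<n = trans (sym (at-map (B ∙_) zeroVec zeroVec (unit-columns n) k<n)) (cong (_‼ k) (⊙-unit-columns B))

  skewPart⇒entries : ∀ B → SkewPart B → SkewEntries B
  skewPart⇒entries B sB i k i<n k<n = begin
    (B ‼ k) ! i                                   ≡⟨ trans (cong (dot (e i)) (∙-e B k k<n)) (dot-e i i<n (B ‼ k)) ⟨
    dot (e i) (B ∙ e k)                           ≡⟨ sB (e i) (e k) ⟩
    dot (e k) (B ∙ e i) +F (-F ω (e i) (e k))     ≡⟨ cong (_+F (-F ω (e i) (e k))) (trans (cong (dot (e k)) (∙-e B i i<n)) (dot-e k k<n (B ‼ i))) ⟩
    ((B ‼ i) ! k) +F (-F ω (e i) (e k))           ∎

  -- The entrywise equations identify `B` with the matrix of the linear map `partner B`, which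
  -- avoids expanding a double sum over coordinates.
  entries⇒skewPart : ∀ B → SkewEntries B → SkewPart B
  entries⇒skewPart B ent u v = begin
    dot u (B ∙ v)                          ≡⟨ cong (λ C → dot u (C ∙ v)) B≡partner ⟩
    dot u (matrix (partner B) ∙ v)         ≡⟨ cong (dot u) (matrix-∙ (partner B) (partner-linear B) v) ⟩
    dot u (partner B v)                    ≡⟨ dot-partner B u v ⟩
    dot v (B ∙ u) +F (-F ω u v)            ∎
    where
    B≡partner : B ≡ matrix (partner B)
    B≡partner = at-ext zeroVec _ _ λ k k<n → at-ext 0F _ _ λ i i<n → begin
      (B ‼ k) ! i                                ≡⟨ ent i k i<n k<n ⟩
      ((B ‼ i) ! k) +F (-F ω (e i) (e k))        ≡⟨ cong (_+F (-F ω (e i) (e k))) (trans (cong (dot (e k)) (∙-e B i i<n)) (dot-e k k<n (B ‼ i))) ⟨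
      dot (e k) (B ∙ e i) +F (-F ω (e i) (e k))  ≡⟨ dot-partner B (e i) (e k) ⟨
      dot (e i) (partner B (e k))                ≡⟨ dot-e i i<n (partner B (e k)) ⟩
      partner B (e k) ! i                        ≡⟨ cong (_! i) (at-map (partner B) zeroVec zeroVec (unit-columns n) k<n) ⟨
      (matrix (partner B) ‼ k) ! i               ∎

  -- The columns y ∷ Y are the last 1 + m ones, so that y sits in column n - (1 + m).
  SkewColumns : ∀ {m} → Frame m → Set
  SkewColumns []              = ⊤
  SkewColumns {suc m} (y ∷ Y) = SkewColumns Y ×
    fill m (λ j → y ! ((n ∸ m) + j)) ≡ fill m (λ j → ((Y ‼ j) ! (n ∸ suc m)) +F (-F σ j))

  skewColumns? : ∀ {m} (Y : Frame m) → Dec (SkewColumns Y)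
  skewColumns? []      = yes tt
  skewColumns? (y ∷ Y) = skewColumns? Y ×-dec (_ ≟V _)

  n∸m≡1+n∸1+m : ∀ {m} → m < n → n ∸ m ≡ suc (n ∸ suc m)
  n∸m≡1+n∸1+m m<n = ℕP.+-∸-assoc 1 m<n

  n∸1+m+suc : ∀ {m} → m < n → ∀ j → (n ∸ m) + j ≡ (n ∸ suc m) + suc j
  n∸1+m+suc {m} m<n j = trans (cong (_+ j) (n∸m≡1+n∸1+m m<n)) (sym (ℕP.+-suc (n ∸ suc m) j))

  -- Column j of `Y` sits at position n - m + j of the full matrix, so the left-hand entry lies d +
  -- 1 rows below the diagonal and the right-hand one is its mirror image.
  SubdiagonalEntries : ∀ {m} → Frame m → Set
  SubdiagonalEntries {m} Y = ∀ j d → suc (j + d) < m →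
    (Y ‼ j) ! ((n ∸ m) + suc (j + d)) ≡ ((Y ‼ suc (j + d)) ! ((n ∸ m) + j)) +F (-F σ d)

  columns⇒subdiagonal : ∀ {m} (Y : Frame m) → m ≤ n → SkewColumns Y → SubdiagonalEntries Y
  columns⇒subdiagonal {suc m} (y ∷ Y) m<n (sY , eq) zero d (s≤s d<m) = begin
    y ! ((n ∸ suc m) + suc d)                                        ≡⟨ cong (y !_) (n∸1+m+suc m<n d) ⟨
    y ! ((n ∸ m) + d)                                                ≡⟨ at-fill 0F (λ j → y ! ((n ∸ m) + j)) d<m ⟨
    fill m (λ j → y ! ((n ∸ m) + j)) ! d                             ≡⟨ cong (_! d) eq ⟩
    fill m (λ j → ((Y ‼ j) ! (n ∸ suc m)) +F (-F σ j)) ! d           ≡⟨ at-fill 0F _ d<m ⟩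
    ((Y ‼ d) ! (n ∸ suc m)) +F (-F σ d)                              ≡⟨ cong (λ p → ((Y ‼ d) ! p) +F (-F σ d)) (ℕP.+-identityʳ (n ∸ suc m)) ⟨
    ((Y ‼ d) ! ((n ∸ suc m) + 0)) +F (-F σ d)                        ∎
  columns⇒subdiagonal {suc m} (y ∷ Y) m<n (sY , eq) (suc j) d (s≤s lt) = begin
    (Y ‼ j) ! ((n ∸ suc m) + suc (suc (j + d)))                      ≡⟨ cong ((Y ‼ j) !_) (n∸1+m+suc m<n (suc (j + d))) ⟨
    (Y ‼ j) ! ((n ∸ m) + suc (j + d))                                ≡⟨ columns⇒subdiagonal Y (ℕP.<⇒≤ m<n) sY j d lt ⟩
    ((Y ‼ suc (j + d)) ! ((n ∸ m) + j)) +F (-F σ d)                  ≡⟨ cong (λ p → ((Y ‼ suc (j + d)) ! p) +F (-F σ d)) (n∸1+m+suc m<n j) ⟩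
    ((Y ‼ suc (j + d)) ! ((n ∸ suc m) + suc j)) +F (-F σ d)          ∎

  subdiagonal⇒columns : ∀ {m} (Y : Frame m) → m ≤ n → SubdiagonalEntries Y → SkewColumns Y
  subdiagonal⇒columns []              _   sub = tt
  subdiagonal⇒columns {suc m} (y ∷ Y) m<n sub =
      subdiagonal⇒columns Y (ℕP.<⇒≤ m<n) (λ j d lt → begin
        (Y ‼ j) ! ((n ∸ m) + suc (j + d))                                ≡⟨ cong ((Y ‼ j) !_) (n∸1+m+suc m<n (suc (j + d))) ⟩
        (Y ‼ j) ! ((n ∸ suc m) + suc (suc (j + d)))                      ≡⟨ sub (suc j) d (s≤s lt) ⟩
        ((Y ‼ suc (j + d)) ! ((n ∸ suc m) + suc j)) +F (-F σ d)          ≡⟨ cong (λ p → ((Y ‼ suc (j + d)) ! p) +F (-F σ d)) (n∸1+m+suc m<n j) ⟨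
        ((Y ‼ suc (j + d)) ! ((n ∸ m) + j)) +F (-F σ d)                  ∎)
    , fill-cong m (λ d d<m → begin
        y ! ((n ∸ m) + d)                                                ≡⟨ cong (y !_) (n∸1+m+suc m<n d) ⟩
        y ! ((n ∸ suc m) + suc d)                                        ≡⟨ sub 0 d (s≤s d<m) ⟩
        ((Y ‼ d) ! ((n ∸ suc m) + 0)) +F (-F σ d)                        ≡⟨ cong (λ p → ((Y ‼ d) ! p) +F (-F σ d)) (ℕP.+-identityʳ (n ∸ suc m)) ⟩
        ((Y ‼ d) ! (n ∸ suc m)) +F (-F σ d)                              ∎)

  ω-e : ∀ j d → suc (j + d) < n → ω (e (suc (j + d))) (e j) ≡ σ d
  ω-e j d lt = good-gram (unit-columns n) unit-columns-good j d lt

  -- The equations below the diagonal suffice: on the diagonal the condition is void because ω is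
  -- alternating, and above it the skewness of ω mirrors the equations below.
  skewColumns⇒skewPart : ∀ B → SkewColumns B → SkewPart B
  skewColumns⇒skewPart B sB = entries⇒skewPart B λ i k i<n k<n → by-cases i k i<n k<n (ℕP.<-cmp k i)
    where
    below : ∀ i k → i < n → k < i → (B ‼ k) ! i ≡ ((B ‼ i) ! k) +F (-F ω (e i) (e k))
    below i k i<n k<i = subst (λ i → i < n → (B ‼ k) ! i ≡ ((B ‼ i) ! k) +F (-F ω (e i) (e k))) (proj₂ o) at-offset i<n
      where
      o = ℕP.m≤n⇒∃[o]m+o≡n k<i
      d = proj₁ o
      at-offset : suc (k + d) < n → (B ‼ k) ! suc (k + d) ≡ ((B ‼ suc (k + d)) ! k) +F (-F ω (e (suc (k + d))) (e k))
      at-offset lt = begin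
        (B ‼ k) ! suc (k + d)                                     ≡⟨ cong (λ p → (B ‼ k) ! (p + suc (k + d))) (ℕP.n∸n≡0 n) ⟨
        (B ‼ k) ! ((n ∸ n) + suc (k + d))                         ≡⟨ columns⇒subdiagonal B ℕP.≤-refl sB k d lt ⟩
        ((B ‼ suc (k + d)) ! ((n ∸ n) + k)) +F (-F σ d)           ≡⟨ cong₂ (λ p s → ((B ‼ suc (k + d)) ! (p + k)) +F (-F s)) (ℕP.n∸n≡0 n) (sym (ω-e k d lt)) ⟩
        ((B ‼ suc (k + d)) ! k) +F (-F ω (e (suc (k + d))) (e k)) ∎
    by-cases : ∀ i k → i < n → k < n → _ → (B ‼ k) ! i ≡ ((B ‼ i) ! k) +F (-F ω (e i) (e k))
    by-cases i k i<n k<n (tri< k<i _ _)  = below i k i<n k<i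
    by-cases i k i<n k<n (tri≈ _ refl _) = begin
      (B ‼ k) ! k                               ≡⟨ RS.solve 1 (λ a → a RS.:= a RS.:+ (RS.:- RS.:0)) refl ((B ‼ k) ! k) ⟩
      ((B ‼ k) ! k) +F (-F 0F)                  ≡⟨ cong (λ s → ((B ‼ k) ! k) +F (-F s)) (ω-alternating (e k)) ⟨
      ((B ‼ k) ! k) +F (-F ω (e k) (e k))       ∎
    by-cases i k i<n k<n (tri> _ _ i<k)  = begin
      (B ‼ k) ! i                                                     ≡⟨ RS.solve 2 (λ a s → a RS.:= (a RS.:+ (RS.:- s)) RS.:+ (RS.:- (RS.:- s))) refl ((B ‼ k) ! i) (ω (e k) (e i)) ⟩
      (((B ‼ k) ! i) +F (-F ω (e k) (e i))) +F (-F (-F ω (e k) (e i)))  ≡⟨ cong₂ (λ a s → a +F (-F s)) (below k i k<n i<k) (ω-skew (e i) (e k)) ⟨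
      ((B ‼ i) ! k) +F (-F ω (e i) (e k))                             ∎

  skewPart⇒skewColumns : ∀ B → SkewPart B → SkewColumns B
  skewPart⇒skewColumns B sB = subdiagonal⇒columns B ℕP.≤-refl λ j d lt → begin
    (B ‼ j) ! ((n ∸ n) + suc (j + d))                         ≡⟨ cong (λ p → (B ‼ j) ! (p + suc (j + d))) (ℕP.n∸n≡0 n) ⟩
    (B ‼ j) ! suc (j + d)                                     ≡⟨ skewPart⇒entries B sB (suc (j + d)) j lt (ℕP.<-trans (s≤s (ℕP.m≤m+n j d)) lt) ⟩
    ((B ‼ suc (j + d)) ! j) +F (-F ω (e (suc (j + d))) (e j)) ≡⟨ cong₂ (λ p s → ((B ‼ suc (j + d)) ! (p + j)) +F (-F s)) (sym (ℕP.n∸n≡0 n)) (ω-e j d lt) ⟩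
    ((B ‼ suc (j + d)) ! ((n ∸ n) + j)) +F (-F σ d)           ∎

-- Counting the matrices B by their kernels

module SkewPartCounts (ℓ : ℕ) {{nz : NonZero ℓ}} (ℓ-prime : Prime ℓ) (g : ℕ) where
  open SkewParts ℓ {{nz}} ℓ-prime g public
  open ≡-Reasoning

  -- the congruence action B ↦ ᵗP B P: the rows of ᵗP are the columns stored in P
  conj : Frame n → Frame n → Frame n
  conj P B = Vec.map (λ p → (rows· P) (B ∙ p)) P

  conj-∙ : ∀ P B v → conj P B ∙ v ≡ (rows· P) (B ∙ (P ∙ v))
  conj-∙ P B v = linear-lincomb (λ p → (rows· P) (B ∙ p)) (∘-linear (rows· P) (B ∙_) (rows-linear P) (∙-linear B)) v P

  dot-conj : ∀ P B u v → dot u (conj P B ∙ v) ≡ dot (P ∙ u) (B ∙ (P ∙ v))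
  dot-conj P B u v = trans (cong (dot u) (conj-∙ P B v)) (sym (dot-lincomb u P (B ∙ (P ∙ v))))

  module _ (P : Frame n) (sP : Sim 1F P) where
    private
      P-preserves : ∀ u v → ω (P ∙ u) (P ∙ v) ≡ ω u v
      P-preserves u v = trans (sP u v) (R.*-identityˡ (ω u v))

      P-surjective : ∀ y → ∃ λ x → P ∙ x ≡ y
      P-surjective = sim-1-surjective {P} sP

    rows-P-injective : ∀ {y z} → (rows· P) y ≡ (rows· P) z → y ≡ z
    rows-P-injective {y} {z} eq = dot-extʳ y z λ v → begin
      dot v y                          ≡⟨ cong (λ w → dot w y) (proj₂ (P-surjective v)) ⟨
      dot (P ∙ proj₁ (P-surjective v)) y    ≡⟨ dot-lincomb (proj₁ (P-surjective v)) P y ⟩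
      dot (proj₁ (P-surjective v)) ((rows· P) y)  ≡⟨ cong (dot (proj₁ (P-surjective v))) eq ⟩
      dot (proj₁ (P-surjective v)) ((rows· P) z)  ≡⟨ dot-lincomb (proj₁ (P-surjective v)) P z ⟨
      dot (P ∙ proj₁ (P-surjective v)) z    ≡⟨ cong (λ w → dot w z) (proj₂ (P-surjective v)) ⟩
      dot v z                          ∎

    conj-injective : ∀ {B C} → conj P B ≡ conj P C → B ≡ C
    conj-injective {B} {C} eq = ∙-ext B C λ y → let x , Px≡y = P-surjective y in begin
      B ∙ y            ≡⟨ cong (B ∙_) Px≡y ⟨
      B ∙ (P ∙ x)      ≡⟨ rows-P-injective (trans (sym (conj-∙ P B x)) (trans (cong (_∙ x) eq) (conj-∙ P C x))) ⟩
      C ∙ (P ∙ x)      ≡⟨ cong (C ∙_) Px≡y ⟩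
      C ∙ y            ∎

    conj-skewPart⁺ : ∀ {B} → SkewPart B → SkewPart (conj P B)
    conj-skewPart⁺ {B} sB u v = begin
      dot u (conj P B ∙ v)                                          ≡⟨ dot-conj P B u v ⟩
      dot (P ∙ u) (B ∙ (P ∙ v))                                     ≡⟨ sB (P ∙ u) (P ∙ v) ⟩
      dot (P ∙ v) (B ∙ (P ∙ u)) +F (-F ω (P ∙ u) (P ∙ v))           ≡⟨ cong₂ (λ a b → a +F (-F b)) (sym (dot-conj P B v u)) (P-preserves u v) ⟩
      dot v (conj P B ∙ u) +F (-F ω u v)                            ∎

    conj-skewPart⁻ : ∀ {B} → SkewPart (conj P B) → SkewPart B
    conj-skewPart⁻ {B} sC u v = at-images (proj₁ (P-surjective u)) (proj₁ (P-surjective v)) (proj₂ (P-surjective u)) (proj₂ (P-surjective v))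
      where
      at-images : ∀ u′ v′ {u v} → P ∙ u′ ≡ u → P ∙ v′ ≡ v → dot u (B ∙ v) ≡ dot v (B ∙ u) +F (-F ω u v)
      at-images u′ v′ refl refl = begin
        dot (P ∙ u′) (B ∙ (P ∙ v′))                                   ≡⟨ dot-conj P B u′ v′ ⟨
        dot u′ (conj P B ∙ v′)                                        ≡⟨ sC u′ v′ ⟩
        dot v′ (conj P B ∙ u′) +F (-F ω u′ v′)                        ≡⟨ cong₂ (λ a b → a +F (-F b)) (dot-conj P B v′ u′) (sym (P-preserves u′ v′)) ⟩
        dot (P ∙ v′) (B ∙ (P ∙ u′)) +F (-F ω (P ∙ u′) (P ∙ v′))       ∎

    rows-P-zero : ∀ {z} → (rows· P) z ≡ zeroVec → z ≡ zeroVec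
    rows-P-zero {z} eq = rows-P-injective (trans eq (sym (linear-zero (rows· P) (rows-linear P))))

  Ker : Frame n → V → Set
  Ker B x = B ∙ x ≡ zeroVec

  ker? : ∀ B x → Dec (Ker B x)
  ker? B x = (B ∙ x) ≟V zeroVec

  ker-zero : ∀ B → Ker B zeroVec
  ker-zero B = lincomb-zero B

  ker-lin : ∀ B a {x y} → Ker B x → Ker B y → Ker B (a *V x +V y)
  ker-lin B a {x} {y} kx ky = trans (∙-linear B a x y) (trans (cong₂ (λ p q → a *V p +V q) kx ky) (trans (+V-identityʳ (a *V zeroVec)) (*V-zeroʳ a)))

  ker-iso : ∀ B → SkewColumns B → ∀ {x y} → Ker B x → Ker B y → ω x y ≡ 0F
  ker-iso B sB {x} {y} kx ky = begin
    ω x y                                                ≡⟨ RS.solve 1 (λ a → a RS.:= RS.:- (RS.:0 RS.:+ (RS.:- a))) refl (ω x y) ⟩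
    -F (0F +F (-F ω x y))                                ≡⟨ cong (λ a → -F (a +F (-F ω x y))) (trans (cong (dot y) kx) (dot-zeroʳ y)) ⟨
    -F (dot y (B ∙ x) +F (-F ω x y))                     ≡⟨ cong -F_ (skewColumns⇒skewPart B sB x y) ⟨
    -F dot x (B ∙ y)                                     ≡⟨ cong -F_ (trans (cong (dot x) ky) (dot-zeroʳ x)) ⟩
    -F 0F                                                ≡⟨ RS.solve 0 (RS.:- RS.:0 RS.:= RS.:0) refl ⟩
    0F                                                   ∎

  module Kernels = TrivialCount skewColumns? ker? ker-zero ker-lin ker-iso

  -- Once the last m columns are known, they force the m entries below the diagonal of the next
  -- column; its other n - m entries are free.
  entry-count : ℕ → ℕ
  entry-count m = ℓ ^ (n ∸ m)

  skew-completions : ℕ → ℕ → ℕ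
  skew-completions k d = prod-range entry-count k d

  sum-skew-by-suffix : ∀ {k d} (eq : d + k ≡ n) (f : Frame k → ℕ) →
    sumFrames n (λ B → 𝟙 (skewColumns? B) * f (suffix d eq B)) ≡ skew-completions k d * sumFrames k (λ W → 𝟙 (skewColumns? W) * f W)
  sum-skew-by-suffix {k} {d} eq f = sum-completions ℓ (VE n) (λ W → 𝟙 (skewColumns? W)) entry-count k d eq
    (λ i i<d W → extensions (subst (i + k <_) eq (ℕP.+-monoˡ-< k i<d)) W) f
    where
    extensions : ∀ {m} → m < n → (W : Frame m) → sumV (λ y → 𝟙 (skewColumns? (y ∷ W))) ≡ 𝟙 (skewColumns? W) * entry-count m
    extensions {m} m<n W = begin
      sumV (λ y → 𝟙 (skewColumns? (y ∷ W)))                                   ≡⟨ ∑-cong (elems (VE n)) (λ y → 𝟙-× (skewColumns? W) (new y ≟V target)) ⟩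
      sumV (λ y → 𝟙 (skewColumns? W) * 𝟙 (new y ≟V target))                   ≡⟨ ∑-*ˡ (elems (VE n)) (𝟙 (skewColumns? W)) _ ⟩
      𝟙 (skewColumns? W) * sumV (λ y → 𝟙 (new y ≟V target))                   ≡⟨ cong (𝟙 (skewColumns? W) *_) (count-last-entries (n ∸ m) m (ℕP.m∸n+n≡m (ℕP.<⇒≤ m<n)) target) ⟩
      𝟙 (skewColumns? W) * entry-count m                                      ∎
      where
      new : V → Vec F m
      new y = fill m (λ j → y ! ((n ∸ m) + j))
      target : Vec F m
      target = fill m (λ j → ((W ‼ j) ! (n ∸ suc m)) +F (-F σ j))

  #skew : sumFrames n (λ B → 𝟙 (skewColumns? B)) ≡ skew-completions 0 n
  #skew = begin
    sumFrames n (λ B → 𝟙 (skewColumns? B))       ≡⟨ ∑-cong (elems (frameEnum n)) (λ B → sym (ℕP.*-identityʳ _)) ⟩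
    sumFrames n (λ B → 𝟙 (skewColumns? B) * 1)   ≡⟨ sum-skew-by-suffix {0} {n} (ℕP.+-identityʳ n) (λ _ → 1) ⟩
    skew-completions 0 n * 1                     ≡⟨ ℕP.*-identityʳ _ ⟩
    skew-completions 0 n                         ∎

  zeroFrame : ∀ k → Frame k
  zeroFrame k = Vec.replicate k zeroVec

  zeroFrame-‼ : ∀ k j → zeroFrame k ‼ j ≡ zeroVec
  zeroFrame-‼ zero    j       = refl
  zeroFrame-‼ (suc k) zero    = refl
  zeroFrame-‼ (suc k) (suc j) = zeroFrame-‼ k j

  -- Zero columns violate the skew condition as soon as two of them are at distance g; fewer than
  -- that are chosen while k ≤ g.
  zeroFrame-skew : ∀ k → k ≤ g → SkewColumns (zeroFrame k)
  zeroFrame-skew zero    _   = tt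
  zeroFrame-skew (suc k) k<g = zeroFrame-skew k (ℕP.<⇒≤ k<g) , fill-cong k λ j j<k → begin
    zeroVec {n} ! ((n ∸ k) + j)                            ≡⟨ at-zero {n} {(n ∸ k) + j} ⟩
    0F                                                     ≡⟨ RS.solve 0 (RS.:0 RS.:= RS.:0 RS.:+ (RS.:- RS.:0)) refl ⟩
    0F +F (-F 0F)                                          ≡⟨ cong₂ (λ a b → a +F (-F b)) (sym (trans (cong (_! (n ∸ suc k)) (zeroFrame-‼ k j)) (at-zero {n} {n ∸ suc k})))
                                                                (sym (σ-zero j (ℕP.<⇒≢ (ℕP.≤-<-trans j<k k<g)))) ⟩
    ((zeroFrame k ‼ j) ! (n ∸ suc k)) +F (-F σ j)          ∎

  -- The number of pairs of a matrix B and an isotropic k-frame in its kernel, for k ≤ g. It is the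
  -- number of all B at k = 0 and the order of the symplectic group at k = g.
  T : ℕ → ℕ
  T k = #iso k * skew-completions k (n ∸ k)

  -- As for fixed frames, `W` is taken as the last k columns of a symplectic `P`. Then B kills `W`
  -- exactly when the last k columns of ᵗP B P vanish, and B ↦ ᵗP B P permutes the skew parts; so it
  -- is enough to count those ending in k zero columns.
  sum-kernel-frames : ∀ {k} → k ≤ g → sumFrames n (λ B → 𝟙 (skewColumns? B) * Kernels.#frames k B) ≡ T k
  sum-kernel-frames {k} k≤g = begin
    sumFrames n (λ B → 𝟙 (skewColumns? B) * sumFrames k (λ W → 𝟙 (iso? W) * 𝟙 (all? (ker? B) W)))
      ≡⟨ ∑-cong (elems (frameEnum n)) (λ B → sym (∑-*ˡ (elems (frameEnum k)) (𝟙 (skewColumns? B)) _)) ⟩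
    sumFrames n (λ B → sumFrames k (λ W → 𝟙 (skewColumns? B) * (𝟙 (iso? W) * 𝟙 (all? (ker? B) W))))
      ≡⟨ ∑-swap (elems (frameEnum n)) (elems (frameEnum k)) _ ⟩
    sumFrames k (λ W → sumFrames n (λ B → 𝟙 (skewColumns? B) * (𝟙 (iso? W) * 𝟙 (all? (ker? B) W))))
      ≡⟨ ∑-cong (elems (frameEnum k)) (λ W → trans (∑-cong (elems (frameEnum n)) (λ B → x∙yz≈y∙xz (𝟙 (skewColumns? B)) (𝟙 (iso? W)) _))
           (∑-*ˡ (elems (frameEnum n)) (𝟙 (iso? W)) _)) ⟩
    sumFrames k (λ W → 𝟙 (iso? W) * Ψ W)   ≡⟨ sum-isotropic-frames eq k≤g Ψ (skew-completions k d) Ψ-const ⟩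
    #iso k * skew-completions k d          ∎
    where
    d = n ∸ k
    eq : d + k ≡ n
    eq = ℕP.m∸n+n≡m (ℕP.≤-trans k≤g g≤n)

    Ψ : Frame k → ℕ
    Ψ W = sumFrames n (λ B → 𝟙 (skewColumns? B) * 𝟙 (all? (ker? B) W))

    Ψ-const : ∀ P → Good (1F ·σ) P → Ψ (suffix d eq P) ≡ skew-completions k d
    Ψ-const P gP = begin
      Ψ (suffix d eq P)
        ≡⟨ ∑-cong (elems (frameEnum n)) (λ B → cong₂ _*_
             (𝟙-cong (skewColumns? B) (skewColumns? (conj P B))
               (λ sB → skewPart⇒skewColumns (conj P B) (conj-skewPart⁺ P sP {B} (skewColumns⇒skewPart B sB)))
               (λ sC → skewPart⇒skewColumns B (conj-skewPart⁻ P sP {B} (skewColumns⇒skewPart (conj P B) sC))))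
             (trans (𝟙-cong (all? (ker? B) (suffix d eq P)) (Vec.map (λ p → (rows· P) (B ∙ p)) (suffix d eq P) ≟Fr zeroFrame k)
                      (ker⇒zero B (suffix d eq P)) (zero⇒ker B (suffix d eq P)))
                    (cong (λ z → 𝟙 (z ≟Fr zeroFrame k)) (sym (suffix-map (λ p → (rows· P) (B ∙ p)) d eq P))))) ⟩
      sumFrames n (λ B → 𝟙 (skewColumns? (conj P B)) * 𝟙 (suffix d eq (conj P B) ≟Fr zeroFrame k))
        ≡⟨ sum-reindex (frameEnum n) (conj P) (conj-injective P sP) (λ B → 𝟙 (skewColumns? B) * 𝟙 (suffix d eq B ≟Fr zeroFrame k)) ⟩
      sumFrames n (λ B → 𝟙 (skewColumns? B) * 𝟙 (suffix d eq B ≟Fr zeroFrame k))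
        ≡⟨ sum-skew-by-suffix eq (λ W → 𝟙 (W ≟Fr zeroFrame k)) ⟩
      skew-completions k d * sumFrames k (λ W → 𝟙 (skewColumns? W) * 𝟙 (W ≟Fr zeroFrame k))
        ≡⟨ cong (skew-completions k d *_) (∑-cong (elems (frameEnum k)) (λ W → ℕP.*-comm (𝟙 (skewColumns? W)) _)) ⟩
      skew-completions k d * sumFrames k (λ W → 𝟙 (W ≟Fr zeroFrame k) * 𝟙 (skewColumns? W))
        ≡⟨ cong (skew-completions k d *_) (sum-δ (frameEnum k) (zeroFrame k) (λ W → 𝟙 (skewColumns? W))) ⟩
      skew-completions k d * 𝟙 (skewColumns? (zeroFrame k))
        ≡⟨ cong (skew-completions k d *_) (𝟙-yes (skewColumns? (zeroFrame k)) (zeroFrame-skew k k≤g)) ⟩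
      skew-completions k d * 1
        ≡⟨ ℕP.*-identityʳ _ ⟩
      skew-completions k d ∎
      where
      sP = good⇒sim 1F P gP

      ker⇒zero : ∀ B {m} (W : Frame m) → All (Ker B) W → Vec.map (λ p → (rows· P) (B ∙ p)) W ≡ zeroFrame m
      ker⇒zero B []      []         = refl
      ker⇒zero B (w ∷ W) (kw ∷ all) = cong₂ _∷_ (trans (cong (rows· P) kw) (linear-zero (rows· P) (rows-linear P))) (ker⇒zero B W all)

      zero⇒ker : ∀ B {m} (W : Frame m) → Vec.map (λ p → (rows· P) (B ∙ p)) W ≡ zeroFrame m → All (Ker B) W
      zero⇒ker B []      _  = []
      zero⇒ker B (w ∷ W) eq = rows-P-zero P sP (∷-injectiveˡ eq) ∷ zero⇒ker B W (∷-injectiveʳ eq)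

  -- The correspondence between symplectic matrices without eigenvalue 1 and invertible B

  Fix : Frame n → V → Set
  Fix M x = M ∙ x ≡ x

  fix? : ∀ M x → Dec (Fix M x)
  fix? M x = (M ∙ x) ≟V x

  hasFixed? : ∀ M → Dec (∃ λ x → x ≢ zeroVec × Fix M x)
  hasFixed? M = search (VE n) (λ x → ¬? (x ≟V zeroVec) ×-dec fix? M x)

  J-linear : Linear J
  J-linear = rows-linear (Ω g)

  J-injective : ∀ {x y} → J x ≡ J y → x ≡ y
  J-injective = linear-injective J J-linear J-injective-zero

  -- With x = M u - u and y = M v - v, M is symplectic at (u , v) iff ω x v = ω y u - ω x y.
  sim⇔skew : ∀ {u v x y Mu Mv} → x +V u ≡ Mu → y +V v ≡ Mv →
    (ω Mu Mv ≡ ω u v → ω x v ≡ ω y u +F (-F ω x y)) × (ω x v ≡ ω y u +F (-F ω x y) → ω Mu Mv ≡ ω u v)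
  sim⇔skew {u} {v} {x} {y} refl refl =
      (λ e → begin
        ω x v                                                    ≡⟨ solve 4 (λ a b c d → b := (a :+ b :+ c :+ d) :- d :- c :- a) refl (ω x y) (ω x v) (ω u y) (ω u v) ⟩
        total ⊕ (-F ω u v) ⊕ (-F ω u y) ⊕ (-F ω x y)          ≡⟨ cong₂ (λ p q → p ⊕ (-F ω u v) ⊕ (-F q) ⊕ (-F ω x y)) (trans (sym expand) e) (ω-skew u y) ⟩
        ω u v ⊕ (-F ω u v) ⊕ (-F (-F ω y u)) ⊕ (-F ω x y)     ≡⟨ solve 3 (λ a b c → a :- a :- (:- b) :- c := b :- c) refl (ω u v) (ω y u) (ω x y) ⟩
        ω y u ⊕ (-F ω x y)                                      ∎)
    , (λ e → begin
        ω (x +V u) (y +V v)                                      ≡⟨ expand ⟩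
        ω x y ⊕ ω x v ⊕ ω u y ⊕ ω u v                         ≡⟨ cong₂ (λ p q → ω x y ⊕ p ⊕ q ⊕ ω u v) e (ω-skew u y) ⟩
        ω x y ⊕ (ω y u ⊕ (-F ω x y)) ⊕ (-F ω y u) ⊕ ω u v    ≡⟨ solve 3 (λ a b c → a :+ (b :- a) :- b :+ c := c) refl (ω x y) (ω y u) (ω u v) ⟩
        ω u v                                                    ∎)
    where
    open RS
    open R using () renaming (_+_ to infixl 6 _⊕_)
    total = ω x y ⊕ ω x v ⊕ ω u y ⊕ ω u v
    expand : ω (x +V u) (y +V v) ≡ total
    expand = begin
      ω (x +V u) (y +V v)                      ≡⟨ β-+ˡ x u (y +V v) ⟩
      ω x (y +V v) ⊕ ω u (y +V v)              ≡⟨ cong₂ _⊕_ (β-+ʳ x y v) (β-+ʳ u y v) ⟩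
      (ω x y ⊕ ω x v) ⊕ (ω u y ⊕ ω u v)        ≡⟨ R.+-assoc (ω x y ⊕ ω x v) (ω u y) (ω u v) ⟨
      total                                    ∎

  SpNoFix : Frame n → Set
  SpNoFix M = Good (1F ·σ) M × ¬ (∃ λ x → x ≢ zeroVec × Fix M x)

  spNoFix? : ∀ M → Dec (SpNoFix M)
  spNoFix? M = GSp? 1F M ×-dec ¬? (hasFixed? M)

  SkewNoKer : Frame n → Set
  SkewNoKer B = SkewColumns B × ¬ (∃ λ x → x ≢ zeroVec × Ker B x)

  skewNoKer? : ∀ B → Dec (SkewNoKer B)
  skewNoKer? B = skewColumns? B ×-dec ¬? (Kernels.nontrivial? B)

  trivial : ∀ {P : V → Set} → ¬ (∃ λ x → x ≢ zeroVec × P x) → ∀ x → P x → x ≡ zeroVec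
  trivial {P} none x px = by-cases (x ≟V zeroVec)
    where
    by-cases : Dec (x ≡ zeroVec) → x ≡ zeroVec
    by-cases (yes eq) = eq
    by-cases (no ne)  = contradiction (x , ne , px) none

  displace : Frame n → V → V
  displace M x = -1F *V x +V M ∙ x

  displace-+ : ∀ M x → displace M x +V x ≡ M ∙ x
  displace-+ M x = begin
    -1F *V x +V M ∙ x +V x        ≡⟨ trans (cong (_+V x) (+V-comm (-1F *V x) (M ∙ x))) (+V-assoc (M ∙ x) (-1F *V x) x) ⟩
    M ∙ x +V (-1F *V x +V x)      ≡⟨ cong (M ∙ x +V_) (trans (+V-comm (-1F *V x) x) (+V-inverseʳ x)) ⟩
    M ∙ x +V zeroVec              ≡⟨ +V-identityʳ (M ∙ x) ⟩
    M ∙ x                         ∎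

  displace-linear : ∀ M → Linear (displace M)
  displace-linear M = +-linear (-1F *V_) (M ∙_) (*-linear -1F id (λ _ _ _ → refl)) (∙-linear M)

  displace-injective : ∀ {M} → SpNoFix M → ∀ {x y} → displace M x ≡ displace M y → x ≡ y
  displace-injective {M} (_ , noFix) = linear-injective (displace M) (displace-linear M) λ x eq →
    trivial noFix x (trans (sym (displace-+ M x)) (trans (cong (_+V x) eq) (+V-identityˡ x)))

  B∙-injective : ∀ {B} → SkewNoKer B → ∀ {x y} → B ∙ x ≡ B ∙ y → x ≡ y
  B∙-injective {B} (_ , noKer) = linear-injective (B ∙_) (∙-linear B) (trivial noKer)

  -- Solving B (M - 1) = Ω for either matrix: B = Ω (M - 1)⁻¹ and M = B⁻¹ Ω + 1.
  toSkewMap toSpMap : Frame n → V → V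
  toSkewMap M = J ∘ pseudoinverse (displace M)
  toSpMap   B x = pseudoinverse (B ∙_) (J x) +V x

  toSkew toSp : Frame n → Frame n
  toSkew M = matrix (toSkewMap M)
  toSp   B = matrix (toSpMap B)

  toSkew-∙ : ∀ {M} → SpNoFix M → ∀ x → toSkew M ∙ x ≡ toSkewMap M x
  toSkew-∙ {M} sM = matrix-∙ (toSkewMap M)
    (∘-linear J (pseudoinverse (displace M)) J-linear (pseudoinverse-linear (displace M) (displace-injective sM) (displace-linear M)))

  toSp-∙ : ∀ {B} → SkewNoKer B → ∀ x → toSp B ∙ x ≡ toSpMap B x
  toSp-∙ {B} sB = matrix-∙ (toSpMap B) (+-linear (pseudoinverse (B ∙_) ∘ J) id
    (∘-linear (pseudoinverse (B ∙_)) J (pseudoinverse-linear (B ∙_) (B∙-injective sB) (∙-linear B)) J-linear) (λ _ _ _ → refl))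

  toSkew-good : ∀ {M} → SpNoFix M → SkewNoKer (toSkew M)
  toSkew-good {M} sM@(gM , _) = skewPart⇒skewColumns (toSkew M) skew , λ (x , x≢0 , kx) → x≢0
      (pseudoinverse-zero A A-injective (displace-linear M) (J-injective-zero _ (trans (sym (toSkew-∙ sM x)) kx)))
    where
    A = displace M
    A-injective : ∀ {x y} → A x ≡ A y → x ≡ y
    A-injective = displace-injective sM
    skew : SkewPart (toSkew M)
    skew x y = begin
      dot x (toSkew M ∙ y)                                  ≡⟨ cong (dot x) (toSkew-∙ sM y) ⟩
      ω x v                                                 ≡⟨ proj₁ (sim⇔skew {u} {v} {x} {y} (moves x) (moves y))
                                                                 (trans (good⇒sim 1F M gM u v) (R.*-identityˡ (ω u v))) ⟩
      ω y u +F (-F ω x y)                                   ≡⟨ cong (λ z → dot y z +F (-F ω x y)) (toSkew-∙ sM x) ⟨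
      dot y (toSkew M ∙ x) +F (-F ω x y)                    ∎
      where
      u = pseudoinverse A x
      v = pseudoinverse A y
      moves : ∀ x → x +V pseudoinverse A x ≡ M ∙ pseudoinverse A x
      moves x = trans (cong (_+V pseudoinverse A x) (sym (pseudoinverse-right A A-injective x))) (displace-+ M (pseudoinverse A x))

  toSp-good : ∀ {B} → SkewNoKer B → SpNoFix (toSp B)
  toSp-good {B} sB@(cB , _) = sim⇒good 1F (toSp B) 1F≢0F sim , λ (x , x≢0 , fx) → x≢0
      (J-injective-zero x (pseudoinverse-zero (B ∙_) B-injective (∙-linear B)
        (+V-cancelʳ x (trans (sym (toSp-∙ sB x)) (trans fx (sym (+V-identityˡ x)))))))
    where
    B-injective : ∀ {x y} → B ∙ x ≡ B ∙ y → x ≡ y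
    B-injective = B∙-injective sB
    sim : Sim 1F (toSp B)
    sim u v = begin
      ω (toSp B ∙ u) (toSp B ∙ v)     ≡⟨ proj₂ (sim⇔skew {u} {v} {x} {y} (sym (toSp-∙ sB u)) (sym (toSp-∙ sB v))) (begin
        ω x v                              ≡⟨ cong (dot x) (pseudoinverse-right (B ∙_) B-injective (J v)) ⟨
        dot x (B ∙ y)                      ≡⟨ skewColumns⇒skewPart B cB x y ⟩
        dot y (B ∙ x) +F (-F ω x y)        ≡⟨ cong (λ z → dot y z +F (-F ω x y)) (pseudoinverse-right (B ∙_) B-injective (J u)) ⟩
        ω y u +F (-F ω x y)                ∎) ⟩
      ω u v                           ≡⟨ R.*-identityˡ (ω u v) ⟨
      1F *F ω u v                     ∎
      where
      x = pseudoinverse (B ∙_) (J u)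
      y = pseudoinverse (B ∙_) (J v)

  toSkew-injective : ∀ {M N} → SpNoFix M → SpNoFix N → toSkew M ≡ toSkew N → M ≡ N
  toSkew-injective {M} {N} sM sN eq = ∙-ext M N λ x → begin
    M ∙ x                  ≡⟨ displace-+ M x ⟨
    displace M x +V x      ≡⟨ cong (_+V x) (same x) ⟩
    displace N x +V x      ≡⟨ displace-+ N x ⟩
    N ∙ x                  ∎
    where
    same : ∀ x → displace M x ≡ displace N x
    same x = begin
      displace M x                                              ≡⟨ pseudoinverse-right (displace N) (displace-injective sN) (displace M x) ⟨
      displace N (pseudoinverse (displace N) (displace M x))    ≡⟨ cong (displace N) (J-injective (trans (sym (toSkew-∙ sM (displace M x)))
                                                                     (trans (cong (_∙ displace M x) eq) (toSkew-∙ sN (displace M x))))) ⟨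
      displace N (pseudoinverse (displace M) (displace M x))    ≡⟨ cong (displace N) (pseudoinverse-left (displace M) (displace-injective sM) x) ⟩
      displace N x                                              ∎

  toSp-injective : ∀ {B C} → SkewNoKer B → SkewNoKer C → toSp B ≡ toSp C → B ≡ C
  toSp-injective {B} {C} sB sC eq = ∙-ext B C λ w → let z , Jz≡Bw = injective⇒surjective (VE n) J J-injective (B ∙ w) in begin
    B ∙ w                                   ≡⟨ Jz≡Bw ⟨
    J z                                     ≡⟨ pseudoinverse-right (C ∙_) (B∙-injective sC) (J z) ⟨
    C ∙ pseudoinverse (C ∙_) (J z)          ≡⟨ cong (C ∙_) (+V-cancelʳ z (trans (sym (toSp-∙ sB z)) (trans (cong (_∙ z) eq) (toSp-∙ sC z)))) ⟨
    C ∙ pseudoinverse (B ∙_) (J z)          ≡⟨ cong (λ y → C ∙ pseudoinverse (B ∙_) y) Jz≡Bw ⟩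
    C ∙ pseudoinverse (B ∙_) (B ∙ w)        ≡⟨ cong (C ∙_) (pseudoinverse-left (B ∙_) (B∙-injective sB) w) ⟩
    C ∙ w                                   ∎

  -- Injections in both directions between finite sets give equality without a check that they are
  -- mutually inverse.
  #spNoFix≡#skewNoKer : sumFrames n (λ M → 𝟙 (spNoFix? M)) ≡ sumFrames n (λ B → 𝟙 (skewNoKer? B))
  #spNoFix≡#skewNoKer = ℕP.≤-antisym
    (count-injection (frameEnum n) (frameEnum n) spNoFix? skewNoKer? toSkew toSkew-good toSkew-injective)
    (count-injection (frameEnum n) (frameEnum n) skewNoKer? spNoFix? toSp toSp-good toSp-injective)

Σ₁-cong-≤ : ∀ m {f h} → (∀ k → k ≤ m → f k ≡ h k) → Σ₁ m f ≡ Σ₁ m h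
Σ₁-cong-≤ zero    eq = refl
Σ₁-cong-≤ (suc m) eq = cong₂ ℚ._+_ (Σ₁-cong-≤ m (λ k k≤m → eq k (ℕP.m≤n⇒m≤1+n k≤m))) (eq (suc m) ℕP.≤-refl)

ratio-complement : ∀ E N G (S : ℚ) → G ≢ 0 → E + N ≡ G → ℕ→ℚ N ≡ ℕ→ℚ G ℚ.* (1ℚ ℚ.+ S) → ratio E G ≡ ℚ.- S
ratio-complement E N G S G≢0 E+N≡G eq = begin
  ratio E G                              ≡⟨ trans (sym (ℚP.*-identityʳ _)) (cong (ratio E G ℚ.*_) (sym (*-invʳ γ γ≢0))) ⟩
  ratio E G ℚ.* (γ ℚ.* inv γ)            ≡⟨ ℚP.*-assoc (ratio E G) γ (inv γ) ⟨
  ratio E G ℚ.* γ ℚ.* inv γ              ≡⟨ cong (ℚ._* inv γ) (trans (ratio-* E G G≢0) E≡) ⟩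
  γ ℚ.* (ℚ.- S) ℚ.* inv γ                ≡⟨ QS.solve 3 (λ γ S i → γ QS.:* (QS.:- S) QS.:* i QS.:= (γ QS.:* i) QS.:* (QS.:- S)) refl γ S (inv γ) ⟩
  γ ℚ.* inv γ ℚ.* (ℚ.- S)                ≡⟨ trans (cong (ℚ._* (ℚ.- S)) (*-invʳ γ γ≢0)) (ℚP.*-identityˡ _) ⟩
  ℚ.- S                                  ∎
  where
  open ≡-Reasoning
  γ = ℕ→ℚ G
  γ≢0 : γ ≢ 0ℚ
  γ≢0 e = G≢0 (ℕ→ℚ-injective e)
  E≡ : ℕ→ℚ E ≡ γ ℚ.* (ℚ.- S)
  E≡ = begin
    ℕ→ℚ E                                       ≡⟨ QS.solve 2 (λ e n → e QS.:= (e QS.:+ n) QS.:- n) refl (ℕ→ℚ E) (ℕ→ℚ N) ⟩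
    ℕ→ℚ E ℚ.+ ℕ→ℚ N ℚ.- ℕ→ℚ N                   ≡⟨ cong₂ ℚ._-_ (trans (sym (ℕ→ℚ-+ E N)) (cong ℕ→ℚ E+N≡G)) eq ⟩
    γ ℚ.- γ ℚ.* (1ℚ ℚ.+ S)                      ≡⟨ QS.solve 2 (λ γ S → γ QS.:- γ QS.:* (QS.:1 QS.:+ S) QS.:= γ QS.:* (QS.:- S)) refl γ S ⟩
    γ ℚ.* (ℚ.- S)                               ∎

-- The two cases of the theorem

module EigenvalueOne (ℓ : ℕ) {{nz : NonZero ℓ}} (ℓ-prime : Prime ℓ) (g q : ℕ) where
  open SkewPartCounts ℓ {{nz}} ℓ-prime g public
  open ≡-Reasoning

  order≢0 : order ≢ 0
  order≢0 = completions≢0 0 n (ℕP.≤-reflexive (ℕP.+-identityʳ n))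

  module _ (q≢0 : ι q ≢ 0F) where
    InGSp-columns : ∀ M → 𝟙 (InGSp? q g M) ≡ 𝟙 (GSp? (ι q) (ᵗ M))
    InGSp-columns M = 𝟙-cong (InGSp? q g M) (GSp? (ι q) (ᵗ M))
      (λ iM → sim⇒good (ι q) (ᵗ M) q≢0 (InGSp⇒sim q M iM))
      (λ gM → sim⇒InGSp q M (good⇒sim (ι q) (ᵗ M) gM))

    #noFix : ℕ
    #noFix = sumFrames n (λ C → 𝟙 (GSp? (ι q) C) * 𝟙 (¬? (hasFixed? C)))

    #GSp-order : #GSp q g ≡ order
    #GSp-order = begin
      #GSp q g                                      ≡⟨ length-filter-∑ (InGSp? q g) (allMats n) ⟩
      sumFrames n (λ M → 𝟙 (InGSp? q g M))          ≡⟨ ∑-cong (elems (frameEnum n)) InGSp-columns ⟩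
      sumFrames n (λ M → 𝟙 (GSp? (ι q) (ᵗ M)))      ≡⟨ sum-reindex (frameEnum n) ᵗ_ ᵗ-injective (λ C → 𝟙 (GSp? (ι q) C)) ⟩
      sumFrames n (λ C → 𝟙 (GSp? (ι q) C))          ≡⟨ #GSp≡order q≢0 ⟩
      order                                         ∎

    #GSpEig1-complement : #GSpEig1 q g + #noFix ≡ order
    #GSpEig1-complement = begin
      #GSpEig1 q g + #noFix
        ≡⟨ cong (_+ #noFix) (trans (length-filter-∑ (λ M → InGSp? q g M ×-dec HasEigenvalue1? M) (allMats n))
             (∑-cong (elems (frameEnum n)) (λ M → trans (𝟙-× (InGSp? q g M) (HasEigenvalue1? M)) (cong₂ _*_ (InGSp-columns M) (eigen-columns M))))) ⟩
      sumFrames n (λ M → 𝟙 (GSp? (ι q) (ᵗ M)) * 𝟙 (hasFixed? (ᵗ M))) + #noFix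
        ≡⟨ cong (_+ #noFix) (sum-reindex (frameEnum n) ᵗ_ ᵗ-injective (λ C → 𝟙 (GSp? (ι q) C) * 𝟙 (hasFixed? C))) ⟩
      sumFrames n (λ C → 𝟙 (GSp? (ι q) C) * 𝟙 (hasFixed? C)) + #noFix
        ≡⟨ ∑-+ (elems (frameEnum n)) _ _ ⟨
      sumFrames n (λ C → 𝟙 (GSp? (ι q) C) * 𝟙 (hasFixed? C) + 𝟙 (GSp? (ι q) C) * 𝟙 (¬? (hasFixed? C)))
        ≡⟨ ∑-cong (elems (frameEnum n)) (λ C → trans (sym (ℕP.*-distribˡ-+ (𝟙 (GSp? (ι q) C)) _ _)) (trans (cong (𝟙 (GSp? (ι q) C) *_) (𝟙-¬ (hasFixed? C))) (ℕP.*-identityʳ _))) ⟩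
      sumFrames n (λ C → 𝟙 (GSp? (ι q) C))
        ≡⟨ #GSp≡order q≢0 ⟩
      order ∎
      where
      eigen-columns : ∀ M → 𝟙 (HasEigenvalue1? M) ≡ 𝟙 (hasFixed? (ᵗ M))
      eigen-columns M = 𝟙-cong (HasEigenvalue1? M) (hasFixed? (ᵗ M))
        (λ (v , v≢0 , Mv≡v) → v , v≢0 , trans (lincomb-transpose M v) Mv≡v)
        (λ (v , v≢0 , Cv≡v) → v , v≢0 , trans (sym (lincomb-transpose M v)) Cv≡v)

    proportion : ∀ S → ℕ→ℚ #noFix ≡ ℕ→ℚ order ℚ.* (1ℚ ℚ.+ S) → 𝔔 q ℓ g ≡ ℚ.- S
    proportion S eq = trans (cong (ratio (#GSpEig1 q g)) #GSp-order) (ratio-complement (#GSpEig1 q g) #noFix order S order≢0 #GSpEig1-complement eq)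

  module NonsplitCase (q≢0 : ι q ≢ 0F) (q≢1 : ι q ≢ 1F) where
    fix-lin : ∀ M a {x y} → Fix M x → Fix M y → Fix M (a *V x +V y)
    fix-lin M a {x} {y} fx fy = trans (∙-linear M a x y) (cong₂ (λ p r → a *V p +V r) fx fy)

    -- For fixed vectors, ω x y = ω (M x) (M y) = q ω x y, and q - 1 is not zero in the field.
    fix-iso : ∀ M → Good (ι q ·σ) M → ∀ {x y} → Fix M x → Fix M y → ω x y ≡ 0F
    fix-iso M gM {x} {y} fx fy = zero? (Enumeration._≟_ FE (ω x y) 0F)
      where
      zero? : Dec (ω x y ≡ 0F) → ω x y ≡ 0F
      zero? (yes e) = e
      zero? (no ne) = contradiction (begin
        (ι q +F (-F 1F)) *F ω x y              ≡⟨ RS.solve 2 (λ c w → (c RS.:- RS.:1) RS.:* w RS.:= c RS.:* w RS.:- w) refl (ι q) (ω x y) ⟩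
        (ι q *F ω x y) +F (-F ω x y)           ≡⟨ cong (_+F (-F ω x y)) (trans (sym (good⇒sim (ι q) M gM x y)) (cong₂ ω fx fy)) ⟩
        ω x y +F (-F ω x y)                    ≡⟨ R.-‿inverseʳ (ω x y) ⟩
        0F                                     ∎)
        (*F-nonzero (λ e → q≢1 (begin
          ι q                       ≡⟨ RS.solve 1 (λ c → c RS.:= (c RS.:- RS.:1) RS.:+ RS.:1) refl (ι q) ⟩
          (ι q +F (-F 1F)) +F 1F    ≡⟨ cong (_+F 1F) e ⟩
          0F +F 1F                  ≡⟨ R.+-identityˡ 1F ⟩
          1F                        ∎)) ne)

    module Fixed = TrivialCount (GSp? (ι q)) fix? lincomb-zero fix-lin fix-iso

    all-fixed : ∀ M {k} (W : Frame k) → 𝟙 (all? (fix? M) W) ≡ 𝟙 ((M ⊙ W) ≟Fr W)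
    all-fixed M W = 𝟙-cong (all? (fix? M) W) ((M ⊙ W) ≟Fr W) (to W) (from W)
      where
      to : ∀ {k} (W : Frame k) → All (Fix M) W → M ⊙ W ≡ W
      to []      []         = refl
      to (w ∷ W) (fw ∷ all) = cong₂ _∷_ fw (to W all)
      from : ∀ {k} (W : Frame k) → M ⊙ W ≡ W → All (Fix M) W
      from []      _  = []
      from (w ∷ W) eq = ∷-injectiveˡ eq ∷ from W (∷-injectiveʳ eq)

    nonsplit : 𝔔 q ℓ g ≡ RHS-nonsplit ℓ g
    nonsplit = proportion q≢0 _ (begin
      ℕ→ℚ (#noFix q≢0)
        ≡⟨ Fixed.trivial-count ⟩
      ℕ→ℚ (sumFrames n (λ M → 𝟙 (GSp? (ι q) M))) ℚ.+ Σ₁ g (λ k → ℕ→ℚ (sumFrames n (λ M → 𝟙 (GSp? (ι q) M) * Fixed.#frames k M)) ℚ.* Π₁ k invFactor)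
        ≡⟨ cong₂ ℚ._+_ (cong ℕ→ℚ (#GSp≡order q≢0)) (Σ₁-cong-≤ g (λ k k≤g → cong (λ z → ℕ→ℚ z ℚ.* Π₁ k invFactor)
             (trans (∑-cong (elems (frameEnum n)) (λ M → cong (𝟙 (GSp? (ι q) M) *_) (∑-cong (elems (frameEnum k)) (λ W → cong (𝟙 (iso? W) *_) (all-fixed M W)))))
                    (sum-fixed-frames q≢0 k≤g)))) ⟩
      ℕ→ℚ order ℚ.+ Σ₁ g (λ k → ℕ→ℚ order ℚ.* Π₁ k invFactor)
        ≡⟨ cong (ℕ→ℚ order ℚ.+_) (Σ₁-* g (ℕ→ℚ order) (λ k → Π₁ k invFactor)) ⟩
      ℕ→ℚ order ℚ.+ ℕ→ℚ order ℚ.* Σ₁ g (λ k → Π₁ k invFactor)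
        ≡⟨ QS.solve 2 (λ a s → a QS.:+ a QS.:* s QS.:= a QS.:* (QS.:1 QS.:+ s)) refl (ℕ→ℚ order) (Σ₁ g (λ k → Π₁ k invFactor)) ⟩
      ℕ→ℚ order ℚ.* (1ℚ ℚ.+ Σ₁ g (λ k → Π₁ k invFactor)) ∎)

  r : ℚ
  r = inv ℓℚ

  r-inverse : r ℚ.* ℓℚ ≡ 1ℚ
  r-inverse = trans (ℚP.*-comm r ℓℚ) (*-invʳ ℓℚ (λ e → ℕ.≢-nonZero⁻¹ ℓ (ℕ→ℚ-injective e)))

  open GaussianIdentity ℓℚ r invFactor invFactor² r-inverse invFactor-inverse invFactor²-inverse

  -- Passing from k to k + 1 gains the factor ℓ^(n-k) - ℓ^k for the longer frame and loses the
  -- factor ℓ^(n-k) for the column of B that must now vanish.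
  T-step : ∀ k → k < g → T (suc k) * ℓ ^ (n ∸ k) ≡ T k * (ℓ ^ (n ∸ k) ∸ ℓ ^ k)
  T-step k k<g = begin
    #iso (suc k) * sc (suc k) (n ∸ suc k) * N            ≡⟨ cong (λ z → z * sc (suc k) (n ∸ suc k) * N) (#iso-suc k (ℕP.<⇒≤ k<n)) ⟩
    #iso k * D * sc (suc k) (n ∸ suc k) * N              ≡⟨ solve 4 (λ i D s N → i :* D :* s :* N := i :* (s :* N) :* D) refl (#iso k) D (sc (suc k) (n ∸ suc k)) N ⟩
    #iso k * (sc (suc k) (n ∸ suc k) * N) * D            ≡⟨ cong (λ z → #iso k * z * D) (prod-range-bottom entry-count k (n ∸ suc k)) ⟨
    #iso k * sc k (suc (n ∸ suc k)) * D                  ≡⟨ cong (λ z → #iso k * sc k z * D) (n∸m≡1+n∸1+m k<n) ⟨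
    #iso k * sc k (n ∸ k) * D                            ∎
    where
    open NS
    sc = skew-completions
    N = ℓ ^ (n ∸ k)
    D = ℓ ^ (n ∸ k) ∸ ℓ ^ k
    k<n : k < n
    k<n = ℕP.<-≤-trans k<g g≤n

  pw-+ : ∀ y i j → pw y (i + j) ≡ pw y i ℚ.* pw y j
  pw-+ y zero    j = sym (ℚP.*-identityˡ _)
  pw-+ y (suc i) j = trans (cong (y ℚ.*_) (pw-+ y i j)) (sym (ℚP.*-assoc y (pw y i) (pw y j)))

  -- Dividing `T-step` by ℓ^(n-k) leaves the factor 1 - ℓ^(2k-n), and n = 2g.
  T≡a : ∀ k → k ≤ g → ℕ→ℚ (T k) ≡ ℕ→ℚ (T 0) ℚ.* a g k
  T≡a zero    _   = sym (ℚP.*-identityʳ _)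
  T≡a (suc k) k<g = begin
    t′                                         ≡⟨ trans (sym (ℚP.*-identityʳ t′)) (cong (t′ ℚ.*_) (sym (pw-rx (n ∸ k)))) ⟩
    t′ ℚ.* (pw ℓℚ (n ∸ k) ℚ.* Rn)              ≡⟨ ℚP.*-assoc t′ _ Rn ⟨
    t′ ℚ.* pw ℓℚ (n ∸ k) ℚ.* Rn                ≡⟨ cong (ℚ._* Rn) step ⟩
    t ℚ.* (pw ℓℚ (n ∸ k) ℚ.- X) ℚ.* Rn         ≡⟨ QS.solve 4 (λ t p X R → t QS.:* (p QS.:- X) QS.:* R QS.:= t QS.:* (p QS.:* R QS.:- X QS.:* R)) refl t (pw ℓℚ (n ∸ k)) X Rn ⟩
    t ℚ.* (pw ℓℚ (n ∸ k) ℚ.* Rn ℚ.- X ℚ.* Rn)  ≡⟨ cong₂ (λ p s → t ℚ.* (p ℚ.- X ℚ.* s)) (pw-rx (n ∸ k)) Rn≡ ⟩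
    t ℚ.* (1ℚ ℚ.- X ℚ.* (X ℚ.* (G ℚ.* G)))     ≡⟨ cong₂ (λ p s → p ℚ.* (1ℚ ℚ.- s)) (T≡a k (ℕP.<⇒≤ k<g)) (QS.solve 2 (λ X G → X QS.:* (X QS.:* (G QS.:* G)) QS.:= (X QS.:* G) QS.:* (X QS.:* G)) refl X G) ⟩
    ℕ→ℚ (T 0) ℚ.* a g k ℚ.* (1ℚ ℚ.- (X ℚ.* G) ℚ.* (X ℚ.* G))  ≡⟨ ℚP.*-assoc (ℕ→ℚ (T 0)) (a g k) _ ⟩
    ℕ→ℚ (T 0) ℚ.* a g (suc k)                  ∎
    where
    t = ℕ→ℚ (T k)
    t′ = ℕ→ℚ (T (suc k))
    X = pw ℓℚ k
    G = pw r g
    Rn = pw r (n ∸ k)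
    k≤n : k ≤ n
    k≤n = ℕP.≤-trans (ℕP.<⇒≤ k<g) g≤n
    -- Makes the truncated difference of ℓ^(n-k) and ℓ^k a true one.
    k≤n∸k : k ≤ n ∸ k
    k≤n∸k = ℕP.m+n≤o⇒m≤o∸n k (subst (k + k ≤_) g+g≡n (ℕP.+-mono-≤ (ℕP.<⇒≤ k<g) (ℕP.<⇒≤ k<g)))

    Rn≡ : Rn ≡ X ℚ.* (G ℚ.* G)
    Rn≡ = begin
      Rn                              ≡⟨ trans (sym (ℚP.*-identityʳ Rn)) (cong (Rn ℚ.*_) (sym (pw-rx k))) ⟩
      Rn ℚ.* (X ℚ.* pw r k)           ≡⟨ QS.solve 3 (λ R X s → R QS.:* (X QS.:* s) QS.:= X QS.:* (R QS.:* s)) refl Rn X (pw r k) ⟩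
      X ℚ.* (Rn ℚ.* pw r k)           ≡⟨ cong (X ℚ.*_) (trans (sym (pw-+ r (n ∸ k) k)) (trans (cong (pw r) (trans (ℕP.m∸n+n≡m k≤n) (sym g+g≡n))) (pw-+ r g g))) ⟩
      X ℚ.* (G ℚ.* G)                 ∎

    step : t′ ℚ.* pw ℓℚ (n ∸ k) ≡ t ℚ.* (pw ℓℚ (n ∸ k) ℚ.- X)
    step = begin
      t′ ℚ.* pw ℓℚ (n ∸ k)                          ≡⟨ cong (t′ ℚ.*_) (sym (ℕ→ℚ-^ ℓ (n ∸ k))) ⟩
      t′ ℚ.* ℕ→ℚ (ℓ ^ (n ∸ k))                      ≡⟨ ℕ→ℚ-* (T (suc k)) (ℓ ^ (n ∸ k)) ⟨
      ℕ→ℚ (T (suc k) * ℓ ^ (n ∸ k))                 ≡⟨ cong ℕ→ℚ (T-step k k<g) ⟩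
      ℕ→ℚ (T k * (ℓ ^ (n ∸ k) ∸ ℓ ^ k))             ≡⟨ ℕ→ℚ-* (T k) (ℓ ^ (n ∸ k) ∸ ℓ ^ k) ⟩
      t ℚ.* ℕ→ℚ (ℓ ^ (n ∸ k) ∸ ℓ ^ k)               ≡⟨ cong (t ℚ.*_) difference ⟩
      t ℚ.* (pw ℓℚ (n ∸ k) ℚ.- X)                   ∎
      where
      D = ℓ ^ (n ∸ k) ∸ ℓ ^ k
      difference : ℕ→ℚ D ≡ pw ℓℚ (n ∸ k) ℚ.- X
      difference = begin
        ℕ→ℚ D                                       ≡⟨ QS.solve 2 (λ d e → d QS.:= (d QS.:+ e) QS.:- e) refl (ℕ→ℚ D) (ℕ→ℚ (ℓ ^ k)) ⟩
        ℕ→ℚ D ℚ.+ ℕ→ℚ (ℓ ^ k) ℚ.- ℕ→ℚ (ℓ ^ k)       ≡⟨ cong (ℚ._- ℕ→ℚ (ℓ ^ k)) (ℕ→ℚ-+ D (ℓ ^ k)) ⟨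
        ℕ→ℚ (D + ℓ ^ k) ℚ.- ℕ→ℚ (ℓ ^ k)             ≡⟨ cong (λ z → ℕ→ℚ z ℚ.- ℕ→ℚ (ℓ ^ k)) (ℕP.m∸n+n≡m (ℕP.^-monoʳ-≤ ℓ k≤n∸k)) ⟩
        ℕ→ℚ (ℓ ^ (n ∸ k)) ℚ.- ℕ→ℚ (ℓ ^ k)           ≡⟨ cong₂ ℚ._-_ (ℕ→ℚ-^ ℓ (n ∸ k)) (ℕ→ℚ-^ ℓ k) ⟩
        pw ℓℚ (n ∸ k) ℚ.- X                         ∎

  -- Once g columns are chosen, `step-count` and `entry-count` are the same power of ℓ, so
  -- completing an isotropic g-frame to a symplectic matrix and filling the remaining columns of B
  -- offer equally many choices.
  T-g : T g ≡ order
  T-g = begin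
    #iso g * skew-completions g (n ∸ g)      ≡⟨ cong (λ z → #iso g * skew-completions g z) n∸g≡g ⟩
    #iso g * skew-completions g g            ≡⟨ ℕP.*-comm (#iso g) _ ⟩
    skew-completions g g * #iso g            ≡⟨ cong (_* #iso g) (prod-range-cong {entry-count} {step-count} g g
                                                  (λ i _ → sym (if-no (i + g ℕ.<? g) (ℕP.≤⇒≯ (ℕP.m≤n+m g i))))) ⟩
    completions g g * #iso g                 ≡⟨ order≡completions*#iso g+g≡n ℕP.≤-refl ⟨
    order                                    ∎
    where
    n∸g≡g : n ∸ g ≡ g
    n∸g≡g = trans (cong (_∸ g) (sym g+g≡n)) (ℕP.m+n∸n≡m g g)

  split : (q≢0 : ι q ≢ 0F) → ι q ≡ 1F → 𝔔 q ℓ g ≡ RHS-split ℓ g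
  split q≢0 q≡1 = proportion q≢0 _ (begin
    ℕ→ℚ (#noFix q≢0)
      ≡⟨ cong ℕ→ℚ (begin
           #noFix q≢0                                                                  ≡⟨ cong (λ c → sumFrames n (λ C → 𝟙 (GSp? c C) * 𝟙 (¬? (hasFixed? C)))) q≡1 ⟩
           sumFrames n (λ C → 𝟙 (GSp? 1F C) * 𝟙 (¬? (hasFixed? C)))                    ≡⟨ ∑-cong (elems (frameEnum n)) (λ C → 𝟙-× (GSp? 1F C) (¬? (hasFixed? C))) ⟨
           sumFrames n (λ C → 𝟙 (spNoFix? C))                                          ≡⟨ #spNoFix≡#skewNoKer ⟩
           sumFrames n (λ B → 𝟙 (skewNoKer? B))                                        ≡⟨ ∑-cong (elems (frameEnum n)) (λ B → 𝟙-× (skewColumns? B) (¬? (Kernels.nontrivial? B))) ⟩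
           sumFrames n (λ B → 𝟙 (skewColumns? B) * 𝟙 (¬? (Kernels.nontrivial? B)))     ∎) ⟩
    ℕ→ℚ (sumFrames n (λ B → 𝟙 (skewColumns? B) * 𝟙 (¬? (Kernels.nontrivial? B))))
      ≡⟨ Kernels.trivial-count ⟩
    ℕ→ℚ (sumFrames n (λ B → 𝟙 (skewColumns? B))) ℚ.+ Σ₁ g (λ k → ℕ→ℚ (sumFrames n (λ B → 𝟙 (skewColumns? B) * Kernels.#frames k B)) ℚ.* Π₁ k invFactor)
      ≡⟨ cong₂ ℚ._+_ (cong ℕ→ℚ (trans #skew (sym (ℕP.*-identityˡ (skew-completions 0 n)))))
           (Σ₁-cong-≤ g (λ k k≤g → trans (cong (λ z → ℕ→ℚ z ℚ.* Π₁ k invFactor) (sum-kernel-frames k≤g))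
             (trans (cong (ℚ._* Π₁ k invFactor) (T≡a k k≤g))
               (QS.solve 3 (λ t a p → t QS.:* a QS.:* p QS.:= t QS.:* (p QS.:* a)) refl t₀ (a g k) (Π₁ k invFactor))))) ⟩
    t₀ ℚ.+ Σ₁ g (λ k → t₀ ℚ.* (Π₁ k invFactor ℚ.* a g k))
      ≡⟨ cong (t₀ ℚ.+_) (Σ₁-* g t₀ (λ k → Π₁ k invFactor ℚ.* a g k)) ⟩
    t₀ ℚ.+ t₀ ℚ.* Σ₁ g (λ k → Π₁ k invFactor ℚ.* a g k)
      -- The leading 1 is written as `1ℚ ℚ.* 1ℚ` because this is, by definition, the term k = 0 of
      -- `A g`.
      ≡⟨ QS.solve 2 (λ t s → t QS.:+ t QS.:* s QS.:= t QS.:* (QS.:1 QS.:* QS.:1 QS.:+ s)) refl t₀ (Σ₁ g (λ k → Π₁ k invFactor ℚ.* a g k)) ⟩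
    t₀ ℚ.* (1ℚ ℚ.* 1ℚ ℚ.+ Σ₁ g (λ k → Π₁ k invFactor ℚ.* a g k))
      ≡⟨ cong (λ z → t₀ ℚ.* (1ℚ ℚ.* 1ℚ ℚ.+ z)) (Σ₁≡psum g (λ k → Π₁ k invFactor ℚ.* a g k)) ⟩
    t₀ ℚ.* (1ℚ ℚ.* 1ℚ ℚ.+ psum g (λ k → Π₁ (suc k) invFactor ℚ.* a g (suc k)))
      ≡⟨ cong (t₀ ℚ.*_) (psum-shift g (λ k → Π₁ k invFactor ℚ.* a g k)) ⟨
    t₀ ℚ.* A g
      ≡⟨ cong (t₀ ℚ.*_) (A-closed-form g) ⟩
    t₀ ℚ.* (a g g ℚ.* (1ℚ ℚ.+ Σ₁ g (λ k → pw ℓℚ k ℚ.* Π₁ k invFactor²)))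
      ≡⟨ ℚP.*-assoc t₀ (a g g) _ ⟨
    t₀ ℚ.* a g g ℚ.* (1ℚ ℚ.+ Σ₁ g (λ k → pw ℓℚ k ℚ.* Π₁ k invFactor²))
      ≡⟨ cong₂ (λ p s → p ℚ.* (1ℚ ℚ.+ s)) (trans (sym (T≡a g ℕP.≤-refl)) (cong ℕ→ℚ T-g))
           (Σ₁-cong g (λ k → cong (ℚ._* Π₁ k invFactor²) (sym (ℕ→ℚ-^ ℓ k)))) ⟩
    ℕ→ℚ order ℚ.* (1ℚ ℚ.+ Σ₁ g (λ k → ℕ→ℚ (ℓ ^ k) ℚ.* Π₁ k invFactor²)) ∎)
    where t₀ = ℕ→ℚ (T 0)

theorem5p3 : (q ℓ g : ℕ) → {{_ : NonZero ℓ}} →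
    IsPrimePower q → Prime ℓ → ¬ (ℓ ∣ q) →
    (ℓ ∣ (q ∸ 1) → 𝔔 q ℓ g ≡ RHS-split ℓ g) ×
    (¬ (ℓ ∣ (q ∸ 1)) → 𝔔 q ℓ g ≡ RHS-nonsplit ℓ g)
theorem5p3 q ℓ g _ ℓ-prime ℓ∤q =
    (λ ℓ∣q-1 → split q≢0 (trans q≡q-1+1 (trans (cong (_+F 1F) (trans (ι-cong% (trans (n∣m⇒m%n≡0 (q ∸ 1) ℓ ℓ∣q-1) (sym (m*n%n≡0 0 ℓ)))) refl)) (R.+-identityˡ 1F))))
  , (λ ℓ∤q-1 → NonsplitCase.nonsplit q≢0 (λ q≡1 → ℓ∤q-1 (m%n≡0⇒n∣m (q ∸ 1) ℓ (ι≡0⇒%≡0 (q-1≡0 q≡1)))))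
  where
  open EigenvalueOne ℓ ℓ-prime g q

  q≢0 : ι q ≢ 0F
  q≢0 e = ℓ∤q (m%n≡0⇒n∣m q ℓ (ι≡0⇒%≡0 e))

  -- Makes `q ∸ 1` a true difference; q = 0 is excluded because ℓ would divide it.
  1≤q : 1 ≤ q
  1≤q = ℕP.n≢0⇒n>0 (λ q≡0 → q≢0 (cong ι q≡0))

  q≡q-1+1 : ι q ≡ ι (q ∸ 1) +F 1F
  q≡q-1+1 = trans (cong ι (sym (ℕP.m∸n+n≡m 1≤q))) (sym (ι-+ (q ∸ 1) 1))

  q-1≡0 : ι q ≡ 1F → ι (q ∸ 1) ≡ 0F
  q-1≡0 q≡1 = begin
    ι (q ∸ 1)                          ≡⟨ RS.solve 1 (λ a → a RS.:= (a RS.:+ RS.:1) RS.:- RS.:1) refl (ι (q ∸ 1)) ⟩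
    (ι (q ∸ 1) +F 1F) +F (-F 1F)       ≡⟨ cong (_+F (-F 1F)) (trans (sym q≡q-1+1) q≡1) ⟩
    1F +F (-F 1F)                      ≡⟨ R.-‿inverseʳ 1F ⟩
    0F                                 ∎
    where open ≡-Reasoning
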